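{- Suppose $M$ is a dense linear order with no first nor last element, $M$ is a suborder of the reals, and for every perfect set $P$ of reals the set $P\cap|M|$ is countable, or even only of cardinality $<2^{\aleph_0}$. Then the monadic theory of $M$ is the monadic theory of the rationals $(\mathbb{Q},<)$.
   Context: $|M|$ is the universe of $M$; structures are nonempty. In this paper a perfect set means a closed, nowhere dense set of reals with no isolated points and at least two points. The monadic theory of an order is the set of sentences of monadic second-order logic (first-order logic with quantification over arbitrary subsets of the universe) in the language $\{<\}$ that are true in it. -}

module Defs where

open import Data.Bool.Base using (Bool; T; _∧_)
open import Data.Fin.Base using (Fin)
open import Data.Nat.Base using (ℕ; suc)
open import Data.Product.Base using (∃; ∃-syntax; _×_; proj₁)
open import Data.Rational.Base as ℚ using (ℚ)
open import Data.Vec.Base using (Vec; []; _∷_; lookup)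
open import Function.Bundles using (_↣_)
open import Level using (0ℓ)
open import Relation.Binary.Core using (Rel)
open import Relation.Binary.PropositionalEquality.Core using (_≡_; _≢_)
open import Relation.Nullary.Negation.Core using (¬_)
open import Relation.Unary using (Pred)

-- All notions are meant to be read in classical mathematics: they are used
-- under ExcludedMiddle 0ℓ and Extensionality 0ℓ 0ℓ.  Since the stdlib's
-- ExcludedMiddle decides every type, and not only the propositions, it yields
-- an element of every type that is not empty, and so also the axiom of choice.

infix 4 _∈_ _<ᶜ_ _<ℝ_ _⊨_

-- Under excluded middle every predicate is decidable, so the Bool-valued
-- functions are all the subsets; by extensionality, two subsets with the same
-- elements are equal.

Subset : Set → Set
Subset A = A → Bool

_∈_ : {A : Set} → A → Subset A → Set
x ∈ P = T (P x)

_∩_ : {A : Set} → Subset A → Subset A → Subset A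
(P ∩ Q) x = P x ∧ Q x

Elements : {A : Set} → Subset A → Set
Elements P = ∃ λ x → x ∈ P

-- Strict comparison of cardinalities.

_<ᶜ_ : Set → Set → Set
A <ᶜ B = (A ↣ B) × ¬ (B ↣ A)

-- A real number is a Dedekind cut, given by its lower half.  The conditions on
-- the cut are irrelevant, so that reals with the same lower half are equal.

record ℝ : Set where
  constructor cut
  field
    lower       : Subset ℚ
    .inhabited  : ∃[ q ] q ∈ lower
    .bounded    : ∃[ q ] ¬ (q ∈ lower)
    .downClosed : ∀ p q → p ℚ.< q → q ∈ lower → p ∈ lower
    .noGreatest : ∀ p → p ∈ lower → ∃[ q ] (p ℚ.< q × q ∈ lower)

open ℝ public using (lower)

_<ℝ_ : Rel ℝ 0ℓ
x <ℝ y = ∃[ q ] (¬ (q ∈ lower x) × q ∈ lower y)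

Between : ℝ → ℝ → ℝ → Set
Between a b x = a <ℝ x × x <ℝ b

Closure : Subset ℝ → Pred ℝ 0ℓ
Closure P x = ∀ a b → Between a b x → ∃[ y ] (Between a b y × y ∈ P)

Interior : Pred ℝ 0ℓ → Pred ℝ 0ℓ
Interior A x = ∃[ a ] ∃[ b ] (Between a b x × (∀ y → Between a b y → A y))

-- Nowhere density is part of the notion of perfect set used here.

record Perfect (P : Subset ℝ) : Set where
  field
    closed       : ∀ x → Closure P x → x ∈ P
    nowhereDense : ∀ x → ¬ Interior (Closure P) x
    noIsolated   : ∀ x → x ∈ P → ∀ a b → Between a b x →
                   ∃[ y ] (Between a b y × y ∈ P × y ≢ x)
    twoPoints    : ∃[ x ] ∃[ y ] (x ∈ P × y ∈ P × x ≢ y)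

record Structure : Set₁ where
  constructor structure
  field
    Carrier : Set
    _<_     : Rel Carrier 0ℓ

suborder : Subset ℝ → Structure
suborder M = structure (Elements M) (λ x y → proj₁ x <ℝ proj₁ y)

rationals : Structure
rationals = structure ℚ ℚ._<_

module _ (𝔐 : Structure) where
  open Structure 𝔐

  NoFirst : Set
  NoFirst = ∀ x → ∃[ y ] y < x

  NoLast : Set
  NoLast = ∀ x → ∃[ y ] x < y

-- Monadic second-order formulas in the language {<}, with n free individual
-- variables and m free set variables (de Bruijn indices).  The remaining
-- connectives and the universal quantifiers are the usual abbreviations.

data Formula (n m : ℕ) : Set where
  _less_ : Fin n → Fin n → Formula n m
  _equal_ : Fin n → Fin n → Formula n m
  _in′_  : Fin n → Fin m → Formula n m
  neg    : Formula n m → Formula n m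
  _and_  : Formula n m → Formula n m → Formula n m
  ex₁    : Formula (suc n) m → Formula n m
  ex₂    : Formula n (suc m) → Formula n m

Sentence : Set
Sentence = Formula 0 0

module _ (𝔐 : Structure) where
  open Structure 𝔐

  Holds : ∀ {n m} → Formula n m → Vec Carrier n → Vec (Subset Carrier) m → Set
  Holds (i less j)  xs Ps = lookup xs i < lookup xs j
  Holds (i equal j) xs Ps = lookup xs i ≡ lookup xs j
  Holds (i in′ j)   xs Ps = lookup xs i ∈ lookup Ps j
  Holds (neg φ)     xs Ps = ¬ Holds φ xs Ps
  Holds (φ and ψ)   xs Ps = Holds φ xs Ps × Holds ψ xs Ps
  Holds (ex₁ φ)     xs Ps = ∃[ x ] Holds φ (x ∷ xs) Ps
  Holds (ex₂ φ)     xs Ps = ∃[ P ] Holds φ xs (P ∷ Ps)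

_⊨_ : Structure → Sentence → Set
𝔐 ⊨ φ = Holds 𝔐 φ [] []

MonadicTheory : Structure → Pred Sentence 0ℓ
MonadicTheory 𝔐 φ = 𝔐 ⊨ φ

{-# OPTIONS --safe #-}
module Submission where

-- Orders are compared by the Ehrenfeucht–Fraïssé game in which a move colours all
-- points.  By induction on the number of moves, any two small dense sets of reals
-- without end points, coloured so that each colour is dense, have the same type;
-- here a set is small if 2^ω has no injection into it with nowhere dense image.
--
-- Given a move q on the first set, call two points equivalent if every convex set
-- between them can be imitated on every small set with the same end colours.  Then
-- the equivalence classes can be imitated as well.  If there were two classes, then
-- in a suitable interval between them the kinds of classes would all be dense.  The
-- second set can be cut into convex pieces of the same kinds, each kind dense, and by
-- the induction hypothesis for the two index orders and the composition theorem that
-- interval could be imitated too, so there is only one class.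
--
-- The pieces are found by a Cantor scheme depending on r in 2^ω in which a point that
-- is never covered determines r.  Smallness yields an r that leaves no point uncovered.
-- M is small because the condensation points of a nowhere dense image of 2^ω in M
-- form a perfect set, and by König's argument 2^ω many of them lie in M.

open import Defs
open import Axiom.ExcludedMiddle using (ExcludedMiddle)
open import Axiom.Extensionality.Propositional using (Extensionality)
open import Data.Bool.Base using (Bool; true; false; T; not; if_then_else_)
  renaming (_<_ to _<ᵇ_; f<t to false<true)
open import Data.Bool.Properties using (T-irrelevant; T-∧)
open import Data.Empty using (⊥; ⊥-elim)
open import Data.Fin.Base using (Fin) renaming (zero to fzero; suc to fsuc)
open import Data.Integer.Base using (ℤ; +_; -[1+_])
open import Data.List.Base using (List; []; _∷_; map; cartesianProduct; length; replicate)
open import Data.List.Membership.Propositional using () renaming (_∈_ to _∈ˡ_)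
open import Data.List.Membership.Propositional.Properties using (∈-map⁺; ∈-cartesianProduct⁺)
open import Data.List.Relation.Unary.Any using (here; there)
open import Data.Maybe.Base using (Maybe; just; nothing)
open import Data.Maybe.Properties using (just-injective)
open import Data.Nat.Base using (ℕ; zero; suc; z≤n; s≤s; _+_; _∸_; _⊔_; _≤′_; ≤′-refl; ≤′-step)
  renaming (_≤_ to _≤ⁿ_; _<_ to _<ⁿ_)
import Data.Nat.Properties as ℕ
open import Data.Product.Base using (Σ; ∃; ∃-syntax; _×_; _,_; proj₁; proj₂)
open import Data.Rational.Base as ℚ using (ℚ; 0ℚ; 1ℚ)
import Data.Rational.Properties as ℚ
open import Data.Sum.Base using (_⊎_; inj₁; inj₂; [_,_]′)
open import Data.Unit.Base using (⊤; tt)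
open import Data.Vec.Base using (Vec; []; _∷_; lookup)
open import Function.Base using (flip)
open import Function.Bundles using (mk↣; Equivalence)
open import Level using (0ℓ)
import Relation.Binary.Construct.Flip.EqAndOrd as Flip
open import Relation.Binary.Core using (Rel)
open import Relation.Binary.Definitions using (tri<; tri≈; tri>)
open import Relation.Binary.PropositionalEquality
  using (_≡_; _≢_; refl; sym; trans; cong; cong₂; subst; cong-app; isEquivalence)
open import Relation.Binary.Structures using (IsStrictTotalOrder; IsDenseLinearOrder)
open import Relation.Binary.Structures.Biased using (isStrictTotalOrderᶜ)
open import Relation.Nullary using (¬_; yes; no; does; recompute)
open import Relation.Unary using (_≐_)

-- On an ordered sum a move is answered through the index order, whose colours are then the types of
-- the pieces. Hence the colour sets differ from move to move, and the induction is on the length of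
-- a list of finite sets, for all finite colourings at once. The index orders must fall under the
-- induction hypothesis too, so they are taken as sets of representatives inside the given sets:
-- they stay small, because smallness passes to subsets. What must be respected when a convex set is
-- imitated is its shape: the colours of its first and last point, if there are any, and whether it
-- has just one point. A prescribed end is got by cutting beside a point of that colour; but if
-- neither side of a cut is to have an end there, a gap of the set is needed. In a countable set one
-- could deal with the points one by one; a small set has no such enumeration. So each step offers
-- two options, together with an interval that neither of them leaves open. A point that is never
-- dealt with then fixes all the options, and such points, one for each branch, would form a nowhere
-- dense set.

record Finite (A : Set) : Set where
  field
    point    : A
    elements : List A
    complete : ∀ a → a ∈ˡ elements

open Finite public

-- Classical logic, choice and finite types.

module Classical (em : ExcludedMiddle 0ℓ) (ext : Extensionality 0ℓ 0ℓ) where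

  abstract
    by-contradiction : {A : Set} → ¬ ¬ A → A
    by-contradiction {A} nna with em {A}
    ... | yes a = a
    ... | no na = ⊥-elim (nna na)

    ⌊_⌋ : Set → Bool
    ⌊ A ⌋ = does (em {A})

    ⌊⌋⁺ : {A : Set} → A → T ⌊ A ⌋
    ⌊⌋⁺ {A} a with em {A}
    ... | yes _ = tt
    ... | no na = na a

    ⌊⌋⁻ : {A : Set} → T ⌊ A ⌋ → A
    ⌊⌋⁻ {A} t with em {A}
    ... | yes a = a

  T-ext : ∀ {a b} → (T a → T b) → (T b → T a) → a ≡ b
  T-ext {false} {false} _ _ = refl
  T-ext {false} {true}  _ g = ⊥-elim (g tt)
  T-ext {true}  {false} f _ = ⊥-elim (f tt)
  T-ext {true}  {true}  _ _ = refl

  ⌊⌋-cong : {A B : Set} → (A → B) → (B → A) → ⌊ A ⌋ ≡ ⌊ B ⌋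
  ⌊⌋-cong f g = T-ext (λ a → ⌊⌋⁺ (f (⌊⌋⁻ a))) (λ b → ⌊⌋⁺ (g (⌊⌋⁻ b)))

  ⟪_⟫ : {X : Set} → (X → Set) → Subset X
  ⟪ φ ⟫ x = ⌊ φ x ⌋

  subset-ext : {X : Set} {P Q : Subset X} →
               (∀ {x} → x ∈ P → x ∈ Q) → (∀ {x} → x ∈ Q → x ∈ P) → P ≡ Q
  subset-ext f g = ext λ x → T-ext f g

  abstract
    -- `h` already supplies witnesses; what is gained is a total function on `X` whose value depends
    -- on `x` alone and not on the proof of `φ x`. Where `φ` fails, `y₀` is the default.
    choice : {X Y : Set} {φ : X → Set} {R : X → Y → Set} → Y →
             (∀ x → φ x → ∃[ y ] R x y) → Σ (X → Y) λ g → ∀ x → φ x → R x (g x)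
    choice {X} {Y} {φ} {R} y₀ h = g , prf
      where
      g : X → Y
      g x with em {φ x}
      ... | yes p = proj₁ (h x p)
      ... | no _  = y₀
      prf : ∀ x → φ x → R x (g x)
      prf x p with em {φ x}
      ... | yes p′ = proj₂ (h x p′)
      ... | no ¬p  = ⊥-elim (¬p p)

    least : (φ : ℕ → Set) → ∃ φ → ∃[ n ] (φ n × (∀ m → φ m → n ≤ⁿ m))
    least φ (n , p) = go φ n p
      where
      go : (φ : ℕ → Set) → ∀ n → φ n → ∃[ n ] (φ n × (∀ m → φ m → n ≤ⁿ m))
      go φ zero p = zero , p , λ _ _ → z≤n
      go φ (suc n) p with em {φ zero} | go (λ k → φ (suc k)) n p
      ... | yes p₀ | _            = zero , p₀ , λ _ _ → z≤n
      ... | no ¬p₀ | k , pk , min = suc k , pk , λ { zero p₀ → ⊥-elim (¬p₀ p₀) ; (suc m) q → s≤s (min m q) }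

  finite-× : ∀ {A B} → Finite A → Finite B → Finite (A × B)
  finite-× A B = record
    { point    = point A , point B
    ; elements = cartesianProduct (elements A) (elements B)
    ; complete = λ { (a , b) → ∈-cartesianProduct⁺ (complete A a) (complete B b) }
    }

  finite-Bool : Finite Bool
  finite-Bool = record
    { point = true ; elements = true ∷ false ∷ []
    ; complete = λ { true → here refl ; false → there (here refl) } }

  finite-⊤ : Finite ⊤
  finite-⊤ = record { point = tt ; elements = tt ∷ [] ; complete = λ _ → here refl }

  finite-Maybe : ∀ {A} → Finite A → Finite (Maybe A)
  finite-Maybe A = record
    { point    = nothing
    ; elements = nothing ∷ map just (elements A)
    ; complete = λ { nothing → here refl ; (just a) → there (∈-map⁺ just (complete A a)) }
    }

  module _ {A B : Set} (bs : List B) (b₀ : B) (all : ∀ b → b ∈ˡ bs) where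
    update : A → (A → B) × B → A → B
    update x (g , b) a = if does (em {a ≡ x}) then b else g a

    functions : List A → List (A → B)
    functions []       = (λ _ → b₀) ∷ []
    functions (x ∷ xs) = map (update x) (cartesianProduct (functions xs) bs)

    -- Overwriting a constant function at the listed points one after another reaches every pattern
    -- of values there. Agreement on the list becomes equality in `finite-→`, by extensionality,
    -- since there the list is exhaustive.
    functions-complete : ∀ xs (h : A → B) →
      ∃[ g ] (g ∈ˡ functions xs × (∀ a → a ∈ˡ xs → g a ≡ h a))
    functions-complete [] h = _ , here refl , λ _ ()
    functions-complete (x ∷ xs) h with functions-complete xs h
    ... | g , g∈ , eq = update x (g , h x) ,
                        ∈-map⁺ (update x) (∈-cartesianProduct⁺ g∈ (all (h x))) , agree
      where
      agree : ∀ a → a ∈ˡ (x ∷ xs) → update x (g , h x) a ≡ h a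
      agree a a∈ with em {a ≡ x}
      agree a a∈         | yes refl = refl
      agree a (here p)   | no a≢x = ⊥-elim (a≢x p)
      agree a (there a∈) | no a≢x = eq a a∈

  finite-→ : ∀ {A B} → Finite A → Finite B → Finite (A → B)
  finite-→ A B = record
    { point    = λ _ → point B
    ; elements = functions (elements B) (point B) (complete B) (elements A)
    ; complete = λ h → let (g , g∈ , eq) = functions-complete (elements B) (point B) (complete B) (elements A) h
                       in subst (_∈ˡ _) (ext λ a → eq a (complete A a)) g∈
    }

-- Game types and the composition theorem for ordered sums.

module Types (em : ExcludedMiddle 0ℓ) (ext : Extensionality 0ℓ 0ℓ) where
  open Classical em ext

  FiniteSet : Set₁
  FiniteSet = Σ Set Finite

  -- Types of the Ehrenfeucht–Fraïssé game whose moves colour all points at once,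
  -- the i-th move with colours from the i-th set of the list.
  Ty : List FiniteSet → Set → Set
  Ty []       C = (C → Bool) × (C → C → Bool)
  Ty (D ∷ ks) C = Ty ks (C × proj₁ D) → Bool

  finite-Ty : ∀ ks {C} → Finite C → Finite (Ty ks C)
  finite-Ty []       C = finite-× (finite-→ C finite-Bool) (finite-→ C (finite-→ C finite-Bool))
  finite-Ty (D ∷ ks) C = finite-→ (finite-Ty ks (finite-× C (proj₂ D))) finite-Bool

  infixr 4 _&_
  _&_ : {X C D : Set} → (X → C) → (X → D) → X → C × D
  (c & q) x = c x , q x

  module _ {X : Set} (_<_ : Rel X 0ℓ) where

    -- Moves colour all of `X`, but only the colours on `P` count (`tp-cong`). So the pieces of a
    -- sum stay subsets of one carrier, and colourings of different pieces can be merged into one.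
    tp : ∀ ks {C} → Subset X → (X → C) → Ty ks C
    tp [] P c = (λ a → ⌊ ∃[ x ] (x ∈ P × c x ≡ a) ⌋) ,
                (λ a b → ⌊ ∃[ x ] ∃[ y ] (x ∈ P × y ∈ P × x < y × c x ≡ a × c y ≡ b) ⌋)
    tp (D ∷ ks) P c t = ⌊ ∃[ q ] tp ks P (c & q) ≡ t ⌋

    tp-cong : ∀ ks {C} {P : Subset X} {c c′ : X → C} →
              (∀ x → x ∈ P → c x ≡ c′ x) → tp ks P c ≡ tp ks P c′
    tp-cong [] {P = P} {c} {c′} eq = cong₂ _,_
      (ext λ a → ⌊⌋-cong (λ (x , x∈ , p) → x , x∈ , trans (sym (eq x x∈)) p)
                         (λ (x , x∈ , p) → x , x∈ , trans (eq x x∈) p))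
      (ext λ a → ext λ b → ⌊⌋-cong
        (λ (x , y , x∈ , y∈ , l , p , r) → x , y , x∈ , y∈ , l , trans (sym (eq x x∈)) p , trans (sym (eq y y∈)) r)
        (λ (x , y , x∈ , y∈ , l , p , r) → x , y , x∈ , y∈ , l , trans (eq x x∈) p , trans (eq y y∈) r))
    tp-cong (D ∷ ks) eq = ext λ t → ⌊⌋-cong
      (λ (q , p) → q , trans (sym (tp-cong ks λ x x∈ → cong (_, q x) (eq x x∈))) p)
      (λ (q , p) → q , trans (tp-cong ks λ x x∈ → cong (_, q x) (eq x x∈)) p)

  module _ {X Y : Set} {_<_ : Rel X 0ℓ} {_≺_ : Rel Y 0ℓ} where

    -- A type with a move left is the set of types that the move can lead to. Equality of types
    -- carries membership over, which is one round of the game.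
    tp-forth : ∀ {D ks C} {P : Subset X} {c : X → C} {Q : Subset Y} {d : Y → C} →
               tp _<_ (D ∷ ks) P c ≡ tp _≺_ (D ∷ ks) Q d →
               ∀ q → ∃[ r ] tp _≺_ ks Q (d & r) ≡ tp _<_ ks P (c & q)
    tp-forth eq q = ⌊⌋⁻ (subst T (cong-app eq _) (⌊⌋⁺ (q , refl)))

    -- The moves that are left can be wasted on constant colourings until the base case is reached,
    -- where the type lists the colours that occur.
    tp-occurs : ∀ ks {C} {P : Subset X} {c : X → C} {Q : Subset Y} {d : Y → C} →
                tp _<_ ks P c ≡ tp _≺_ ks Q d → ∀ x → x ∈ P → ∃[ y ] (y ∈ Q × d y ≡ c x)
    tp-occurs [] eq x x∈ = ⌊⌋⁻ (subst T (cong-app (cong proj₁ eq) _) (⌊⌋⁺ (x , x∈ , refl)))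
    tp-occurs (D ∷ ks) eq x x∈ =
      let r , eq′ = tp-forth {D = D} {ks = ks} eq (λ _ → point (proj₂ D))
          y , y∈ , p = tp-occurs ks (sym eq′) x x∈
      in y , y∈ , cong proj₁ p

    tp-occurs₂ : ∀ ks {C} {P : Subset X} {c : X → C} {Q : Subset Y} {d : Y → C} →
                 tp _<_ ks P c ≡ tp _≺_ ks Q d → ∀ x x′ → x ∈ P → x′ ∈ P → x < x′ →
                 ∃[ y ] ∃[ y′ ] (y ∈ Q × y′ ∈ Q × y ≺ y′ × d y ≡ c x × d y′ ≡ c x′)
    tp-occurs₂ [] eq x x′ x∈ x′∈ l =
      ⌊⌋⁻ (subst T (cong-app (cong-app (cong proj₂ eq) _) _) (⌊⌋⁺ (x , x′ , x∈ , x′∈ , l , refl , refl)))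
    tp-occurs₂ (D ∷ ks) eq x x′ x∈ x′∈ l =
      let r , eq′ = tp-forth {D = D} {ks = ks} eq (λ _ → point (proj₂ D))
          y , y′ , y∈ , y′∈ , l′ , p , p′ = tp-occurs₂ ks (sym eq′) x x′ x∈ x′∈ l
      in y , y′ , y∈ , y′∈ , l′ , cong proj₁ p , cong proj₁ p′

  module _ {X Y : Set} {_<_ : Rel X 0ℓ} {_≺_ : Rel Y 0ℓ} where

    tp-ext₀ : ∀ {C} {P : Subset X} {c : X → C} {Q : Subset Y} {d : Y → C} →
      (∀ x → x ∈ P → ∃[ y ] (y ∈ Q × d y ≡ c x)) →
      (∀ y → y ∈ Q → ∃[ x ] (x ∈ P × c x ≡ d y)) →
      (∀ x x′ → x ∈ P → x′ ∈ P → x < x′ → ∃[ y ] ∃[ y′ ] (y ∈ Q × y′ ∈ Q × y ≺ y′ × d y ≡ c x × d y′ ≡ c x′)) →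
      (∀ y y′ → y ∈ Q → y′ ∈ Q → y ≺ y′ → ∃[ x ] ∃[ x′ ] (x ∈ P × x′ ∈ P × x < x′ × c x ≡ d y × c x′ ≡ d y′)) →
      tp _<_ [] P c ≡ tp _≺_ [] Q d
    tp-ext₀ f g f₂ g₂ = cong₂ _,_
      (ext λ a → ⌊⌋-cong (λ { (x , x∈ , refl) → f x x∈ }) (λ { (x , x∈ , refl) → g x x∈ }))
      (ext λ a → ext λ b → ⌊⌋-cong
        (λ { (x , y , x∈ , y∈ , l , refl , refl) → f₂ x y x∈ y∈ l })
        (λ { (x , y , x∈ , y∈ , l , refl , refl) → g₂ x y x∈ y∈ l }))

    tp-ext : ∀ {D ks C} {P : Subset X} {c : X → C} {Q : Subset Y} {d : Y → C} →
      (∀ q → ∃[ r ] tp _≺_ ks Q (d & r) ≡ tp _<_ ks P (c & q)) →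
      (∀ r → ∃[ q ] tp _<_ ks P (c & q) ≡ tp _≺_ ks Q (d & r)) →
      tp _<_ (D ∷ ks) P c ≡ tp _≺_ (D ∷ ks) Q d
    tp-ext f g = ext λ t → ⌊⌋-cong
      (λ { (q , refl) → f q }) (λ { (r , refl) → g r })

  module _ {X Y : Set} {_<_ : Rel X 0ℓ} {_≺_ : Rel Y 0ℓ} where

    -- A move is answered by the constant colouring with the colour that the only point has
    -- received; irreflexivity rules out ordered pairs.
    tp-single : (∀ x → ¬ x < x) → (∀ y → ¬ y ≺ y) →
      ∀ ks {C} {P : Subset X} {c : X → C} {Q : Subset Y} {d : Y → C} x y →
      x ∈ P → (∀ x′ → x′ ∈ P → x′ ≡ x) → y ∈ Q → (∀ y′ → y′ ∈ Q → y′ ≡ y) → c x ≡ d y →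
      tp _<_ ks P c ≡ tp _≺_ ks Q d
    tp-single irr irr′ [] x y x∈ x! y∈ y! eq = tp-ext₀
      (λ x′ p → y , y∈ , trans (sym eq) (cong _ (sym (x! x′ p))))
      (λ y′ p → x , x∈ , trans eq (cong _ (sym (y! y′ p))))
      (λ x₁ x₂ p₁ p₂ l → ⊥-elim (irr x (subst (x <_) (x! x₂ p₂) (subst (_< x₂) (x! x₁ p₁) l))))
      (λ x₁ x₂ p₁ p₂ l → ⊥-elim (irr′ y (subst (y ≺_) (y! x₂ p₂) (subst (_≺ x₂) (y! x₁ p₁) l))))
    tp-single irr irr′ (D ∷ ks) x y x∈ x! y∈ y! eq = tp-ext {D = D} {ks = ks}
      (λ q → (λ _ → q x) , sym (tp-single irr irr′ ks x y x∈ x! y∈ y! (cong (_, q x) eq)))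
      (λ r → (λ _ → r y) , tp-single irr irr′ ks x y x∈ x! y∈ y! (cong (_, r y) eq))

  fibre : {X J : Set} → Subset X → (X → J) → J → Subset X
  fibre P f j = ⟪ (λ x → x ∈ P × f x ≡ j) ⟫

  record Sum {X J : Set} (_<_ : Rel X 0ℓ) (_≺_ : Rel J 0ℓ)
             (P : Subset X) (f : X → J) (I : Subset J) : Set where
    field
      into : ∀ x → x ∈ P → f x ∈ I
      mono : ∀ x y → x ∈ P → y ∈ P → x < y → f x ≺ f y ⊎ f x ≡ f y
      back : ∀ x y → x ∈ P → y ∈ P → f x ≺ f y → x < y

  open Sum

  -- To answer a move on a sum, the index order is coloured by the types of the pieces.
  idx : List FiniteSet → FiniteSet → List FiniteSet
  idx []       C       = []
  idx (D ∷ ks) (C , F) = let F′ = finite-× F (proj₂ D) in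
                         (Ty ks (C × proj₁ D) , finite-Ty ks F′) ∷ idx ks ((C × proj₁ D) , F′)

  module _ {X Y J K : Set} {_<_ : Rel X 0ℓ} {_<′_ : Rel Y 0ℓ} {_≺_ : Rel J 0ℓ} {_≺′_ : Rel K 0ℓ} where

    compose-forth₀ : ∀ {C L : Set} (h : L → Ty [] C)
      {P : Subset X} {c : X → C} {f : X → J} {I : Subset J} {l : J → L}
      {Q : Subset Y} {d : Y → C} {g : Y → K} {I′ : Subset K} {l′ : K → L} →
      Sum _<_ _≺_ P f I → Sum _<′_ _≺′_ Q g I′ →
      (∀ j → j ∈ I → tp _<_ [] (fibre P f j) c ≡ h (l j)) →
      (∀ k → k ∈ I′ → tp _<′_ [] (fibre Q g k) d ≡ h (l′ k)) →
      tp _≺_ [] I l ≡ tp _≺′_ [] I′ l′ →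
      (∀ x → x ∈ P → ∃[ y ] (y ∈ Q × d y ≡ c x)) ×
      (∀ x x′ → x ∈ P → x′ ∈ P → x < x′ → ∃[ y ] ∃[ y′ ] (y ∈ Q × y′ ∈ Q × y <′ y′ × d y ≡ c x × d y′ ≡ c x′))
    compose-forth₀ h {P} {c} {f} {I} {l} {Q} {d} {g} {I′} {l′} S S′ ty ty′ eq = one , two
      where
      in-fibre : ∀ {x} → x ∈ P → x ∈ fibre P f (f x)
      in-fibre x∈ = ⌊⌋⁺ (x∈ , refl)
      types : ∀ {j k} → j ∈ I → k ∈ I′ → l′ k ≡ l j →
              tp _<_ [] (fibre P f j) c ≡ tp _<′_ [] (fibre Q g k) d
      types j∈ k∈ e = trans (ty _ j∈) (trans (cong h (sym e)) (sym (ty′ _ k∈)))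
      one : ∀ x → x ∈ P → ∃[ y ] (y ∈ Q × d y ≡ c x)
      one x x∈ =
        let k , k∈ , e = tp-occurs [] eq (f x) (into S x x∈)
            y , y∈ , p = tp-occurs [] (types (into S x x∈) k∈ e) x (in-fibre x∈)
        in y , proj₁ (⌊⌋⁻ y∈) , p
      two : ∀ x x′ → x ∈ P → x′ ∈ P → x < x′ → ∃[ y ] ∃[ y′ ] (y ∈ Q × y′ ∈ Q × y <′ y′ × d y ≡ c x × d y′ ≡ c x′)
      two x x′ x∈ x′∈ lt with mono S x x′ x∈ x′∈ lt
      ... | inj₁ lt′ =
        let k , k′ , k∈ , k′∈ , lt″ , e , e′ = tp-occurs₂ [] eq (f x) (f x′) (into S x x∈) (into S x′ x′∈) lt′
            y , y∈ , p = tp-occurs [] (types (into S x x∈) k∈ e) x (in-fibre x∈)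
            y′ , y′∈ , p′ = tp-occurs [] (types (into S x′ x′∈) k′∈ e′) x′ (in-fibre x′∈)
            y∈Q , gy = ⌊⌋⁻ y∈
            y′∈Q , gy′ = ⌊⌋⁻ y′∈
        in y , y′ , y∈Q , y′∈Q ,
           back S′ y y′ y∈Q y′∈Q (subst (_≺′ g y′) (sym gy) (subst (k ≺′_) (sym gy′) lt″)) , p , p′
      ... | inj₂ fx≡ =
        let k , k∈ , e = tp-occurs [] eq (f x) (into S x x∈)
            y , y′ , y∈ , y′∈ , lt′ , p , p′ =
              tp-occurs₂ [] (types (into S x x∈) k∈ e) x x′ (in-fibre x∈) (⌊⌋⁺ (x′∈ , sym fx≡)) lt
        in y , y′ , proj₁ (⌊⌋⁻ y∈) , proj₁ (⌊⌋⁻ y′∈) , lt′ , p , p′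

  -- Composition theorem; `h` reads the type of a piece off the label of its index. A move `q` adds
  -- to the label of each index the type that its piece acquires. The game on the index orders
  -- answers this colouring, each piece of the second sum then answers by itself as the new label
  -- demands, and `proj₂` becomes the new `h`.
  compose : ∀ ks {X Y J K : Set} {_<_ : Rel X 0ℓ} {_<′_ : Rel Y 0ℓ} {_≺_ : Rel J 0ℓ} {_≺′_ : Rel K 0ℓ}
    {C : Set} (F : Finite C) {L : Set} (h : L → Ty ks C)
    {P : Subset X} {c : X → C} {f : X → J} {I : Subset J} {l : J → L}
    {Q : Subset Y} {d : Y → C} {g : Y → K} {I′ : Subset K} {l′ : K → L} →
    Sum _<_ _≺_ P f I → Sum _<′_ _≺′_ Q g I′ →
    (∀ j → j ∈ I → tp _<_ ks (fibre P f j) c ≡ h (l j)) →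
    (∀ k → k ∈ I′ → tp _<′_ ks (fibre Q g k) d ≡ h (l′ k)) →
    tp _≺_ (idx ks (C , F)) I l ≡ tp _≺′_ (idx ks (C , F)) I′ l′ →
    tp _<_ ks P c ≡ tp _<′_ ks Q d
  compose [] F h S S′ ty ty′ eq =
    let f , f₂ = compose-forth₀ h S S′ ty ty′ eq
        g , g₂ = compose-forth₀ h S′ S ty′ ty (sym eq)
    in tp-ext₀ f g f₂ g₂
  compose (D ∷ ks) {C = C} F h S S′ ty ty′ eq = tp-ext {D = D} {ks = ks} (forth S S′ ty ty′ eq) (forth S′ S ty′ ty (sym eq))
    where
    forth : ∀ {X Y J K : Set} {_<_ : Rel X 0ℓ} {_<′_ : Rel Y 0ℓ} {_≺_ : Rel J 0ℓ} {_≺′_ : Rel K 0ℓ}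
      {P : Subset X} {c : X → C} {f : X → J} {I : Subset J} {l : J → _}
      {Q : Subset Y} {d : Y → C} {g : Y → K} {I′ : Subset K} {l′ : K → _} →
      Sum _<_ _≺_ P f I → Sum _<′_ _≺′_ Q g I′ →
      (∀ j → j ∈ I → tp _<_ (D ∷ ks) (fibre P f j) c ≡ h (l j)) →
      (∀ k → k ∈ I′ → tp _<′_ (D ∷ ks) (fibre Q g k) d ≡ h (l′ k)) →
      tp _≺_ (idx (D ∷ ks) (C , F)) I l ≡ tp _≺′_ (idx (D ∷ ks) (C , F)) I′ l′ →
      ∀ q → ∃[ r ] tp _<′_ ks Q (d & r) ≡ tp _<_ ks P (c & q)
    forth {_<_ = _<_} {_<′_} {_≺_} {_≺′_} {P} {c} {f} {I} {l} {Q} {d} {g} {I′} {l′} S S′ ty ty′ eq q = r , sym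
        (compose ks (finite-× F (proj₂ D)) proj₂ S S′ (λ _ _ → refl) typed eq′)
      where
      m : _ → Ty ks (C × proj₁ D)
      m j = tp _<_ ks (fibre P f j) (c & q)
      answer = tp-forth {D = _ , finite-Ty ks (finite-× F (proj₂ D))} {ks = idx ks ((C × proj₁ D) , finite-× F (proj₂ D))} eq m
      m′ = proj₁ answer
      eq′ = sym (proj₂ answer)
      piece : ∀ k → k ∈ I′ → ∃[ r ] tp _<′_ ks (fibre Q g k) (d & r) ≡ m′ k
      piece k k∈ =
        let j , j∈ , e = tp-occurs (idx ks ((C × proj₁ D) , finite-× F (proj₂ D))) (sym eq′) k k∈
            r , e′ = tp-forth {D = D} {ks = ks} (trans (ty j j∈) (trans (cong h (cong proj₁ e)) (sym (ty′ k k∈)))) q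
        in r , trans e′ (cong proj₂ e)
      pieces = choice (λ _ → point (proj₂ D)) piece
      r = λ y → proj₁ pieces (g y) y
      typed : ∀ k → k ∈ I′ → tp _<′_ ks (fibre Q g k) (d & r) ≡ m′ k
      typed k k∈ = trans
        (tp-cong _<′_ ks λ y y∈ → cong (λ i → d y , proj₁ pieces i y) (proj₂ (⌊⌋⁻ y∈)))
        (proj₂ pieces k k∈)

  -- The index order is the same on both sides and each index is labelled by the type of its piece,
  -- so the two labelled index orders coincide and the answers on the pieces can be merged.
  glue : ∀ ks {X J : Set} {_<_ : Rel X 0ℓ} {_≺_ : Rel J 0ℓ} {C D : Set} (F : Finite (C × D)) → D →
    {P Q : Subset X} {c d : X → C} {q : X → D} {f g : X → J} →
    Sum _<_ _≺_ P f (λ _ → true) → Sum _<_ _≺_ Q g (λ _ → true) →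
    (∀ j → ∃[ r ] tp _<_ ks (fibre Q g j) (d & r) ≡ tp _<_ ks (fibre P f j) (c & q)) →
    ∃[ r ] tp _<_ ks Q (d & r) ≡ tp _<_ ks P (c & q)
  glue ks {_<_ = _<_} F D₀ {P} {Q} {c} {d} {q} {f} {g} S S′ pieces = r ,
    sym (compose ks F (λ t → t) S S′ (λ _ _ → refl) typed refl)
    where
    r = λ y → proj₁ (pieces (g y)) y
    typed : ∀ k → _ → tp _<_ ks (fibre Q g k) (d & r) ≡ tp _<_ ks (fibre P f k) (c & q)
    typed k _ = trans
      (tp-cong _<_ ks λ y y∈ → cong (λ i → d y , proj₁ (pieces i) y) (proj₂ (⌊⌋⁻ y∈)))
      (proj₂ (pieces k))

-- Separable linear orders, small sets and their cuts.

record SeparableOrder : Set₁ where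
  field
    X    : Set
    _<_  : Rel X 0ℓ
    sto  : IsStrictTotalOrder _≡_ _<_
    -- For the reals, mark n x says that x is at most the n-th rational.
    mark : ℕ → X → Set
    down : ∀ n {x y} → x < y → mark n y → mark n x
    sep  : ∀ {x y} → x < y → ∃[ n ] (mark n x × ¬ mark n y)

module Orders (em : ExcludedMiddle 0ℓ) (ext : Extensionality 0ℓ 0ℓ) where
  open Classical em ext

  -- Descending chains and decompositions towards the left are obtained from the ascending ones in
  -- the reversed order. This is a reason to work with an abstract order; the marks have to be
  -- complemented to stay downward closed.
  _ᵒ : SeparableOrder → SeparableOrder
  O ᵒ = record
    { X = X ; _<_ = flip _<_ ; sto = Flip.isStrictTotalOrder sto
    ; mark = λ n x → ¬ mark n x
    ; down = λ n y<x ¬y x∈ → ¬y (down n y<x x∈)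
    ; sep = λ y<x → let n , y∈ , x∉ = sep y<x in n , x∉ , λ ¬y → ¬y y∈ }
    where open SeparableOrder O

  module Extremum {X : Set} (_<_ : Rel X 0ℓ) (sto : IsStrictTotalOrder _≡_ _<_) where
    open IsStrictTotalOrder sto using (compare)

    IsLeast : Subset X → X → Set
    IsLeast A x = x ∈ A × (∀ y → y ∈ A → ¬ y < x)

    abstract
      leastColour : {C : Set} → Subset X → (X → C) → Maybe C
      leastColour A c with em {∃[ a ] IsLeast A a}
      ... | yes (a , _) = just (c a)
      ... | no _        = nothing

    least-unique : ∀ {A a b} → IsLeast A a → IsLeast A b → a ≡ b
    least-unique {a = a} {b} (a∈ , a≤) (b∈ , b≤) with compare a b
    ... | tri< l _ _ = ⊥-elim (b≤ a a∈ l)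
    ... | tri≈ _ e _ = e
    ... | tri> _ _ g = ⊥-elim (a≤ b b∈ g)

    module _ {C : Set} {c : X → C} where

      abstract
        least-just⁺ : ∀ {A a} → IsLeast A a → leastColour A c ≡ just (c a)
        least-just⁺ {A} {a} l with em {∃[ a ] IsLeast A a}
        ... | yes (b , l′) = cong (λ x → just (c x)) (least-unique l′ l)
        ... | no none      = ⊥-elim (none (a , l))

      abstract
        least-nothing⁺ : ∀ {A} → (∀ a → a ∈ A → ∃[ b ] (b ∈ A × b < a)) → leastColour A c ≡ nothing
        least-nothing⁺ {A} h with em {∃[ a ] IsLeast A a}
        ... | yes (a , a∈ , a≤) = let b , b∈ , l = h a a∈ in ⊥-elim (a≤ b b∈ l)
        ... | no _              = refl

      abstract
        least-just⁻ : ∀ {A e} → leastColour A c ≡ just e → ∃[ a ] (IsLeast A a × c a ≡ e)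
        least-just⁻ {A} eq with em {∃[ a ] IsLeast A a}
        ... | yes (a , l) = a , l , just-injective eq

      abstract
        least-nothing⁻ : ∀ {A} → leastColour A c ≡ nothing → ∀ a → a ∈ A → ∃[ b ] (b ∈ A × b < a)
        least-nothing⁻ {A} eq a a∈ = by-contradiction λ none → absurd
          (trans (sym eq) (least-just⁺ (a∈ , λ b b∈ l → none (b , b∈ , l))))
          where
          absurd : ∀ {e : C} → ¬ (nothing ≡ just e)
          absurd ()

      -- A least point of either set lies at or below `a₀`, and down there the two sets agree.
      least-initial : ∀ {A A′} a₀ → a₀ ∈ A′ → (∀ a → a ∈ A′ → a ∈ A) →
                      (∀ a → a ∈ A → ¬ a₀ < a → a ∈ A′) → leastColour A c ≡ leastColour A′ c
      least-initial {A} {A′} a₀ a₀∈ sub ini = go (leastColour A′ c) refl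
        where
        open IsStrictTotalOrder sto using (asym; irrefl) renaming (trans to <-trans)
        go : ∀ m → leastColour A′ c ≡ m → leastColour A c ≡ leastColour A′ c
        go (just e) eq = let a , (a∈ , a≤) , ca = least-just⁻ eq in
          trans (least-just⁺ (sub a a∈ , λ y y∈ l → a≤ y (ini y y∈ λ l′ → a≤ a₀ a₀∈ (<-trans l′ l)) l))
                (sym (least-just⁺ (a∈ , a≤)))
        go nothing eq = trans (least-nothing⁺ below) (sym eq)
          where
          below : ∀ a → a ∈ A → ∃[ b ] (b ∈ A × b < a)
          below a a∈ with compare a₀ a
          ... | tri< l _ _ = a₀ , sub a₀ a₀∈ , l
          ... | tri≈ _ refl _ = let b , b∈ , l = least-nothing⁻ eq a₀ a₀∈ in b , sub b b∈ , l
          ... | tri> n _ _ = let b , b∈ , l = least-nothing⁻ eq a (ini a a∈ n) in b , sub b b∈ , l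

  module Order (O : SeparableOrder) where
    open SeparableOrder O public
    open IsStrictTotalOrder sto public
      using (compare; asym) renaming (trans to <-trans; irrefl to <-irrefl)

    infix 4 _≼_
    _≼_ : Rel X 0ℓ
    x ≼ y = ¬ y < x

    irr : ∀ {x} → ¬ x < x
    irr = <-irrefl refl

    ≼-<-trans : ∀ {x y z} → x ≼ y → y < z → x < z
    ≼-<-trans {x} {y} x≼y y<z with compare x y
    ... | tri< l _ _ = <-trans l y<z
    ... | tri≈ _ refl _ = y<z
    ... | tri> _ _ g = ⊥-elim (x≼y g)

    <-≼-trans : ∀ {x y z} → x < y → y ≼ z → x < z
    <-≼-trans {y = y} {z} x<y y≼z with compare y z
    ... | tri< l _ _ = <-trans x<y l
    ... | tri≈ _ refl _ = x<y
    ... | tri> _ _ g = ⊥-elim (y≼z g)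

    ≼-trans : ∀ {x y z} → x ≼ y → y ≼ z → x ≼ z
    ≼-trans x≼y y≼z z<x = x≼y (≼-<-trans y≼z z<x)

    <⇒≼ : ∀ {x y} → x < y → x ≼ y
    <⇒≼ = asym

    ≼⇒<⊎≡ : ∀ {x y} → x ≼ y → x < y ⊎ x ≡ y
    ≼⇒<⊎≡ {x} {y} h with compare x y
    ... | tri< l _ _ = inj₁ l
    ... | tri≈ _ e _ = inj₂ e
    ... | tri> _ _ g = ⊥-elim (h g)

    <⊎≽ : ∀ x y → x < y ⊎ y ≼ x
    <⊎≽ x y with compare x y
    ... | tri< l _ _ = inj₁ l
    ... | tri≈ _ refl _ = inj₂ irr
    ... | tri> _ _ g = inj₂ (asym g)

    ≼-antisym : ∀ {x y} → x ≼ y → y ≼ x → x ≡ y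
    ≼-antisym p q with ≼⇒<⊎≡ p
    ... | inj₁ l = ⊥-elim (q l)
    ... | inj₂ e = e

    mark-≼ : ∀ n {x y} → x ≼ y → mark n y → mark n x
    mark-≼ n h y∈ with ≼⇒<⊎≡ h
    ... | inj₁ l    = down n l y∈
    ... | inj₂ refl = y∈

    NowhereDense : {I : Set} → (I → X) → Set
    NowhereDense f = ∀ a b → a < b →
      ∃[ c ] ∃[ d ] (a ≼ c × c < d × d ≼ b × (∀ i → c < f i → ¬ f i < d))

    -- Fewer than continuum many points would be a stronger demand. Embeddings of the binary
    -- sequences whose image is somewhere dense are tolerated, because perfect sets, being nowhere
    -- dense here, give no control over them.
    Small : Subset X → Set
    Small B = ¬ Σ ((ℕ → Bool) → X) λ f →
      (∀ r → f r ∈ B) × (∀ r r′ → f r ≡ f r′ → r ≡ r′) × NowhereDense f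

    small-⊆ : ∀ {A B} → (∀ x → x ∈ A → x ∈ B) → Small B → Small A
    small-⊆ sub sm (f , f∈ , inj , nd) = sm (f , (λ r → sub _ (f∈ r)) , inj , nd)

    Convex : Subset X → Subset X → Set
    Convex A B = ∀ x y z → x ∈ A → z ∈ A → y ∈ B → x < y → y < z → y ∈ A

    NoLeast NoGreatest : Subset X → Set
    NoLeast    A = ∀ x → x ∈ A → ∃[ y ] (y ∈ A × y < x)
    NoGreatest A = ∀ x → x ∈ A → ∃[ y ] (y ∈ A × x < y)

    open Extremum _<_ sto public using () renaming
      (IsLeast to IsMin; leastColour to minColour; least-just⁺ to min-just⁺; least-just⁻ to min-just⁻;
       least-nothing⁺ to min-nothing⁺; least-nothing⁻ to min-nothing⁻; least-initial to min-initial)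
    open Extremum (flip _<_) (Flip.isStrictTotalOrder sto) public using () renaming
      (IsLeast to IsMax; leastColour to maxColour; least-just⁺ to max-just⁺; least-just⁻ to max-just⁻;
       least-nothing⁺ to max-nothing⁺; least-nothing⁻ to max-nothing⁻; least-initial to max-final)

    module _ {C : Set} (E : Subset C) where

      record Dense (A : Subset X) (c : X → C) : Set where
        field
          colour  : ∀ x → x ∈ A → c x ∈ E
          between : ∀ x y → x ∈ A → y ∈ A → x < y → ∀ e → e ∈ E →
                    ∃[ z ] (z ∈ A × x < z × z < y × c z ≡ e)

        inside : ∀ {x y} → x ∈ A → y ∈ A → x < y → ∃[ z ] (z ∈ A × x < z × z < y)
        inside {x} {y} x∈ y∈ l = let z , z∈ , l₁ , l₂ , _ = between x y x∈ y∈ l (c x) (colour x x∈)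
                                 in z , z∈ , l₁ , l₂

      record Uniform (A : Subset X) (c : X → C) : Set where
        field
          dense      : Dense A c
          inhabited  : ∃[ x ] x ∈ A
          noLeast    : NoLeast A
          noGreatest : NoGreatest A
        open Dense dense public

      Legal : Maybe C → Set
      Legal m = ∀ e → m ≡ just e → e ∈ E

    dense-convex : ∀ {C} {E : Subset C} {A B c} → Dense E B c → (∀ x → x ∈ A → x ∈ B) → Convex A B → Dense E A c
    dense-convex D sub cvx = record
      { colour = λ x x∈ → colour x (sub x x∈)
      ; between = λ x y x∈ y∈ l e e∈ →
          let z , z∈ , l₁ , l₂ , ce = between x y (sub x x∈) (sub y y∈) l e e∈
          in z , cvx x z y x∈ y∈ z∈ l₁ l₂ , l₁ , l₂ , ce }
      where open Dense D

    infixl 30 _↾_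
    -- The latest bit stands first, so that passing to a child is a cons.
    _↾_ : (ℕ → Bool) → ℕ → List Bool
    r ↾ zero  = []
    r ↾ suc n = r n ∷ r ↾ n

    -- T is a scheme of regions.  Points in T (r ↾ n) for all n, one for each r, would form
    -- a nowhere dense injective image of 2^ω.
    abstract
      escape : ∀ {B} → Small B → (T : List Bool → X → Set) →
        (∀ β s x → T (β ∷ s) x → T s x) →
        (∀ s x → T (true ∷ s) x → ¬ T (false ∷ s) x) →
        (∀ r z → z ∈ B → (∀ n → T (r ↾ n) z) → ∀ a b → a < z → z < b →
          ∃[ n ] ∃[ c ] ∃[ d ] (a ≼ c × c < d × d ≼ b ×
            (∀ x → x ∈ B → c < x → x < d → T (r ↾ n) x × (∀ β → ¬ T (β ∷ r ↾ n) x)))) →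
        ∃[ r ] (∀ x → x ∈ B → ∃[ n ] ¬ T (r ↾ n) x)
      escape {B} small T anti disj thin = by-contradiction λ none →
        let hit : ∀ r → ∃[ z ] (z ∈ B × (∀ n → T (r ↾ n) z))
            hit r = by-contradiction λ no-z → none (r , λ x x∈ → by-contradiction λ all-n →
                      no-z (x , x∈ , λ n → by-contradiction λ ¬T → all-n (n , ¬T)))
            f  = λ r → proj₁ (hit r)
            f∈ = λ r → proj₁ (proj₂ (hit r))
            fT = λ r → proj₂ (proj₂ (hit r))
        in small (f , f∈
          , (λ r r′ e → ext λ n → cong (λ { (b ∷ _) → b ; [] → true })
               (same r r′ (f r) (suc n) (fT r (suc n)) (subst (T (r′ ↾ suc n)) (sym e) (fT r′ (suc n)))))
          , nd f f∈ fT)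
        where
        same : ∀ r r′ z n → T (r ↾ n) z → T (r′ ↾ n) z → r ↾ n ≡ r′ ↾ n
        same r r′ z zero _ _ = refl
        same r r′ z (suc n) t t′ with same r r′ z n (anti _ _ _ t) (anti _ _ _ t′)
        ... | e with r n | r′ n
        ...   | true  | true  = cong (true ∷_) e
        ...   | false | false = cong (false ∷_) e
        ...   | true  | false = ⊥-elim (disj _ z t (subst (λ s → T (false ∷ s) z) (sym e) t′))
        ...   | false | true  = ⊥-elim (disj _ z (subst (λ s → T (true ∷ s) z) (sym e) t′) t)
        nd : ∀ f → (∀ r → f r ∈ B) → (∀ r n → T (r ↾ n) (f r)) → NowhereDense f
        nd f f∈ fT a b a<b with em {∃[ r ] (a < f r × f r < b)}
        ... | no none = a , b , irr , a<b , irr , λ r l l′ → none (r , l , l′)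
        -- A branch with its value in the thin interval agrees with `r` up to `n`, and from there
        -- neither bit can be continued at that value.
        ... | yes (r , l , l′) =
          let n , c , d , a≼c , c<d , d≼b , clear = thin r (f r) (f∈ r) (fT r) a b l l′
          in c , d , a≼c , c<d , d≼b , λ r′ m m′ →
             let t , none = clear (f r′) (f∈ r′) m m′
                 e = same r′ r (f r′) n (fT r′ n) t
             in none (r′ n) (subst (λ s → T (r′ n ∷ s) (f r′)) e (fT r′ (suc n)))

    Unsplit : ℕ → X → X → Set
    Unsplit n p q = (∀ x → p ≼ x → x ≼ q → mark n x) ⊎ (∀ x → p ≼ x → x ≼ q → ¬ mark n x)

    -- One step of a Cantor scheme with cells [p₁,p₂] and [p₃,p₄].  As mark n splits neither,
    -- a branch has at most one point.
    record FourPoints (B : Subset X) (n : ℕ) (a b : X) : Set where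
      field
        p₁ p₂ p₃ p₄ : X
        p₁∈ : p₁ ∈ B
        p₂∈ : p₂ ∈ B
        p₃∈ : p₃ ∈ B
        p₄∈ : p₄ ∈ B
        a<p₁  : a < p₁
        p₁<p₂ : p₁ < p₂
        p₂<p₃ : p₂ < p₃
        p₃<p₄ : p₃ < p₄
        p₄<b  : p₄ < b
        unsplit : Unsplit n p₁ p₄

    module _ {C : Set} {E : Subset C} {B : Subset X} {c : X → C} (D : Dense E B c) where
      open Dense D

      abstract
        -- A mark is downward closed, so an inner point `m` decides it for a whole side: everything
        -- below `m` is marked if `m` is, everything above is unmarked if `m` is not. The four
        -- points are taken on that side.
        fourPoints : ∀ n {a b} → a ∈ B → b ∈ B → a < b → FourPoints B n a b
        fourPoints n {a} {b} a∈ b∈ a<b with inside a∈ b∈ a<b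
        ... | m , m∈ , a<m , m<b with em {mark n m}
        ...   | yes m∈L =
          let p₂ , p₂∈ , l₂ , r₂ = inside a∈ m∈ a<m
              p₁ , p₁∈ , l₁ , r₁ = inside a∈ p₂∈ l₂
              p₃ , p₃∈ , l₃ , r₃ = inside p₂∈ m∈ r₂
              p₄ , p₄∈ , l₄ , r₄ = inside p₃∈ m∈ r₃
          in record { p₁∈ = p₁∈ ; p₂∈ = p₂∈ ; p₃∈ = p₃∈ ; p₄∈ = p₄∈ ; a<p₁ = l₁ ; p₁<p₂ = r₁ ; p₂<p₃ = l₃
                    ; p₃<p₄ = l₄ ; p₄<b = <-trans r₄ m<b
                    ; unsplit = inj₁ λ x _ x≼ → down n (≼-<-trans x≼ r₄) m∈L }
        ...   | no m∉L =
          let p₂ , p₂∈ , l₂ , r₂ = inside m∈ b∈ m<b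
              p₁ , p₁∈ , l₁ , r₁ = inside m∈ p₂∈ l₂
              p₃ , p₃∈ , l₃ , r₃ = inside p₂∈ b∈ r₂
              p₄ , p₄∈ , l₄ , r₄ = inside p₃∈ b∈ r₃
          in record { p₁∈ = p₁∈ ; p₂∈ = p₂∈ ; p₃∈ = p₃∈ ; p₄∈ = p₄∈ ; a<p₁ = <-trans a<m l₁ ; p₁<p₂ = r₁ ; p₂<p₃ = l₃
                    ; p₃<p₄ = l₄ ; p₄<b = r₄
                    ; unsplit = inj₂ λ x ≼x _ x∈L → m∉L (down n (<-≼-trans l₁ ≼x) x∈L) }

    _∖_ : Subset X → Subset X → Subset X
    B ∖ Λ = ⟪ (λ x → x ∈ B × ¬ x ∈ Λ) ⟫

    ∖⁺ : ∀ (B Λ : Subset X) {x} → x ∈ B → ¬ x ∈ Λ → x ∈ (B ∖ Λ)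
    ∖⁺ B Λ x∈ x∉ = ⌊⌋⁺ (x∈ , x∉)

    record Initial (Λ B : Subset X) : Set where
      field
        ⊆-whole : ∀ x → x ∈ Λ → x ∈ B
        closed  : ∀ x y → x ∈ B → y ∈ Λ → x < y → x ∈ Λ

      separates : ∀ {x y} → x ∈ Λ → y ∈ B → ¬ y ∈ Λ → x < y
      separates {x} {y} x∈ y∈ y∉ with compare x y
      ... | tri< l _ _ = l
      ... | tri≈ _ refl _ = ⊥-elim (y∉ x∈)
      ... | tri> _ _ g = ⊥-elim (y∉ (closed y x y∈ x∈ g))

    -- The cut is described from both sides: `l` belongs to the last point below it, `f` to the
    -- first point above it. With `nothing` twice it is a gap of `B`. In a densely coloured set at
    -- least one of them is `nothing`, by `no-jump`.
    record Division (B : Subset X) (x y : X) {C : Set} (c : X → C) (l f : Maybe C) : Set where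
      field
        Λ       : Subset X
        initial : Initial Λ B
        x∈Λ     : x ∈ Λ
        y∉Λ     : ¬ y ∈ Λ
        maxΛ    : maxColour Λ c ≡ l
        minΛ    : minColour (B ∖ Λ) c ≡ f
      open Initial initial public

    module _ {C : Set} {E : Subset C} {B : Subset X} {c : X → C} (D : Dense E B c) where
      open Dense D

      abstract
        division-below : ∀ {x y} → x ∈ B → y ∈ B → x < y → ∀ {e} → e ∈ E → Division B x y c nothing (just e)
        division-below x∈ y∈ x<y e∈ with between _ _ x∈ y∈ x<y _ e∈
        ... | z , z∈ , x<z , z<y , refl = record
          { Λ = ⟪ (λ u → u ∈ B × u < z) ⟫
          ; initial = record
            { ⊆-whole = λ u u∈ → proj₁ (⌊⌋⁻ u∈)
            ; closed = λ u v u∈ v∈ u<v → ⌊⌋⁺ (u∈ , <-trans u<v (proj₂ (⌊⌋⁻ v∈))) }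
          ; x∈Λ = ⌊⌋⁺ (x∈ , x<z)
          ; y∉Λ = λ y∈Λ → asym z<y (proj₂ (⌊⌋⁻ y∈Λ))
          ; maxΛ = max-nothing⁺ λ u u∈ → let u∈B , u<z = ⌊⌋⁻ u∈
                                             w , w∈ , l₁ , l₂ = inside u∈B z∈ u<z
                                         in w , ⌊⌋⁺ (w∈ , l₂) , l₁
          ; minΛ = min-just⁺ {a = z} (⌊⌋⁺ (z∈ , λ z∈Λ → irr (proj₂ (⌊⌋⁻ z∈Λ))) ,
                              λ u u∈ u<z → proj₂ (⌊⌋⁻ u∈) (⌊⌋⁺ (proj₁ (⌊⌋⁻ u∈) , u<z))) }

      abstract
        division-above : ∀ {x y} → x ∈ B → y ∈ B → x < y → ∀ {e} → e ∈ E → Division B x y c (just e) nothing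
        division-above x∈ y∈ x<y e∈ with between _ _ x∈ y∈ x<y _ e∈
        ... | z , z∈ , x<z , z<y , refl = record
          { Λ = ⟪ (λ u → u ∈ B × u ≼ z) ⟫
          ; initial = record
            { ⊆-whole = λ u u∈ → proj₁ (⌊⌋⁻ u∈)
            ; closed = λ u v u∈ v∈ u<v → ⌊⌋⁺ (u∈ , <⇒≼ (<-≼-trans u<v (proj₂ (⌊⌋⁻ v∈)))) }
          ; x∈Λ = ⌊⌋⁺ (x∈ , asym x<z)
          ; y∉Λ = λ y∈Λ → proj₂ (⌊⌋⁻ y∈Λ) z<y
          ; maxΛ = max-just⁺ {a = z} (⌊⌋⁺ (z∈ , irr) , λ u u∈ → proj₂ (⌊⌋⁻ u∈))
          ; minΛ = min-nothing⁺ λ u u∈ →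
              let u∈B , u∉ = ⌊⌋⁻ u∈
                  z<u = by-contradiction λ n → u∉ (⌊⌋⁺ (u∈B , n))
                  w , w∈ , l₁ , l₂ = inside z∈ u∈B z<u
              in w , ⌊⌋⁺ (w∈ , λ w∈Λ → proj₂ (⌊⌋⁻ w∈Λ) l₁) , l₂ }

      module _ (small : Small B) {x y : X} (x∈ : x ∈ B) (y∈ : y ∈ B) (x<y : x < y) where
        private
          Cell : Set
          Cell = Σ X λ a → Σ X λ b → a ∈ B × b ∈ B × a < b

          left right : Cell → X
          left  = proj₁
          right (_ , b , _) = b

          points : ∀ n (K : Cell) → FourPoints B n (left K) (right K)
          points n (a , b , a∈ , b∈ , a<b) = fourPoints D n a∈ b∈ a<b

          child : Bool → ℕ → Cell → Cell
          child false n K = p₁ , p₂ , p₁∈ , p₂∈ , p₁<p₂ where open FourPoints (points n K)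
          child true  n K = p₃ , p₄ , p₃∈ , p₄∈ , p₃<p₄ where open FourPoints (points n K)

          size : List Bool → ℕ
          size []      = zero
          size (_ ∷ s) = suc (size s)

          cell : List Bool → Cell
          cell []      = x , y , x∈ , y∈ , x<y
          cell (β ∷ s) = child β (size s) (cell s)

          left-< : ∀ β n K → left K < left (child β n K)
          left-< false n K = a<p₁ where open FourPoints (points n K)
          left-< true  n K = <-trans a<p₁ (<-trans p₁<p₂ p₂<p₃) where open FourPoints (points n K)

          right-< : ∀ β n K → right (child β n K) < right K
          right-< false n K = <-trans p₂<p₃ (<-trans p₃<p₄ p₄<b) where open FourPoints (points n K)
          right-< true  n K = p₄<b where open FourPoints (points n K)

          child-unsplit : ∀ β n K → Unsplit n (left (child β n K)) (right (child β n K))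
          child-unsplit false n K with FourPoints.unsplit (points n K)
          ... | inj₁ h = inj₁ λ u l r → h u l (<⇒≼ (≼-<-trans r (<-trans p₂<p₃ p₃<p₄))) where open FourPoints (points n K)
          ... | inj₂ h = inj₂ λ u l r → h u l (<⇒≼ (≼-<-trans r (<-trans p₂<p₃ p₃<p₄))) where open FourPoints (points n K)
          child-unsplit true n K with FourPoints.unsplit (points n K)
          ... | inj₁ h = inj₁ λ u l r → h u (<⇒≼ (<-≼-trans (<-trans p₁<p₂ p₂<p₃) l)) r where open FourPoints (points n K)
          ... | inj₂ h = inj₂ λ u l r → h u (<⇒≼ (<-≼-trans (<-trans p₁<p₂ p₂<p₃) l)) r where open FourPoints (points n K)

          Tree : List Bool → X → Set
          Tree s z = left (cell s) < z × z < right (cell s)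

          size-↾ : ∀ r n → size (r ↾ n) ≡ n
          size-↾ r zero = refl
          size-↾ r (suc n) = cong suc (size-↾ r n)

          module _ (r : ℕ → Bool) where
            a b : ℕ → X
            a n = left (cell (r ↾ n))
            b n = right (cell (r ↾ n))

            a-< : ∀ n → a n < a (suc n)
            a-< n = left-< (r n) (size (r ↾ n)) (cell (r ↾ n))

            b-< : ∀ n → b (suc n) < b n
            b-< n = right-< (r n) (size (r ↾ n)) (cell (r ↾ n))

            a-mono : ∀ m n → a m ≼ a (n + m)
            a-mono m zero    = irr
            a-mono m (suc n) = ≼-trans (a-mono m n) (<⇒≼ (a-< (n + m)))

            b-anti : ∀ m n → b (n + m) ≼ b m
            b-anti m zero    = irr
            b-anti m (suc n) = ≼-trans (<⇒≼ (b-< (n + m))) (b-anti m n)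

            a<b : ∀ m n → a m < b n
            a<b m n = ≼-<-trans (a-mono m n) (<-≼-trans a<b-diag b≼)
              where
              a<b-diag : a (n + m) < b (n + m)
              a<b-diag = proj₂ (proj₂ (proj₂ (proj₂ (cell (r ↾ (n + m))))))
              b≼ : b (n + m) ≼ b n
              b≼ = subst (λ k → b k ≼ b n) (ℕ.+-comm m n) (b-anti n m)

            unsplit-at : ∀ n → Unsplit n (a (suc n)) (b (suc n))
            unsplit-at n = subst (λ k → Unsplit k (a (suc n)) (b (suc n))) (size-↾ r n)
                             (child-unsplit (r n) (size (r ↾ n)) (cell (r ↾ n)))

            -- The mark that separates `u` from `z` does not split the cell of `z` made with it. As
            -- `z` is unmarked, so is the left end of that cell, which therefore lies beyond `u`.
            left-of : ∀ {u z} → u < z → (∀ n → Tree (r ↾ n) z) → ∃[ n ] u < a n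
            left-of u<z t with sep u<z
            ... | n , u∈ , z∉ with unsplit-at n
            ...   | inj₁ h = ⊥-elim (z∉ (h _ (asym (proj₁ (t (suc n)))) (asym (proj₂ (t (suc n))))))
            ...   | inj₂ h with <⊎≽ _ _
            ...     | inj₁ l = suc n , l
            ...     | inj₂ g = ⊥-elim (h (a (suc n)) irr (asym (a<b (suc n) (suc n))) (mark-≼ n g u∈))

            right-of : ∀ {u z} → z < u → (∀ n → Tree (r ↾ n) z) → ∃[ n ] b n < u
            right-of z<u t with sep z<u
            ... | n , z∈ , u∉ with unsplit-at n
            ...   | inj₂ h = ⊥-elim (h _ (asym (proj₁ (t (suc n)))) (asym (proj₂ (t (suc n)))) z∈)
            ...   | inj₁ h with <⊎≽ _ _
            ...     | inj₁ l = suc n , l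
            ...     | inj₂ g = ⊥-elim (u∉ (mark-≼ n g (h (b (suc n)) (asym (a<b (suc n) (suc n))) irr)))

          thin : ∀ r z → z ∈ B → (∀ n → Tree (r ↾ n) z) → ∀ u v → u < z → z < v →
            ∃[ n ] ∃[ c ] ∃[ d ] (u ≼ c × c < d × d ≼ v ×
              (∀ x → x ∈ B → c < x → x < d → Tree (r ↾ n) x × (∀ β → ¬ Tree (β ∷ r ↾ n) x)))
          -- The interval between the two children belongs to the cell and to neither child. At
          -- stage `n` the cell has shrunk into the interval from `u` to `v` on both sides.
          thin r z z∈ t u v u<z z<v = n , p₂ , p₃ ,
              <⇒≼ (<-trans u<a (<-trans a<p₁ p₁<p₂)) , p₂<p₃ , <⇒≼ (<-trans p₃<p₄ (<-trans p₄<b b<v)) ,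
              λ w _ l l′ → (<-trans a<p₁ (<-trans p₁<p₂ l) , <-trans l′ (<-trans p₃<p₄ p₄<b)) ,
                           λ { false (_ , g) → asym g l ; true (g , _) → asym g l′ }
            where
            m₁ = proj₁ (left-of r u<z t)
            m₂ = proj₁ (right-of r z<v t)
            n = m₁ + m₂
            u<a : u < a r n
            u<a = <-≼-trans (proj₂ (left-of r u<z t)) (subst (λ k → a r m₁ ≼ a r k) (ℕ.+-comm m₂ m₁) (a-mono r m₁ m₂))
            b<v : b r n < v
            b<v = ≼-<-trans (b-anti r m₂ m₁) (proj₂ (right-of r z<v t))
            open FourPoints (points (size (r ↾ n)) (cell (r ↾ n)))

          module _ (r : ℕ → Bool) (covers : ∀ u → u ∈ B → ∃[ n ] ¬ Tree (r ↾ n) u) where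
            Below : Subset X
            Below = ⟪ (λ u → u ∈ B × ∃[ n ] u ≼ a r n) ⟫

            in-below : ∀ {u} → u ∈ Below → u ∈ B × ∃[ n ] u ≼ a r n
            in-below u∈ = ⌊⌋⁻ u∈

            below-in : ∀ u → u ∈ B × ∃[ n ] u ≼ a r n → u ∈ Below
            below-in u h = ⌊⌋⁺ h

            ends∈ : ∀ n → a r n ∈ B × b r n ∈ B
            ends∈ n = let _ , _ , a∈ , b∈ , _ = cell (r ↾ n) in a∈ , b∈

            low : ∀ u → u ∈ B → ¬ u ∈ Below → ∃[ n ] ¬ Tree (r ↾ n) u → ∃[ w ] (w ∈ (B ∖ Below) × w < u)
            low u u∈ u∉ (n , ¬t) = b r (suc n) ,
              ∖⁺ B Below (proj₂ (ends∈ (suc n))) (λ b∈ → let _ , m , b≼ = in-below b∈ in b≼ (a<b r m (suc n))) ,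
              <-≼-trans (b-< r n) b≼u
              where
              a<u : a r n < u
              a<u = by-contradiction λ g → u∉ (below-in u (u∈ , n , g))
              b≼u : b r n ≼ u
              b≼u l = ¬t (a<u , l)

            -- The left ends of the cells increase strictly and the right ends decrease strictly.
            -- Since no point of `B` stays in all cells, the left ends are cofinal below the cut and
            -- the right ends coinitial above it.
            gap-at : Division B x y c nothing nothing
            gap-at = record
              { Λ = Below
              ; initial = record
                { ⊆-whole = λ u u∈ → proj₁ (in-below u∈)
                ; closed = λ u v u∈ v∈ u<v → let _ , n , v≼ = in-below v∈ in below-in u (u∈ , n , <⇒≼ (<-≼-trans u<v v≼)) }
              ; x∈Λ = below-in x (x∈ , 0 , irr)
              ; y∉Λ = λ y∈Λ → let _ , n , y≼ = in-below y∈Λ in y≼ (a<b r n 0)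
              ; maxΛ = max-nothing⁺ λ u u∈ →
                  let _ , n , u≼ = in-below u∈
                  in a r (suc n) , below-in _ (proj₁ (ends∈ (suc n)) , suc n , irr) , ≼-<-trans u≼ (a-< r n)
              ; minΛ = min-nothing⁺ λ u u∈ → let u∈B , u∉ = ⌊⌋⁻ u∈ in low u u∈B u∉ (covers u u∈B) }

        abstract
          division-gap : Division B x y c nothing nothing
          division-gap = let r , covers = escape small Tree
                               (λ β s z (l , l′) → <-trans (left-< β _ _) l , <-trans l′ (right-< β _ _))
                               (λ s z (l , _) (_ , l′) → asym (FourPoints.p₂<p₃ (points (size s) (cell s))) (<-trans l l′))
                               thin
                         in gap-at r covers

      abstract
        divide-after : Small B → ∀ {x y} → x ∈ B → y ∈ B → x < y → ∀ l → Legal E l → Division B x y c l nothing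
        divide-after sm x∈ y∈ x<y (just e) leg = division-above x∈ y∈ x<y (leg e refl)
        divide-after sm x∈ y∈ x<y nothing  leg = division-gap sm x∈ y∈ x<y

      abstract
        divide-before : Small B → ∀ {x y} → x ∈ B → y ∈ B → x < y → ∀ f → Legal E f → Division B x y c nothing f
        divide-before sm x∈ y∈ x<y (just e) leg = division-below x∈ y∈ x<y (leg e refl)
        divide-before sm x∈ y∈ x<y nothing  leg = division-gap sm x∈ y∈ x<y

-- Shapes of convex sets and their realisation.

module Shapes (em : ExcludedMiddle 0ℓ) (ext : Extensionality 0ℓ 0ℓ) (O : SeparableOrder) where
  open Classical em ext
  open Orders em ext
  open Order O

  Shape : Set → Set
  Shape C = Maybe C × Maybe C × Bool

  Several : Subset X → Set
  Several A = ∃[ x ] ∃[ y ] (x ∈ A × y ∈ A × x < y)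

  shape : {C : Set} → Subset X → (X → C) → Shape C
  shape A c = minColour A c , maxColour A c , ⌊ Several A ⌋

  -- Nonempty densely coloured sets have only such shapes (`shape-legit`), and each of them can be
  -- cut out of a small densely coloured set between any two of its points (`place`).
  Legit : {C : Set} → Subset C → Shape C → Set
  Legit E (f , l , several) =
    Legal E f × Legal E l × (several ≡ false → ∃[ e ] (e ∈ E × f ≡ just e × l ≡ just e))

  T⇒≡ : ∀ {b} → T b → b ≡ true
  T⇒≡ {true} _ = refl

  ≡⇒T : ∀ {b} → b ≡ true → T b
  ≡⇒T refl = _

  several⁺ : ∀ {A x y} → x ∈ A → y ∈ A → x < y → ⌊ Several A ⌋ ≡ true
  several⁺ x∈ y∈ l = T⇒≡ (⌊⌋⁺ (_ , _ , x∈ , y∈ , l))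

  single⁻ : ∀ {A} → ⌊ Several A ⌋ ≡ false → ∀ x y → x ∈ A → y ∈ A → x ≡ y
  single⁻ {A} eq x y x∈ y∈ with compare x y
  ... | tri< l _ _ = ⊥-elim (subst T eq (⌊⌋⁺ (x , y , x∈ , y∈ , l)))
  ... | tri≈ _ e _ = e
  ... | tri> _ _ g = ⊥-elim (subst T eq (⌊⌋⁺ (y , x , y∈ , x∈ , g)))

  single⁺ : ∀ {A} → (∀ x y → x ∈ A → y ∈ A → x ≡ y) → ⌊ Several A ⌋ ≡ false
  single⁺ {A} h with ⌊ Several A ⌋ in eq
  ... | false = refl
  ... | true  = let x , y , x∈ , y∈ , l = ⌊⌋⁻ (≡⇒T eq) in ⊥-elim (irr (subst (x <_) (sym (h x y x∈ y∈)) l))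

  single-shape : ∀ {C} {A} {c : X → C} {a} → a ∈ A → (∀ x → x ∈ A → x ≡ a) → shape A c ≡ (just (c a) , just (c a) , false)
  single-shape {a = a} a∈ h = cong₂ _,_
    (min-just⁺ {a = a} (a∈ , λ y y∈ l → irr (subst (_< a) (h y y∈) l)))
    (cong₂ _,_ (max-just⁺ {a = a} (a∈ , λ y y∈ l → irr (subst (a <_) (h y y∈) l)))
               (single⁺ λ x y x∈ y∈ → trans (h x x∈) (sym (h y y∈))))

  shape-legit : ∀ {C} {E : Subset C} {A c x} → Dense E A c → x ∈ A → Legit E (shape A c)
  shape-legit {E = E} {A} {c} {x} D x∈ =
    (λ e eq → let a , (a∈ , _) , ca = min-just⁻ eq in subst (_∈ E) ca (colour a a∈)) ,
    (λ e eq → let a , (a∈ , _) , ca = max-just⁻ eq in subst (_∈ E) ca (colour a a∈)) ,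
    (λ eq → let s = single-shape x∈ λ y y∈ → single⁻ eq y x y∈ x∈
            in c x , colour x x∈ , cong proj₁ s , cong (λ z → proj₁ (proj₂ z)) s)
    where open Dense D

  -- The data are kept apart from their properties, so that one slot for each chain point can be
  -- picked by `choice`, with a default elsewhere.
  record SlotData : Set where
    field
      Λ       : ℕ → Subset X
      t₁ t₂ t : X

  module _ {C : Set} {E : Subset C} {B : Subset X} {c : X → C} where

    abstract
      -- The first point of the stretch is the first one after the lower cut and its last point the
      -- last one before the upper cut. So cuts made independently of each other determine the shape
      -- of what lies between them.
      between-initials : ∀ {Λ Λ′ u v} → Initial Λ B → Initial Λ′ B →
        (∀ x → x ∈ Λ → x ∈ Λ′) → u ∈ (Λ′ ∖ Λ) → v ∈ (Λ′ ∖ Λ) → u < v →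
        shape (Λ′ ∖ Λ) c ≡ (minColour (B ∖ Λ) c , maxColour Λ′ c , true)
      between-initials {Λ} {Λ′} {u} {v} I I′ sub u∈ v∈ u<v = cong₂ _,_
        (sym (min-initial u u∈
          (λ a a∈ → let a∈Λ′ , a∉ = ⌊⌋⁻ a∈ in ⌊⌋⁺ (Initial.⊆-whole I′ a a∈Λ′ , a∉))
          (λ a a∈ a≼u → let a∈B , a∉ = ⌊⌋⁻ a∈ in ⌊⌋⁺ (low a a∈B a≼u , a∉))))
        (cong₂ _,_
          (sym (max-final u u∈ (λ a a∈ → proj₁ (⌊⌋⁻ a∈))
            (λ a a∈ u≼a → ⌊⌋⁺ (a∈ , λ a∈Λ → u≼a (Initial.separates I a∈Λ (Initial.⊆-whole I′ u (proj₁ (⌊⌋⁻ u∈))) (proj₂ (⌊⌋⁻ u∈)))))))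
          (several⁺ u∈ v∈ u<v))
        where
        low : ∀ a → a ∈ B → a ≼ u → a ∈ Λ′
        low a a∈ a≼u with ≼⇒<⊎≡ a≼u
        ... | inj₁ l    = Initial.closed I′ a u a∈ (proj₁ (⌊⌋⁻ u∈)) l
        ... | inj₂ refl = proj₁ (⌊⌋⁻ u∈)

    initial-⊆ : ∀ {Λ Λ′ t} → Initial Λ B → Initial Λ′ B → t ∈ B → ¬ t ∈ Λ → t ∈ Λ′ → ∀ x → x ∈ Λ → x ∈ Λ′
    initial-⊆ I I′ t∈ t∉ t∈′ x x∈ = Initial.closed I′ x _ (Initial.⊆-whole I x x∈) t∈′ (Initial.separates I x∈ t∈ t∉)

    -- `noMax₁` and `noMin₂` leave both neighbours of the new piece without an end towards it, so
    -- that they can serve as regions to be cut further.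
    record Place (x y : X) (sh : Shape C) : Set where
      field
        Λ₁ Λ₂    : Subset X
        initial₁ : Initial Λ₁ B
        initial₂ : Initial Λ₂ B
        x∈Λ₁     : x ∈ Λ₁
        y∉Λ₂     : ¬ y ∈ Λ₂
        Λ₁⊆Λ₂    : ∀ u → u ∈ Λ₁ → u ∈ Λ₂
        noMax₁   : maxColour Λ₁ c ≡ nothing
        noMin₂   : minColour (B ∖ Λ₂) c ≡ nothing
        point    : X
        point∈   : point ∈ (Λ₂ ∖ Λ₁)
        shape≡   : shape (Λ₂ ∖ Λ₁) c ≡ sh

    abstract
      place-several : Dense E B c → ∀ {x y t₁ t₂ f l} → t₁ ∈ B → t₂ ∈ B → t₁ < t₂ →
        Division B x t₁ c nothing f → Division B t₂ y c l nothing → Place x y (f , l , true)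
      place-several D {x} {y} {t₁} {t₂} t₁∈ t₂∈ t₁<t₂ M₁ M₂ = record
        { Λ₁ = M₁.Λ ; Λ₂ = M₂.Λ ; initial₁ = M₁.initial ; initial₂ = M₂.initial ; x∈Λ₁ = M₁.x∈Λ ; y∉Λ₂ = M₂.y∉Λ
        ; Λ₁⊆Λ₂ = Λ⊆ ; noMax₁ = M₁.maxΛ ; noMin₂ = M₂.minΛ ; point = t₁ ; point∈ = t₁∈′
        ; shape≡ = trans (between-initials M₁.initial M₂.initial Λ⊆ t₁∈′ t₂∈′ t₁<t₂)
                         (cong₂ (λ a b → a , b , true) M₁.minΛ M₂.maxΛ) }
        where
        module M₁ = Division M₁
        module M₂ = Division M₂
        Λ⊆ : ∀ u → u ∈ M₁.Λ → u ∈ M₂.Λ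
        Λ⊆ u u∈ = M₂.closed u t₂ (M₁.⊆-whole u u∈) M₂.x∈Λ (<-trans (M₁.separates u∈ t₁∈ M₁.y∉Λ) t₁<t₂)
        t₁∈′ : t₁ ∈ (M₂.Λ ∖ M₁.Λ)
        t₁∈′ = ∖⁺ M₂.Λ M₁.Λ (M₂.closed t₁ t₂ t₁∈ M₂.x∈Λ t₁<t₂) M₁.y∉Λ
        t₂∈′ : t₂ ∈ (M₂.Λ ∖ M₁.Λ)
        t₂∈′ = ∖⁺ M₂.Λ M₁.Λ M₂.x∈Λ (λ t₂∈Λ → M₁.y∉Λ (M₁.closed t₁ t₂ t₁∈ t₂∈Λ t₁<t₂))

      place : Dense E B c → Small B → ∀ {x y} → x ∈ B → y ∈ B → x < y → ∀ sh → Legit E sh → Place x y sh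
      place D sm {x} {y} x∈ y∈ x<y (f , l , true) (legf , legl , _) =
        let t₁ , t₁∈ , x<t₁ , t₁<y = Dense.inside D x∈ y∈ x<y
            t₂ , t₂∈ , t₁<t₂ , t₂<y = Dense.inside D t₁∈ y∈ t₁<y
        in place-several D t₁∈ t₂∈ t₁<t₂ (divide-before D sm x∈ t₁∈ x<t₁ f legf) (divide-after D sm t₂∈ y∈ t₂<y l legl)
      place D sm {x} {y} x∈ y∈ x<y (f , l , false) (_ , _ , one) with one refl
      ... | e , e∈ , refl , refl with Dense.between D x y x∈ y∈ x<y e e∈
      ...   | p , p∈ , x<p , p<y , refl = record
          { Λ₁ = ⟪ (λ u → u ∈ B × u < p) ⟫ ; Λ₂ = ⟪ (λ u → u ∈ B × u ≼ p) ⟫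
          ; initial₁ = record
            { ⊆-whole = λ u u∈ → proj₁ (⌊⌋⁻ u∈)
            ; closed = λ u v u∈ v∈ u<v → ⌊⌋⁺ (u∈ , <-trans u<v (proj₂ (⌊⌋⁻ v∈))) }
          ; initial₂ = record
            { ⊆-whole = λ u u∈ → proj₁ (⌊⌋⁻ u∈)
            ; closed = λ u v u∈ v∈ u<v → ⌊⌋⁺ (u∈ , <⇒≼ (<-≼-trans u<v (proj₂ (⌊⌋⁻ v∈)))) }
          ; x∈Λ₁ = ⌊⌋⁺ (x∈ , x<p) ; y∉Λ₂ = λ y∈Λ → proj₂ (⌊⌋⁻ y∈Λ) p<y
          ; Λ₁⊆Λ₂ = λ u u∈ → let u∈B , u<p = ⌊⌋⁻ u∈ in ⌊⌋⁺ (u∈B , asym u<p)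
          ; noMax₁ = max-nothing⁺ λ u u∈ → let u∈B , u<p = ⌊⌋⁻ u∈
                                               w , w∈ , l₁ , l₂ = inside u∈B p∈ u<p
                                           in w , ⌊⌋⁺ (w∈ , l₂) , l₁
          ; noMin₂ = min-nothing⁺ λ u u∈ →
              let u∈B , u∉ = ⌊⌋⁻ u∈
                  p<u = by-contradiction λ n → u∉ (⌊⌋⁺ (u∈B , n))
                  w , w∈ , l₁ , l₂ = inside p∈ u∈B p<u
              in w , ⌊⌋⁺ (w∈ , λ w∈Λ → proj₂ (⌊⌋⁻ w∈Λ) l₁) , l₂
          ; point = p ; point∈ = p∈′
          ; shape≡ = single-shape p∈′ λ u u∈ → let u∈Λ₂ , u∉ = ⌊⌋⁻ u∈
                                                   u∈B , u≼p = ⌊⌋⁻ u∈Λ₂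
                                               in ≼-antisym u≼p λ u<p → u∉ (⌊⌋⁺ (u∈B , u<p)) }
        where
        open Dense D
        p∈′ : p ∈ (⟪ (λ u → u ∈ B × u ≼ p) ⟫ ∖ ⟪ (λ u → u ∈ B × u < p) ⟫)
        p∈′ = ∖⁺ ⟪ (λ u → u ∈ B × u ≼ p) ⟫ ⟪ (λ u → u ∈ B × u < p) ⟫ (⌊⌋⁺ (p∈ , irr)) (λ q → irr (proj₂ (⌊⌋⁻ q)))

    -- Four successive cuts. The stretches from cut 0 to 1 and from 2 to 3 are regions without ends,
    -- and the one from 1 to 2 is the wanted piece. Outside, `l` is the last colour before cut 0 and
    -- `f` the first colour after cut 3: what runs from one slot to the next thus begins with `f`
    -- and ends with `l`.
    record Slot (x y : X) (f l : Maybe C) (sh : Shape C) (S : SlotData) : Set where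
      open SlotData S
      field
        initial  : ∀ i → Initial (Λ i) B
        increase : ∀ i u → u ∈ Λ i → u ∈ Λ (suc i)
        bounded  : ∀ i u → u ∈ Λ i → u ∈ Λ 3
        x∈Λ₀     : x ∈ Λ 0
        y∉Λ₃     : ¬ y ∈ Λ 3
        t₁∈      : t₁ ∈ (Λ 1 ∖ Λ 0)
        t∈       : t ∈ (Λ 2 ∖ Λ 1)
        t₂∈      : t₂ ∈ (Λ 3 ∖ Λ 2)
        max₀     : maxColour (Λ 0) c ≡ l
        min₀     : minColour (B ∖ Λ 0) c ≡ nothing
        max₁     : maxColour (Λ 1) c ≡ nothing
        shape₂   : shape (Λ 2 ∖ Λ 1) c ≡ sh
        min₂     : minColour (B ∖ Λ 2) c ≡ nothing
        max₃     : maxColour (Λ 3) c ≡ nothing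
        min₃     : minColour (B ∖ Λ 3) c ≡ f

    slot : Dense E B c → Small B → ∀ {x y} → x ∈ B → y ∈ B → x < y →
           ∀ f l sh → Legal E f → Legal E l → Legit E sh → ∃[ S ] Slot x y f l sh S
    slot D sm {x} {y} x∈ y∈ x<y f l sh legf legl leg = S , record
        { initial = λ { 0 → M₀.initial ; 1 → P.initial₁ ; 2 → P.initial₂ ; (suc (suc (suc _))) → M₃.initial }
        ; increase = λ { 0 → inc₀ ; 1 → P.Λ₁⊆Λ₂ ; 2 → inc₂ ; (suc (suc (suc _))) → λ _ u∈ → u∈ }
        ; bounded = λ { 0 → λ u u∈ → inc₂ u (P.Λ₁⊆Λ₂ u (inc₀ u u∈)) ; 1 → λ u u∈ → inc₂ u (P.Λ₁⊆Λ₂ u u∈)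
                      ; 2 → inc₂ ; (suc (suc (suc _))) → λ _ u∈ → u∈ }
        ; x∈Λ₀ = M₀.x∈Λ ; y∉Λ₃ = M₃.y∉Λ
        ; t₁∈ = ∖⁺ P.Λ₁ M₀.Λ P.x∈Λ₁ M₀.y∉Λ ; t∈ = P.point∈ ; t₂∈ = ∖⁺ M₃.Λ P.Λ₂ M₃.x∈Λ P.y∉Λ₂
        ; max₀ = M₀.maxΛ ; min₀ = M₀.minΛ ; max₁ = P.noMax₁ ; shape₂ = P.shape≡ ; min₂ = P.noMin₂
        ; max₃ = M₃.maxΛ ; min₃ = M₃.minΛ }
      where
      open Dense D
      r₁ = inside x∈ y∈ x<y
      s₁ = proj₁ r₁
      s₁∈ = proj₁ (proj₂ r₁)
      s₁<y = proj₂ (proj₂ (proj₂ r₁))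
      r₂ = inside s₁∈ y∈ s₁<y
      s₂ = proj₁ r₂
      s₂∈ = proj₁ (proj₂ r₂)
      s₁<s₂ = proj₁ (proj₂ (proj₂ r₂))
      s₂<y = proj₂ (proj₂ (proj₂ r₂))
      M₀ = divide-after D sm x∈ s₁∈ (proj₁ (proj₂ (proj₂ r₁))) l legl
      P  = place D sm s₁∈ s₂∈ s₁<s₂ sh leg
      M₃ = divide-before D sm s₂∈ y∈ s₂<y f legf
      module M₀ = Division M₀
      module M₃ = Division M₃
      module P  = Place P
      S : SlotData
      S = record { Λ = λ { 0 → M₀.Λ ; 1 → P.Λ₁ ; 2 → P.Λ₂ ; (suc (suc (suc _))) → M₃.Λ }
                 ; t₁ = s₁ ; t₂ = s₂ ; t = P.point }
      inc₀ : ∀ u → u ∈ M₀.Λ → u ∈ P.Λ₁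
      inc₀ = initial-⊆ M₀.initial P.initial₁ s₁∈ M₀.y∉Λ P.x∈Λ₁
      inc₂ : ∀ u → u ∈ P.Λ₂ → u ∈ M₃.Λ
      inc₂ = initial-⊆ P.initial₂ M₃.initial s₂∈ P.y∉Λ₂ M₃.x∈Λ

-- Cofinal sequences.

module Sequences (em : ExcludedMiddle 0ℓ) (ext : Extensionality 0ℓ 0ℓ) (O : SeparableOrder) where
  open Classical em ext
  open Orders em ext
  open Order O

  seq-mono : (v : ℕ → X) → (∀ n → v n < v (suc n)) → ∀ m n → m ≤ⁿ n → v m ≼ v n
  seq-mono v inc m n m≤n = go (ℕ.≤⇒≤′ m≤n)
    where
    go : ∀ {n} → m ≤′ n → v m ≼ v n
    go ≤′-refl     = irr
    go (≤′-step h) = ≼-trans (go h) (<⇒≼ (inc _))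

  module _ {C : Set} {E : Subset C} {A : Subset X} {c : X → C} (D : Dense E A c) (top : NoGreatest A) where
    open Dense D

    -- One step towards cofinality: `w` leaves the mark behind if `A` ever does. Marks separate
    -- points, so leaving each of them behind in turn means passing every point of `A`.
    above-mark : ∀ n u → u ∈ A →
      ∃[ w ] (w ∈ A × u < w × (∀ x y → y ∈ A → mark n x → ¬ mark n y → x < w))
    above-mark n u u∈ with em {∃[ y ] (y ∈ A × ¬ mark n y)}
    ... | no none = let w , w∈ , l = top u u∈ in w , w∈ , l , λ x y y∈ _ y∉ → ⊥-elim (none (y , y∈ , y∉))
    ... | yes (y , y∈ , y∉) with <⊎≽ u y
    ...   | inj₁ l = y , y∈ , l , λ x _ _ x∈ _ → by-contradiction λ g → y∉ (mark-≼ n g x∈)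
    ...   | inj₂ g = let w , w∈ , l = top u u∈ in
                     w , w∈ , l , λ x _ _ x∈ _ → ≼-<-trans (λ y<x → y∉ (down n y<x x∈)) (≼-<-trans g l)

    record CofinalSequence (a : X) (e : C) : Set where
      field
        v       : ℕ → X
        v∈      : ∀ n → v n ∈ A
        v-<     : ∀ n → v n < v (suc n)
        a<v     : a < v 0
        cofinal : ∀ x → x ∈ A → ∃[ n ] x < v n
        colour≡ : ∀ n → c (v n) ≡ e

    abstract
      cofinalSequence : ∀ {a e} → a ∈ A → e ∈ E → CofinalSequence a e
      cofinalSequence {a} {e} a∈ e∈ = record
        { v = λ n → proj₁ (s n) ; v∈ = λ n → proj₂ (s n)
        ; v-< = λ n → proj₁ (proj₂ (proj₂ (next n (proj₁ (s n)) (proj₂ (s n)))))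
        ; a<v = proj₁ (proj₂ (proj₂ (next 0 a a∈)))
        ; cofinal = λ x x∈ →
            let y , y∈ , x<y = top x x∈
                n , x∈L , y∉L = sep x<y
            in suc n , proj₂ (proj₂ (proj₂ (proj₂ (next n (proj₁ (s n)) (proj₂ (s n)))))) x y y∈ x∈L y∉L
        ; colour≡ = λ { zero → proj₁ (proj₂ (proj₂ (proj₂ (next 0 a a∈))))
                      ; (suc n) → proj₁ (proj₂ (proj₂ (proj₂ (next n (proj₁ (s n)) (proj₂ (s n)))))) } }
        where
        next : ∀ n u → u ∈ A →
          ∃[ w ] (w ∈ A × u < w × c w ≡ e × (∀ x y → y ∈ A → mark n x → ¬ mark n y → x < w))
        next n u u∈ =
          let w , w∈ , u<w , far = above-mark n u u∈
              w′ , w′∈ , w<w′ = top w w∈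
              z , z∈ , w<z , _ , cz = between w w′ w∈ w′∈ w<w′ e e∈
          in z , z∈ , <-trans u<w w<z , cz , λ x y y∈ x∈ y∉ → <-trans (far x y y∈ x∈ y∉) w<z
        s : ℕ → Σ X (_∈ A)
        s zero    = let w , w∈ , _ = next 0 a a∈ in w , w∈
        s (suc n) = let w , w∈ , _ = next n (proj₁ (s n)) (proj₂ (s n)) in w , w∈

    -- An ascending sequence kept as a set with nearest neighbours instead of indices; in this form
    -- two halves are joined by a mere union.
    record HalfChain (p : X) : Set where
      field
        Δ     : Subset X
        Δ⊆    : ∀ δ → δ ∈ Δ → δ ∈ A
        p∈    : p ∈ Δ
        p≼    : ∀ δ → δ ∈ Δ → p ≼ δ
        above : ∀ x → x ∈ A → p ≼ x → ∃[ δ ] (δ ∈ Δ × x < δ × (∀ δ′ → δ′ ∈ Δ → x < δ′ → δ ≼ δ′))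
        below : ∀ x → x ∈ A → p < x → ∃[ δ ] (δ ∈ Δ × δ < x × (∀ δ′ → δ′ ∈ Δ → δ′ < x → δ′ ≼ δ))

    abstract
      halfChain : ∀ {p} → p ∈ A → HalfChain p
      halfChain {p} p∈ = record
        { Δ = ⟪ (λ x → ∃[ n ] x ≡ a n) ⟫
        ; Δ⊆ = λ δ δ∈ → let n , e = ⌊⌋⁻ δ∈ in subst (_∈ A) (sym e) (a∈ n)
        ; p∈ = ⌊⌋⁺ (0 , refl)
        ; p≼ = λ δ δ∈ → let n , e = ⌊⌋⁻ δ∈ in subst (p ≼_) (sym e) (a-mono 0 n z≤n)
        ; above = λ x x∈ _ →
            let n , l , min = least (λ n → x < a n) (let n , l = cofinal x x∈ in suc n , l)
            in a n , ⌊⌋⁺ (n , refl) , l , λ δ′ δ′∈ l′ →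
               let m , e = ⌊⌋⁻ δ′∈ in subst (a n ≼_) (sym e) (a-mono n m (min m (subst (x <_) e l′)))
        ; below = λ x x∈ p<x →
            let n , l = cofinal x x∈ in below-at x p<x (least (λ n → x ≼ a n) (suc n , asym l)) }
        where
        open CofinalSequence (cofinalSequence p∈ (colour p p∈))
        a : ℕ → X
        a zero    = p
        a (suc n) = v n
        a∈ : ∀ n → a n ∈ A
        a∈ zero    = p∈
        a∈ (suc n) = v∈ n
        a-mono : ∀ m n → m ≤ⁿ n → a m ≼ a n
        a-mono = seq-mono a λ { zero → a<v ; (suc n) → v-< n }
        below-at : ∀ x → p < x → ∃[ n ] (x ≼ a n × (∀ m → x ≼ a m → n ≤ⁿ m)) →
                ∃[ δ ] (δ ∈ ⟪ (λ x → ∃[ n ] x ≡ a n) ⟫ × δ < x ×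
                  (∀ δ′ → δ′ ∈ ⟪ (λ x → ∃[ n ] x ≡ a n) ⟫ → δ′ < x → δ′ ≼ δ))
        below-at x p<x (zero , x≼p , _) = ⊥-elim (x≼p p<x)
        below-at x p<x (suc n , x≼ , min) = a n , ⌊⌋⁺ (n , refl) ,
          by-contradiction (λ g → ℕ.<-irrefl refl (min n g)) ,
          λ δ′ δ′∈ l → let m , e = ⌊⌋⁻ δ′∈ in
            subst (_≼ a n) (sym e) (a-mono m n (ℕ.≤-pred (ℕ.≰⇒> λ n<m → ≼-trans x≼ (a-mono (suc n) m n<m) (subst (_< x) e l))))

-- Discrete chains unbounded in both directions.

module Chains (em : ExcludedMiddle 0ℓ) (ext : Extensionality 0ℓ 0ℓ) (O : SeparableOrder) where
  open Classical em ext
  open Orders em ext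
  open Order O
  module Oᵒ = Order (O ᵒ)

  dense-flip : ∀ {C} {E : Subset C} {A c} → Dense E A c → Oᵒ.Dense E A c
  dense-flip D = record
    { colour = colour
    ; between = λ x y x∈ y∈ l e e∈ → let z , z∈ , l₁ , l₂ , ce = between y x y∈ x∈ l e e∈ in z , z∈ , l₂ , l₁ , ce }
    where open Dense D

  record Chain (A : Subset X) : Set where
    field
      Δ     : Subset X
      Δ⊆    : ∀ δ → δ ∈ Δ → δ ∈ A
      above : ∀ x → x ∈ A → ∃[ δ ] (δ ∈ Δ × x < δ × (∀ δ′ → δ′ ∈ Δ → x < δ′ → δ ≼ δ′))
      below : ∀ x → x ∈ A → ∃[ δ ] (δ ∈ Δ × δ < x × (∀ δ′ → δ′ ∈ Δ → δ′ < x → δ′ ≼ δ))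

  abstract
    -- One half ascends from `p`; the other is the same construction in the reversed order, from the
    -- same `p`. They meet only in `p`, so neighbours are found in one half at a time.
    chain : ∀ {C} {E : Subset C} {A c} → Uniform E A c → Chain A
    chain {A = A} U = record
      { Δ = ⟪ (λ x → x ∈ R.Δ ⊎ x ∈ L.Δ) ⟫
      ; Δ⊆ = λ δ δ∈ → [ R.Δ⊆ δ , L.Δ⊆ δ ]′ (⌊⌋⁻ δ∈)
      ; above = up
      ; below = dn }
      where
      open Uniform U
      p : X
      p = proj₁ inhabited
      R : Sequences.HalfChain em ext O dense noGreatest p
      R = Sequences.halfChain em ext O dense noGreatest (proj₂ inhabited)
      L : Sequences.HalfChain em ext (O ᵒ) (dense-flip dense) noLeast p
      L = Sequences.halfChain em ext (O ᵒ) (dense-flip dense) noLeast (proj₂ inhabited)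
      module R = Sequences.HalfChain R
      module L = Sequences.HalfChain L
      Δ : Subset X
      Δ = ⟪ (λ x → x ∈ R.Δ ⊎ x ∈ L.Δ) ⟫
      up : ∀ x → x ∈ A → ∃[ δ ] (δ ∈ Δ × x < δ × (∀ δ′ → δ′ ∈ Δ → x < δ′ → δ ≼ δ′))
      up x x∈ with <⊎≽ x p
      ... | inj₁ x<p = let δ , δ∈ , l , min = L.below x x∈ x<p in
        δ , ⌊⌋⁺ (inj₂ δ∈) , l , λ δ′ δ′∈ l′ →
          [ (λ r → ≼-trans (L.p≼ δ δ∈) (R.p≼ δ′ r)) , (λ m → min δ′ m l′) ]′ (⌊⌋⁻ δ′∈)
      ... | inj₂ p≼x = let δ , δ∈ , l , min = R.above x x∈ p≼x in
        δ , ⌊⌋⁺ (inj₁ δ∈) , l , λ δ′ δ′∈ l′ →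
          [ (λ r → min δ′ r l′) , (λ m → ⊥-elim (L.p≼ δ′ m (≼-<-trans p≼x l′))) ]′ (⌊⌋⁻ δ′∈)
      dn : ∀ x → x ∈ A → ∃[ δ ] (δ ∈ Δ × δ < x × (∀ δ′ → δ′ ∈ Δ → δ′ < x → δ′ ≼ δ))
      dn x x∈ with <⊎≽ p x
      ... | inj₁ p<x = let δ , δ∈ , l , max = R.below x x∈ p<x in
        δ , ⌊⌋⁺ (inj₁ δ∈) , l , λ δ′ δ′∈ l′ →
          [ (λ r → max δ′ r l′) , (λ m → ≼-trans (L.p≼ δ′ m) (R.p≼ δ δ∈)) ]′ (⌊⌋⁻ δ′∈)
      ... | inj₂ x≼p = let δ , δ∈ , l , max = L.above x x∈ x≼p in
        δ , ⌊⌋⁺ (inj₂ δ∈) , l , λ δ′ δ′∈ l′ →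
          [ (λ r → ⊥-elim (R.p≼ δ′ r (<-≼-trans l′ x≼p))) , (λ m → max δ′ m l′) ]′ (⌊⌋⁻ δ′∈)

-- One step of cutting a region into pieces and smaller regions.

module Steps (em : ExcludedMiddle 0ℓ) (ext : Extensionality 0ℓ 0ℓ) (O : SeparableOrder) where
  open Classical em ext
  open Orders em ext
  open Order O
  open Shapes em ext O
  open Chains em ext O

  just≢nothing : {A : Set} {a : A} {m : Maybe A} → m ≡ just a → m ≡ nothing → ⊥
  just≢nothing refl ()

  -- A partition given through its points: `block x` is the part in which `x` lies. The label
  -- `nothing` stands for a region still to be cut, and `just κ` for a finished piece of kind `κ`.
  record Blocks {C Kd : Set} (sh : Kd → Shape C) (F : Kd → Set)
                (K : Subset X) (c : X → C) (n : ℕ) (k : Kd) : Set where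
    field
      block             : X → Subset X
      label             : X → Maybe Kd
      self              : ∀ x → x ∈ K → x ∈ block x
      inside-K          : ∀ x y → x ∈ K → y ∈ block x → y ∈ K
      same-block        : ∀ x y → x ∈ K → y ∈ block x → block y ≡ block x
      same-label        : ∀ x y → x ∈ K → y ∈ block x → label y ≡ label x
      convex            : ∀ x → x ∈ K → Convex (block x) K
      region-noLeast    : ∀ x → x ∈ K → label x ≡ nothing → NoLeast (block x)
      region-noGreatest : ∀ x → x ∈ K → label x ≡ nothing → NoGreatest (block x)
      region-unsplit    : ∀ x → x ∈ K → label x ≡ nothing →
                          (∀ y → y ∈ block x → mark n y) ⊎ (∀ y → y ∈ block x → ¬ mark n y)
      piece-shape       : ∀ x κ → x ∈ K → label x ≡ just κ → F κ × shape (block x) c ≡ sh κ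
      has-piece         : ∃[ x ] (x ∈ K × label x ≡ just k)
      region-below      : ∀ y → y ∈ K → ∃[ z ] (z ∈ K × z < y × label z ≡ nothing × ¬ y ∈ block z)
      region-above      : ∀ y → y ∈ K → ∃[ z ] (z ∈ K × y < z × label z ≡ nothing × ¬ y ∈ block z)
      region-between    : ∀ x y κ κ′ → x ∈ K → y ∈ K → x < y → label x ≡ just κ → label y ≡ just κ′ →
                          ¬ y ∈ block x → ∃[ z ] (z ∈ K × x < z × z < y × label z ≡ nothing)

  -- A point in a region of one option lies in a piece of the other one, so a point that is
  -- never covered determines all the bits chosen.
  record Step {C Kd : Set} (sh : Kd → Shape C) (F : Kd → Set)
              (K : Subset X) (c : X → C) (n : ℕ) (k : Kd) : Set where
    field
      blocks : Bool → Blocks sh F K c n k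
    module Option (β : Bool) = Blocks (blocks β)
    field
      disjoint : ∀ x → x ∈ K → Option.label true x ≡ nothing → ¬ Option.label false x ≡ nothing
      covered  : ∃[ u ] ∃[ v ] (u ∈ K × v ∈ K × u < v ×
                 (∀ x → x ∈ K → u < x → x < v → ∀ β → ¬ Option.label β x ≡ nothing))

  module _ {C Kd : Set} {E : Subset C} (sh : Kd → Shape C) (F : Kd → Set) {ρ k : Kd}
           (Fρ : F ρ) (Fk : F k) (legρ : Legit E (sh ρ)) (legk : Legit E (sh k))
           (several : proj₂ (proj₂ (sh ρ)) ≡ true)
           {K : Subset X} {c : X → C} (U : Uniform E K c) (small : Small K) (n : ℕ) where
    open Uniform U
    open Chain (chain U)
    private
      first last : Maybe C
      first = proj₁ (sh ρ)
      last  = proj₁ (proj₂ (sh ρ))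

      p = proj₁ inhabited

      abstract
        succ-data : Σ (X → X) λ s → ∀ x → x ∈ K → s x ∈ Δ × x < s x × (∀ δ → δ ∈ Δ → x < δ → s x ≼ δ)
        succ-data = choice {R = λ x δ → δ ∈ Δ × x < δ × (∀ δ′ → δ′ ∈ Δ → x < δ′ → δ ≼ δ′)} p above

        pred-data : Σ (X → X) λ pr → ∀ x → x ∈ K → pr x ∈ Δ × pr x < x × (∀ δ → δ ∈ Δ → δ < x → δ ≼ pr x)
        pred-data = choice {R = λ x δ → δ ∈ Δ × δ < x × (∀ δ′ → δ′ ∈ Δ → δ′ < x → δ′ ≼ δ)} p below

      s pr : X → X
      s  = proj₁ succ-data
      pr = proj₁ pred-data

      module _ {x : X} (x∈ : x ∈ K) where
        s∈   = proj₁ (proj₂ succ-data x x∈)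
        x<s  = proj₁ (proj₂ (proj₂ succ-data x x∈))
        s-min = proj₂ (proj₂ (proj₂ succ-data x x∈))
        pr∈   = proj₁ (proj₂ pred-data x x∈)
        pr<x  = proj₁ (proj₂ (proj₂ pred-data x x∈))
        pr-max = proj₂ (proj₂ (proj₂ pred-data x x∈))

      pr-s : ∀ δ → δ ∈ Δ → pr (s δ) ≡ δ
      pr-s δ δ∈ = ≼-antisym
        (λ δ<pr → s-min (Δ⊆ δ δ∈) (pr (s δ)) (pr∈ s∈K) δ<pr (pr<x s∈K))
        (pr-max s∈K δ δ∈ (x<s (Δ⊆ δ δ∈)))
        where s∈K = Δ⊆ _ (s∈ (Δ⊆ δ δ∈))

      s-pr≼ : ∀ δ → δ ∈ Δ → s (pr δ) ≼ δ
      s-pr≼ δ δ∈ = s-min (Δ⊆ _ (pr∈ (Δ⊆ δ δ∈))) δ δ∈ (pr<x (Δ⊆ δ δ∈))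

      base : ∀ x → x ∈ K → ∃[ δ ] (δ ∈ Δ × δ ≼ x × x < s δ)
      base x x∈ with em {x ∈ Δ}
      ... | yes x∈Δ = x , x∈Δ , irr , x<s x∈
      ... | no x∉Δ  = pr x , pr∈ x∈ , asym (pr<x x∈) , above-x
        where
        prK = Δ⊆ _ (pr∈ x∈)
        above-x : x < s (pr x)
        above-x with compare x (s (pr x))
        ... | tri< l _ _ = l
        ... | tri≈ _ e _ = ⊥-elim (x∉Δ (subst (_∈ Δ) (sym e) (s∈ prK)))
        ... | tri> _ _ g = ⊥-elim (pr-max x∈ _ (s∈ prK) g (x<s prK))

    -- Every chain point `δ` gets a slot between `lo δ` and `hi δ`, before the next chain point.
    -- What remains between neighbouring slots becomes a piece of kind `ρ`; it contains `δ` and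
    -- `lo δ`, so `ρ` must be a kind with several points. The ends of the slots are parameters
    -- because the two options place them differently.
    module Build (lo hi : X → X)
      (lo∈ : ∀ δ → δ ∈ Δ → lo δ ∈ K) (hi∈ : ∀ δ → δ ∈ Δ → hi δ ∈ K)
      (δ<lo : ∀ δ → δ ∈ Δ → δ < lo δ) (lo<hi : ∀ δ → δ ∈ Δ → lo δ < hi δ) (hi<s : ∀ δ → δ ∈ Δ → hi δ < s δ)
      (unsplit : ∀ δ → δ ∈ Δ → Unsplit n (lo δ) (hi δ)) where

      private
        abstract
          slots : Σ (X → SlotData) λ S →
                  ∀ δ → δ ∈ Δ → Slot {E = E} {B = K} {c = c} (lo δ) (hi δ) first last (sh k) (S δ)
          slots = choice {R = λ δ → Slot {E = E} {B = K} {c = c} (lo δ) (hi δ) first last (sh k)}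
            (record { Λ = λ _ _ → true ; t₁ = p ; t₂ = p ; t = p })
            (λ δ δ∈ → slot dense small (lo∈ δ δ∈) (hi∈ δ δ∈) (lo<hi δ δ∈) first last (sh k)
                        (proj₁ legρ) (proj₁ (proj₂ legρ)) legk)

        module D (δ : X) = SlotData (proj₁ slots δ)
        module S (δ : X) (δ∈ : δ ∈ Δ) = Slot (proj₂ slots δ δ∈)
        open D using (Λ)

        -- Cut off from K the pieces (δ , 0), (δ , 1), … follow one another: ρ, region, k, region,
        -- and then the piece (s δ , 0).  For i ≥ 4 the piece (δ , i) is empty.
        floor : X → ℕ → Subset X
        floor δ zero    = Λ (pr δ) 3
        floor δ (suc i) = Λ δ i

        piece : X × ℕ → Subset X
        piece (δ , i) = Λ δ i ∖ floor δ i

        floor-initial : ∀ δ i → δ ∈ Δ → Initial (floor δ i) K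
        floor-initial δ zero    δ∈ = S.initial (pr δ) (pr∈ (Δ⊆ δ δ∈)) 3
        floor-initial δ (suc i) δ∈ = S.initial δ δ∈ i

        Λ-< : ∀ δ → δ ∈ Δ → ∀ i x → x ∈ Λ δ i → x < hi δ
        Λ-< δ δ∈ i x x∈ = Initial.separates (S.initial δ δ∈ 3) (S.bounded δ δ∈ i x x∈) (hi∈ δ δ∈) (S.y∉Λ₃ δ δ∈)

        Λ-mono : ∀ δ → δ ∈ Δ → ∀ {i j} → i ≤ⁿ j → ∀ x → x ∈ Λ δ i → x ∈ Λ δ j
        Λ-mono δ δ∈ i≤j x x∈ = go (ℕ.≤⇒≤′ i≤j)
          where
          go : ∀ {j} → _ ≤′ j → x ∈ Λ δ j
          go ≤′-refl     = x∈
          go (≤′-step h) = S.increase δ δ∈ _ x (go h)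

        lo∈Λ : ∀ δ → δ ∈ Δ → ∀ i → lo δ ∈ Λ δ i
        lo∈Λ δ δ∈ i = Λ-mono δ δ∈ z≤n _ (S.x∈Λ₀ δ δ∈)

        ≤lo∈Λ : ∀ δ → δ ∈ Δ → ∀ x → x ∈ K → x < lo δ → ∀ i → x ∈ Λ δ i
        ≤lo∈Λ δ δ∈ x x∈ l i = Initial.closed (S.initial δ δ∈ i) x (lo δ) x∈ (lo∈Λ δ δ∈ i) l

        pr-Λ-< : ∀ δ → δ ∈ Δ → ∀ i x → x ∈ Λ (pr δ) i → x < δ
        pr-Λ-< δ δ∈ i x x∈ = <-≼-trans (<-trans (Λ-< _ pr∈Δ i x x∈) (hi<s _ pr∈Δ)) (s-pr≼ δ δ∈)
          where pr∈Δ = pr∈ (Δ⊆ δ δ∈)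

        floor-step : ∀ δ → δ ∈ Δ → ∀ i x → x ∈ Λ (pr δ) 3 → x ∈ floor δ i
        floor-step δ δ∈ zero x x∈ = x∈
        floor-step δ δ∈ (suc i) x x∈ =
          ≤lo∈Λ δ δ∈ x (Initial.⊆-whole (floor-initial δ 0 δ∈) x x∈) (<-trans (pr-Λ-< δ δ∈ 3 x x∈) (δ<lo δ δ∈)) i

        across : ∀ δ δ′ → δ ∈ Δ → δ′ ∈ Δ → δ < δ′ → ∀ i j x → x ∈ Λ δ i → x ∈ floor δ′ j
        across δ δ′ δ∈ δ′∈ l i j x x∈ = floor-step δ′ δ′∈ j x x∈pr
          where
          δ≼pr = pr-max (Δ⊆ δ′ δ′∈) δ δ∈ l
          pr∈Δ = pr∈ (Δ⊆ δ′ δ′∈)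
          x∈pr : x ∈ Λ (pr δ′) 3
          x∈pr with ≼⇒<⊎≡ δ≼pr
          ... | inj₂ refl = S.bounded δ δ∈ i x x∈
          ... | inj₁ l′ = ≤lo∈Λ _ pr∈Δ x (Initial.⊆-whole (S.initial δ δ∈ i) x x∈)
                  (<-trans (<-≼-trans (<-trans (Λ-< δ δ∈ i x x∈) (hi<s δ δ∈)) (s-min (Δ⊆ δ δ∈) _ pr∈Δ l′)) (δ<lo _ pr∈Δ)) 3

        upward : ∀ δ → δ ∈ Δ → ∀ i j → i <ⁿ j → ∀ x → x ∈ Λ δ i → x ∈ floor δ j
        upward δ δ∈ i (suc j) (s≤s i≤j) x x∈ = Λ-mono δ δ∈ i≤j x x∈

        -- Pieces are differences of successive cuts, so a point belongs to the first cut that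
        -- contains it. A point beyond cut 3 of its own segment lies in the `ρ` piece that ends in
        -- the next segment.
        locate : ∀ x → x ∈ K → ∃[ a ] (proj₁ a ∈ Δ × x ∈ piece a)
        locate x x∈ with base x x∈
        ... | δ , δ∈ , δ≼x , x<sδ with em {x ∈ Λ δ 3}
        ...   | no x∉ = (s δ , 0) , s∈ (Δ⊆ δ δ∈) ,
                  ⌊⌋⁺ (≤lo∈Λ _ (s∈ (Δ⊆ δ δ∈)) x x∈ (<-trans x<sδ (δ<lo _ (s∈ (Δ⊆ δ δ∈)))) 0 ,
                       λ x∈pr → x∉ (subst (λ u → x ∈ Λ u 3) (pr-s δ δ∈) x∈pr))
        ...   | yes x∈Λ with least (λ i → x ∈ Λ δ i) (3 , x∈Λ)
        ...     | zero , x∈₀ , _ = (δ , 0) , δ∈ , ⌊⌋⁺ (x∈₀ , λ x∈pr → δ≼x (pr-Λ-< δ δ∈ 3 x x∈pr))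
        ...     | suc i , x∈ᵢ , min = (δ , suc i) , δ∈ , ⌊⌋⁺ (x∈ᵢ , λ x∈′ → ℕ.<-irrefl refl (min i x∈′))

        abstract
          address-data : Σ (X → X × ℕ) λ a → ∀ x → x ∈ K → proj₁ (a x) ∈ Δ × x ∈ piece (a x)
          address-data = choice {R = λ x a → proj₁ a ∈ Δ × x ∈ piece a} (p , 0) locate

        address : X → X × ℕ
        address = proj₁ address-data

        base∈ : ∀ x → x ∈ K → proj₁ (address x) ∈ Δ
        base∈ x x∈ = proj₁ (proj₂ address-data x x∈)

        piece∈ : ∀ x → x ∈ K → x ∈ piece (address x)
        piece∈ x x∈ = proj₂ (proj₂ address-data x x∈)

        unique : ∀ x a b → proj₁ a ∈ Δ → proj₁ b ∈ Δ → x ∈ piece a → x ∈ piece b → a ≡ b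
        unique x (δ , i) (δ′ , j) δ∈ δ′∈ x∈a x∈b with compare δ δ′
        ... | tri< l _ _ = ⊥-elim (proj₂ (⌊⌋⁻ x∈b) (across δ δ′ δ∈ δ′∈ l i j x (proj₁ (⌊⌋⁻ x∈a))))
        ... | tri> _ _ g = ⊥-elim (proj₂ (⌊⌋⁻ x∈a) (across δ′ δ δ′∈ δ∈ g j i x (proj₁ (⌊⌋⁻ x∈b))))
        ... | tri≈ _ refl _ with ℕ.<-cmp i j
        ...   | tri< l _ _ = ⊥-elim (proj₂ (⌊⌋⁻ x∈b) (upward δ δ∈ i j l x (proj₁ (⌊⌋⁻ x∈a))))
        ...   | tri> _ _ g = ⊥-elim (proj₂ (⌊⌋⁻ x∈a) (upward δ δ∈ j i g x (proj₁ (⌊⌋⁻ x∈b))))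
        ...   | tri≈ _ refl _ = refl

        piece⊆K : ∀ a → proj₁ a ∈ Δ → ∀ x → x ∈ piece a → x ∈ K
        piece⊆K (δ , i) δ∈ x x∈ = Initial.⊆-whole (S.initial δ δ∈ i) x (proj₁ (⌊⌋⁻ x∈))

        address≡ : ∀ x a → proj₁ a ∈ Δ → x ∈ piece a → address x ≡ a
        address≡ x a a∈ x∈ = unique x _ _ (base∈ x x∈K) a∈ (piece∈ x x∈K) x∈
          where x∈K = piece⊆K a a∈ x x∈

        kind : ℕ → Maybe Kd
        kind 0 = just ρ
        kind 2 = just k
        kind _ = nothing

        lab : X → Maybe Kd
        lab x = kind (proj₂ (address x))

        label-at : ∀ x δ i → δ ∈ Δ → x ∈ piece (δ , i) → lab x ≡ kind i
        label-at x δ i δ∈ x∈ = cong (λ a → kind (proj₂ a)) (address≡ x (δ , i) δ∈ x∈)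

        separated : ∀ x y δ i δ′ j → x ∈ Λ δ i → δ′ ∈ Δ → y ∈ piece (δ′ , j) → x ∈ floor δ′ j → x < y
        separated x y δ i δ′ j x∈ δ′∈ y∈ x∈low =
          Initial.separates (floor-initial δ′ j δ′∈) x∈low (piece⊆K (δ′ , j) δ′∈ y y∈) (proj₂ (⌊⌋⁻ y∈))

        empty : ∀ δ i → δ ∈ Δ → ∀ x → ¬ x ∈ piece (δ , suc (suc (suc (suc i))))
        empty δ i δ∈ x x∈ = proj₂ (⌊⌋⁻ x∈)
          (Λ-mono δ δ∈ (s≤s (s≤s (s≤s z≤n))) x (S.bounded δ δ∈ _ x (proj₁ (⌊⌋⁻ x∈))))

        module _ {C′ : Set} {Λ₁ Λ₂ : Subset X} (I₁ : Initial Λ₁ K) (I₂ : Initial Λ₂ K) {c : X → C′} where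
          noLeast-∖ : minColour (K ∖ Λ₁) c ≡ nothing → NoLeast (Λ₂ ∖ Λ₁)
          noLeast-∖ eq x x∈ =
            let x∈₂ , x∉ = ⌊⌋⁻ x∈
                w , w∈ , l = min-nothing⁻ eq x (⌊⌋⁺ (Initial.⊆-whole I₂ x x∈₂ , x∉))
                w∈K , w∉ = ⌊⌋⁻ w∈
            in w , ⌊⌋⁺ (Initial.closed I₂ w x w∈K x∈₂ l , w∉) , l
          noGreatest-∖ : maxColour Λ₂ c ≡ nothing → NoGreatest (Λ₂ ∖ Λ₁)
          noGreatest-∖ eq x x∈ =
            let x∈₂ , x∉ = ⌊⌋⁻ x∈
                w , w∈ , l = max-nothing⁻ eq x x∈₂
            in w , ⌊⌋⁺ (w∈ , λ w∈₁ → x∉ (Initial.closed I₁ x w (Initial.⊆-whole I₂ x x∈₂) w∈₁ l)) , l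

        region-ends : ∀ δ i → δ ∈ Δ → kind i ≡ nothing → NoLeast (piece (δ , i)) × NoGreatest (piece (δ , i))
        region-ends δ 1 δ∈ _ = noLeast-∖ (initial 0) (initial 1) min₀ , noGreatest-∖ (initial 0) (initial 1) max₁
          where open S δ δ∈
        region-ends δ 3 δ∈ _ = noLeast-∖ (initial 2) (initial 3) min₂ , noGreatest-∖ (initial 2) (initial 3) max₃
          where open S δ δ∈
        region-ends δ (suc (suc (suc (suc i)))) δ∈ _ = (λ x x∈ → ⊥-elim (empty δ i δ∈ x x∈)) , λ x x∈ → ⊥-elim (empty δ i δ∈ x x∈)

        region-slot : ∀ x δ i → δ ∈ Δ → x ∈ piece (δ , i) → kind i ≡ nothing → lo δ < x × x < hi δ
        region-slot x δ (suc (suc (suc (suc i)))) δ∈ x∈ _ = ⊥-elim (empty δ i δ∈ x x∈)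
        region-slot x δ 1 δ∈ x∈ _ = separated (lo δ) x δ 0 δ 1 (lo∈Λ δ δ∈ 0) δ∈ x∈ (lo∈Λ δ δ∈ 0) , Λ-< δ δ∈ 1 x (proj₁ (⌊⌋⁻ x∈))
        region-slot x δ 3 δ∈ x∈ _ = separated (lo δ) x δ 0 δ 3 (lo∈Λ δ δ∈ 0) δ∈ x∈ (lo∈Λ δ δ∈ 2) , Λ-< δ δ∈ 3 x (proj₁ (⌊⌋⁻ x∈))

        shapes : ∀ δ i κ → δ ∈ Δ → kind i ≡ just κ → F κ × shape (piece (δ , i)) c ≡ sh κ
        shapes δ 2 κ δ∈ refl = Fk , S.shape₂ δ δ∈
        -- The first colour of a `ρ` piece was arranged by cut 3 of the slot before it, the last one
        -- by cut 0 of the slot at `δ`.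
        shapes δ 0 κ δ∈ refl = Fρ , trans
          (between-initials {E = E} (floor-initial δ 0 δ∈) (S.initial δ δ∈ 0)
            (across (pr δ) δ pr∈Δ δ∈ (pr<x (Δ⊆ δ δ∈)) 3 1)
            (⌊⌋⁺ (≤lo∈Λ δ δ∈ δ (Δ⊆ δ δ∈) (δ<lo δ δ∈) 0 , λ δ∈pr → irr (pr-Λ-< δ δ∈ 3 δ δ∈pr)))
            (⌊⌋⁺ (lo∈Λ δ δ∈ 0 , λ lo∈pr → asym (δ<lo δ δ∈) (pr-Λ-< δ δ∈ 3 (lo δ) lo∈pr)))
            (δ<lo δ δ∈))
          (trans (cong₂ (λ m m′ → m , m′ , true) (S.min₃ (pr δ) pr∈Δ) (S.max₀ δ δ∈))
                 (cong (λ b → first , last , b) (sym several)))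
          where pr∈Δ = pr∈ (Δ⊆ δ δ∈)

        -- Finished pieces alternate with regions. The witness is `t₂` of the earlier slot, or `t₁`
        -- if the two pieces are the neighbours 0 and 2 at one chain point.
        between-pieces : ∀ x y δ i δ′ j κ κ′ → δ ∈ Δ → δ′ ∈ Δ → x ∈ piece (δ , i) → y ∈ piece (δ′ , j) → x < y →
          kind i ≡ just κ → kind j ≡ just κ′ → ¬ (δ , i) ≡ (δ′ , j) →
          ∃[ z ] (z ∈ K × x < z × z < y × lab z ≡ nothing)
        between-pieces x y δ i δ′ j κ κ′ δ∈ δ′∈ x∈ y∈ l ki kj ≢ with compare δ δ′
        ... | tri> _ _ g = ⊥-elim (asym l (separated y x δ′ j δ i (proj₁ (⌊⌋⁻ y∈)) δ∈ x∈
                              (across δ′ δ δ′∈ δ∈ g j i y (proj₁ (⌊⌋⁻ y∈)))))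
        ... | tri< δ<δ′ _ _ = D.t₂ δ , piece⊆K (δ , 3) δ∈ _ (S.t₂∈ δ δ∈) ,
              separated x (D.t₂ δ) δ i δ 3 (proj₁ (⌊⌋⁻ x∈)) δ∈ (S.t₂∈ δ δ∈) (early i ki (proj₁ (⌊⌋⁻ x∈))) ,
              separated (D.t₂ δ) y δ 3 δ′ j (proj₁ (⌊⌋⁻ (S.t₂∈ δ δ∈))) δ′∈ y∈
                (across δ δ′ δ∈ δ′∈ δ<δ′ 3 j (D.t₂ δ) (proj₁ (⌊⌋⁻ (S.t₂∈ δ δ∈)))) ,
              label-at _ δ 3 δ∈ (S.t₂∈ δ δ∈)
          where
          early : ∀ i → kind i ≡ just κ → x ∈ Λ δ i → x ∈ Λ δ 2
          early 0 _ x∈ = Λ-mono δ δ∈ z≤n x x∈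
          early 2 _ x∈ = x∈
        between-pieces x y δ 0 .δ 0 κ κ′ δ∈ δ′∈ x∈ y∈ l ki kj ≢ | tri≈ _ refl _ = ⊥-elim (≢ refl)
        between-pieces x y δ 2 .δ 2 κ κ′ δ∈ δ′∈ x∈ y∈ l ki kj ≢ | tri≈ _ refl _ = ⊥-elim (≢ refl)
        between-pieces x y δ 2 .δ 0 κ κ′ δ∈ δ′∈ x∈ y∈ l ki kj ≢ | tri≈ _ refl _ =
          ⊥-elim (asym l (separated y x δ 0 δ 2 (proj₁ (⌊⌋⁻ y∈)) δ∈ x∈ (S.increase δ δ∈ 0 y (proj₁ (⌊⌋⁻ y∈)))))
        between-pieces x y δ 0 .δ 2 κ κ′ δ∈ δ′∈ x∈ y∈ l ki kj ≢ | tri≈ _ refl _ =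
          D.t₁ δ , piece⊆K (δ , 1) δ∈ _ (S.t₁∈ δ δ∈) ,
          separated x (D.t₁ δ) δ 0 δ 1 (proj₁ (⌊⌋⁻ x∈)) δ∈ (S.t₁∈ δ δ∈) (proj₁ (⌊⌋⁻ x∈)) ,
          separated (D.t₁ δ) y δ 1 δ 2 (proj₁ (⌊⌋⁻ (S.t₁∈ δ δ∈))) δ∈ y∈ (proj₁ (⌊⌋⁻ (S.t₁∈ δ δ∈))) ,
          label-at _ δ 1 δ∈ (S.t₁∈ δ δ∈)

      built : Blocks sh F K c n k
      built = record
        { block = λ x → piece (address x)
        ; label = lab
        ; self = piece∈
        ; inside-K = λ x y x∈ y∈ → piece⊆K (address x) (base∈ x x∈) y y∈
        ; same-block = λ x y x∈ y∈ → cong piece (address≡ y (address x) (base∈ x x∈) y∈)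
        ; same-label = λ x y x∈ y∈ → cong (λ a → kind (proj₂ a)) (address≡ y (address x) (base∈ x x∈) y∈)
        ; convex = λ x x∈ u v w u∈ w∈ v∈ u<v v<w → let δ , i = address x in
            ⌊⌋⁺ ( Initial.closed (S.initial δ (base∈ x x∈) i) v w v∈ (proj₁ (⌊⌋⁻ w∈)) v<w
                , λ v∈low → proj₂ (⌊⌋⁻ u∈) (Initial.closed (floor-initial δ i (base∈ x x∈)) u v
                    (piece⊆K (δ , i) (base∈ x x∈) u u∈) v∈low u<v))
        ; region-noLeast = λ x x∈ eq → proj₁ (region-ends _ _ (base∈ x x∈) eq)
        ; region-noGreatest = λ x x∈ eq → proj₂ (region-ends _ _ (base∈ x x∈) eq)
        ; region-unsplit = λ x x∈ eq → let δ , i = address x in one-side δ i (base∈ x x∈) eq (unsplit δ (base∈ x x∈))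
        ; piece-shape = λ x κ x∈ eq → shapes _ _ κ (base∈ x x∈) eq
        ; has-piece = let δ , δ∈ , _ = above p (proj₂ inhabited)
                      in D.t δ , piece⊆K (δ , 2) δ∈ _ (S.t∈ δ δ∈) , label-at _ δ 2 δ∈ (S.t∈ δ δ∈)
        ; region-below = λ y y∈ →
            let δ , δ∈ , δ≼y , _ = base y y∈
                γ = pr δ
                γ∈ = pr∈ (Δ⊆ δ δ∈)
                t∈ = S.t₂∈ γ γ∈
            in D.t₂ γ , piece⊆K (γ , 3) γ∈ _ t∈ ,
               <-≼-trans (pr-Λ-< δ δ∈ 3 _ (proj₁ (⌊⌋⁻ t∈))) δ≼y ,
               label-at _ γ 3 γ∈ t∈ ,
               λ y∈p → δ≼y (pr-Λ-< δ δ∈ 3 y (proj₁ (⌊⌋⁻ (subst (λ a → y ∈ piece a) (address≡ _ _ γ∈ t∈) y∈p))))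
        ; region-above = λ y y∈ →
            let δ , δ∈ , _ , y<s = base y y∈
                γ = s δ
                γ∈ = s∈ (Δ⊆ δ δ∈)
                t∈ = S.t₁∈ γ γ∈
                y∈Λ = ≤lo∈Λ γ γ∈ y y∈ (<-trans y<s (δ<lo γ γ∈)) 0
            in D.t₁ γ , piece⊆K (γ , 1) γ∈ _ t∈ ,
               separated y _ γ 0 γ 1 y∈Λ γ∈ t∈ y∈Λ ,
               label-at _ γ 1 γ∈ t∈ ,
               λ y∈p → proj₂ (⌊⌋⁻ (subst (λ a → y ∈ piece a) (address≡ _ _ γ∈ t∈) y∈p)) y∈Λ
        ; region-between = λ x y κ κ′ x∈ y∈ x<y lx ly y∉ →
            between-pieces x y _ _ _ _ κ κ′ (base∈ x x∈) (base∈ y y∈) (piece∈ x x∈) (piece∈ y y∈) x<y lx ly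
              (λ e → y∉ (subst (λ a → y ∈ piece a) (sym e) (piece∈ y y∈)))
        }
        where
        one-side : ∀ δ i → δ ∈ Δ → kind i ≡ nothing → Unsplit n (lo δ) (hi δ) →
                   (∀ y → y ∈ piece (δ , i) → mark n y) ⊎ (∀ y → y ∈ piece (δ , i) → ¬ mark n y)
        one-side δ i δ∈ eq (inj₁ h) = inj₁ λ y y∈ → let l , l′ = region-slot y δ i δ∈ y∈ eq in h y (asym l) (asym l′)
        one-side δ i δ∈ eq (inj₂ h) = inj₂ λ y y∈ → let l , l′ = region-slot y δ i δ∈ y∈ eq in h y (asym l) (asym l′)

      slot-of : ∀ x → x ∈ K → Blocks.label built x ≡ nothing → ∃[ δ ] (δ ∈ Δ × lo δ < x × x < hi δ)
      slot-of x x∈ eq = _ , base∈ x x∈ , region-slot x _ _ (base∈ x x∈) (piece∈ x x∈) eq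

    private
      Quad : X → X × X × X × X → Set
      Quad δ (a , b , a′ , b′) = (a ∈ K × b ∈ K × a′ ∈ K × b′ ∈ K) ×
        (δ < a × a < b × b < a′ × a′ < b′ × b′ < s δ) × Unsplit n a b × Unsplit n a′ b′

      quadruple : ∀ δ → δ ∈ Δ → ∃ (Quad δ)
      quadruple δ δ∈ = (p₁ , p₂ , p₃ , p₄) , (p₁∈ , p₂∈ , p₃∈ , p₄∈) , (a<p₁ , p₁<p₂ , p₂<p₃ , p₃<p₄ , p₄<b) ,
          narrow irr (asym (<-trans p₂<p₃ p₃<p₄)) unsplit , narrow (asym (<-trans p₁<p₂ p₂<p₃)) irr unsplit
        where
        open FourPoints (fourPoints dense n (Δ⊆ δ δ∈) (Δ⊆ _ (s∈ (Δ⊆ δ δ∈))) (x<s (Δ⊆ δ δ∈)))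
        narrow : ∀ {a b a′ b′} → a ≼ a′ → b′ ≼ b → Unsplit n a b → Unsplit n a′ b′
        narrow l r (inj₁ h) = inj₁ λ x l′ r′ → h x (≼-trans l l′) (≼-trans r′ r)
        narrow l r (inj₂ h) = inj₂ λ x l′ r′ → h x (≼-trans l l′) (≼-trans r′ r)

      abstract
        quads : Σ (X → X × X × X × X) λ q → ∀ δ → δ ∈ Δ → Quad δ (q δ)
        quads = choice {R = Quad} (p , p , p , p) quadruple

      q₁ q₂ q₃ q₄ : X → X
      q₁ δ = proj₁ (proj₁ quads δ)
      q₂ δ = proj₁ (proj₂ (proj₁ quads δ))
      q₃ δ = proj₁ (proj₂ (proj₂ (proj₁ quads δ)))
      q₄ δ = proj₂ (proj₂ (proj₂ (proj₁ quads δ)))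

      module Q (δ : X) (δ∈ : δ ∈ Δ) where
        q₁∈ = proj₁ (proj₁ (proj₂ quads δ δ∈))
        q₂∈ = proj₁ (proj₂ (proj₁ (proj₂ quads δ δ∈)))
        q₃∈ = proj₁ (proj₂ (proj₂ (proj₁ (proj₂ quads δ δ∈))))
        q₄∈ = proj₂ (proj₂ (proj₂ (proj₁ (proj₂ quads δ δ∈))))
        δ<q₁ = proj₁ (proj₁ (proj₂ (proj₂ quads δ δ∈)))
        q₁<q₂ = proj₁ (proj₂ (proj₁ (proj₂ (proj₂ quads δ δ∈))))
        q₂<q₃ = proj₁ (proj₂ (proj₂ (proj₁ (proj₂ (proj₂ quads δ δ∈)))))
        q₃<q₄ = proj₁ (proj₂ (proj₂ (proj₂ (proj₁ (proj₂ (proj₂ quads δ δ∈))))))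
        q₄<s = proj₂ (proj₂ (proj₂ (proj₂ (proj₁ (proj₂ (proj₂ quads δ δ∈))))))
        unsplit₁ = proj₁ (proj₂ (proj₂ (proj₂ quads δ δ∈)))
        unsplit₂ = proj₂ (proj₂ (proj₂ (proj₂ quads δ δ∈)))

      module B₀ = Build q₁ q₂ Q.q₁∈ Q.q₂∈ Q.δ<q₁ Q.q₁<q₂
        (λ δ δ∈ → <-trans (Q.q₂<q₃ δ δ∈) (<-trans (Q.q₃<q₄ δ δ∈) (Q.q₄<s δ δ∈))) Q.unsplit₁
      module B₁ = Build q₃ q₄ Q.q₃∈ Q.q₄∈
        (λ δ δ∈ → <-trans (Q.δ<q₁ δ δ∈) (<-trans (Q.q₁<q₂ δ δ∈) (Q.q₂<q₃ δ δ∈)))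
        Q.q₃<q₄ Q.q₄<s Q.unsplit₂

      same-segment : ∀ {x δ δ′} → δ ∈ Δ → δ′ ∈ Δ → δ < x → x < s δ → δ′ < x → x < s δ′ → δ ≡ δ′
      same-segment {x} {δ} {δ′} δ∈ δ′∈ l r l′ r′ with compare δ δ′
      ... | tri< g _ _ = ⊥-elim (s-min (Δ⊆ δ δ∈) δ′ δ′∈ g (<-trans l′ r))
      ... | tri≈ _ e _ = e
      ... | tri> _ _ g = ⊥-elim (s-min (Δ⊆ δ′ δ′∈) δ δ∈ g (<-trans l r′))

      module _ (δ : X) (δ∈ : δ ∈ Δ) where
        open Q δ δ∈
        δ<q₃ : δ < q₃ δ
        δ<q₃ = <-trans δ<q₁ (<-trans q₁<q₂ q₂<q₃)
        q₂<s : q₂ δ < s δ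
        q₂<s = <-trans q₂<q₃ (<-trans q₃<q₄ q₄<s)

    abstract
      -- One option puts the slots between `q₁` and `q₂`, the other between `q₃` and `q₄`. Regions
      -- lie inside slots, so no point is in a region of both options, and the points between `δ`
      -- and `q₁ δ` are in no region of either.
      step : Step sh F K c n k
      step = record
        { blocks = λ { false → B₀.built ; true → B₁.built }
        ; disjoint = λ x x∈ e₁ e₀ → apart x (B₀.slot-of x x∈ e₀) (B₁.slot-of x x∈ e₁)
        ; covered = let δ , δ∈ , _ = above p (proj₂ inhabited) in
            δ , q₁ δ , Δ⊆ δ δ∈ , Q.q₁∈ δ δ∈ , Q.δ<q₁ δ δ∈ ,
            λ { x x∈ l l′ false e → free₀ δ δ∈ x l l′ (B₀.slot-of x x∈ e)
              ; x x∈ l l′ true e → free₁ δ δ∈ x l l′ (B₁.slot-of x x∈ e) }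
        }
        where
        apart : ∀ x → ∃[ δ ] (δ ∈ Δ × q₁ δ < x × x < q₂ δ) → ∃[ δ ] (δ ∈ Δ × q₃ δ < x × x < q₄ δ) → ⊥
        apart x (δ , δ∈ , l , r) (δ′ , δ′∈ , l′ , r′)
          with same-segment δ∈ δ′∈ (<-trans (Q.δ<q₁ δ δ∈) l) (<-trans r (q₂<s δ δ∈))
                 (<-trans (δ<q₃ δ′ δ′∈) l′) (<-trans r′ (Q.q₄<s δ′ δ′∈))
        ... | refl = asym (<-trans r (Q.q₂<q₃ δ δ∈)) l′
        module _ (δ : X) (δ∈ : δ ∈ Δ) (x : X) (l : δ < x) (r : x < q₁ δ) where
          r′ : x < s δ
          r′ = <-trans r (<-trans (Q.q₁<q₂ δ δ∈) (q₂<s δ δ∈))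
          free₀ : ∃[ δ ] (δ ∈ Δ × q₁ δ < x × x < q₂ δ) → ⊥
          free₀ (γ , γ∈ , m , m′)
            with same-segment δ∈ γ∈ l r′ (<-trans (Q.δ<q₁ γ γ∈) m) (<-trans m′ (q₂<s γ γ∈))
          ... | refl = asym r m
          free₁ : ∃[ δ ] (δ ∈ Δ × q₃ δ < x × x < q₄ δ) → ⊥
          free₁ (γ , γ∈ , m , m′)
            with same-segment δ∈ γ∈ l r′ (<-trans (δ<q₃ γ γ∈) m) (<-trans m′ (Q.q₄<s γ γ∈))
          ... | refl = asym r (<-trans (Q.q₁<q₂ δ δ∈) (<-trans (Q.q₂<q₃ δ δ∈) m))

-- Partitions into convex pieces with every kind dense.

module Arrangements (em : ExcludedMiddle 0ℓ) (ext : Extensionality 0ℓ 0ℓ) (O : SeparableOrder) where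
  open Classical em ext
  open Types em ext
  open Orders em ext
  open Order O
  open Shapes em ext O
  open Steps em ext O

  -- `f` sends a point to the representative of its piece. With representatives taken from `B`, the
  -- index order is a subset of `B` and can be fed to the induction hypothesis.
  record Arrangement {C Kd : Set} (sh : Kd → Shape C) (F : Subset Kd) (B : Subset X) (c : X → C) : Set where
    field
      f       : X → X
      R       : Subset X
      kind    : X → Kd
      R⊆B     : ∀ x → x ∈ R → x ∈ B
      fixed   : ∀ x → x ∈ R → f x ≡ x
      sum     : Sum _<_ _<_ B f R
      shapes  : ∀ i → i ∈ R → shape (fibre B f i) c ≡ sh (kind i)
      uniform : Uniform F R kind

  side-below : ∀ {K B x z z′} → Convex K B → x ∈ B → ¬ x ∈ K → z ∈ K → z′ ∈ K → x < z → x < z′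
  side-below {x = x} {z} {z′} cvx x∈ x∉ z∈ z′∈ l with compare x z′
  ... | tri< l′ _ _ = l′
  ... | tri≈ _ refl _ = ⊥-elim (x∉ z′∈)
  ... | tri> _ _ g = ⊥-elim (x∉ (cvx z′ x z z′∈ z∈ x∈ g l))

  side-above : ∀ {K B x z z′} → Convex K B → x ∈ B → ¬ x ∈ K → z ∈ K → z′ ∈ K → z < x → z′ < x
  side-above {x = x} {z} {z′} cvx x∈ x∉ z∈ z′∈ l with compare z′ x
  ... | tri< l′ _ _ = l′
  ... | tri≈ _ refl _ = ⊥-elim (x∉ z′∈)
  ... | tri> _ _ g = ⊥-elim (x∉ (cvx z x z′ z∈ z′∈ x∈ l g))

  module Scheme {C Kd : Set} {E : Subset C} (sh : Kd → Shape C) (F : Subset Kd)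
    (legit : ∀ k → k ∈ F → Legit E (sh k))
    (ρ : Kd) (ρ∈ : ρ ∈ F) (several : proj₂ (proj₂ (sh ρ)) ≡ true)
    (κ : ℕ → Kd) (κ∈ : ∀ n → κ n ∈ F) (hits : ∀ k → k ∈ F → ∀ m → ∃[ j ] κ (j + m) ≡ k)
    {B : Subset X} {c : X → C} (U : Uniform E B c) (small : Small B) where

    open Uniform U using (dense; inhabited)

    Good : Subset X → Set
    Good K = Uniform E K c × Small K

    State : Set
    State = Subset X × Maybe Kd

    with-label : ∀ {K : Subset X} {m m′ : Maybe Kd} → m ≡ m′ → _≡_ {A = State} (K , m) (K , m′)
    with-label {K} e = cong (λ m → K , m) e

    abstract
      -- Deciding `Good K` makes refinement a total function, so the stages can be defined by
      -- recursion before their invariants are known. At points of `B` the second case does not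
      -- arise, by `Stage.good`.
      refine : Bool → ℕ → Subset X → X → State
      refine β n K x with em {Good K}
      ... | yes (UK , smK) = block x , label x
        where open Blocks (Step.blocks (step sh (_∈ F) ρ∈ (κ∈ n) (legit ρ ρ∈) (legit _ (κ∈ n)) several UK smK n) β)
      ... | no _ = K , nothing

      refine-step : ∀ n K → Good K → Σ (Step sh (_∈ F) K c n (κ n)) λ st →
        ∀ β x → refine β n K x ≡ (Step.Option.block st β x , Step.Option.label st β x)
      refine-step n K good with em {Good K}
      ... | yes (UK , smK) = step sh (_∈ F) ρ∈ (κ∈ n) (legit ρ ρ∈) (legit _ (κ∈ n)) several UK smK n , λ _ _ → refl
      ... | no bad = ⊥-elim (bad good)

    next : Bool → ℕ → State → X → State
    next β n (K , just k)  x = K , just k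
    next β n (K , nothing) x = refine β n K x

    stage : List Bool → X → State
    stage []      x = B , nothing
    stage (β ∷ s) x = next β (length s) (stage s x) x

    -- The invariant behind the density of the limit is `gaps`: two finished pieces always have
    -- something open between them, and later steps put every kind there.
    record Stage (S : X → State) : Set where
      field
        self   : ∀ x {K m} → x ∈ B → S x ≡ (K , m) → x ∈ K
        ⊆B     : ∀ x {K m} → x ∈ B → S x ≡ (K , m) → ∀ y → y ∈ K → y ∈ B
        same   : ∀ x {K m} → x ∈ B → S x ≡ (K , m) → ∀ y → y ∈ K → S y ≡ (K , m)
        convex : ∀ x {K m} → x ∈ B → S x ≡ (K , m) → Convex K B
        open-ended  : ∀ x {K} → x ∈ B → S x ≡ (K , nothing) → NoLeast K × NoGreatest K
        shaped : ∀ x {K k} → x ∈ B → S x ≡ (K , just k) → k ∈ F × shape K c ≡ sh k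
        gaps   : ∀ x y {K K′ k k′} → x ∈ B → y ∈ B → S x ≡ (K , just k) → S y ≡ (K′ , just k′) → x < y → ¬ y ∈ K →
                 ∃[ z ] ∃[ K″ ] (z ∈ B × x < z × z < y × S z ≡ (K″ , nothing))

      good : ∀ x {K} → x ∈ B → S x ≡ (K , nothing) → Good K
      good x x∈ eq = record
        { dense = dense-convex dense (⊆B x x∈ eq) (convex x x∈ eq) ; inhabited = x , self x x∈ eq
        ; noLeast = proj₁ (open-ended x x∈ eq) ; noGreatest = proj₂ (open-ended x x∈ eq) } , small-⊆ (⊆B x x∈ eq) small

      region-step : ∀ n x {K} → x ∈ B → S x ≡ (K , nothing) → Σ (Step sh (_∈ F) K c n (κ n)) λ st →
        ∀ β y → y ∈ K → next β n (S y) y ≡ (Step.Option.block st β y , Step.Option.label st β y)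
      region-step n x {K} x∈ eq = let st , st≡ = refine-step n K (good x x∈ eq) in
        st , λ β y y∈ → trans (cong (λ s → next β n s y) (same x x∈ eq y y∈)) (st≡ β y)

    stage-zero : Stage (stage [])
    stage-zero = record
      { self = λ { x x∈ refl → x∈ } ; ⊆B = λ { x x∈ refl y y∈ → y∈ } ; same = λ { x x∈ refl y y∈ → refl }
      ; convex = λ { x x∈ refl u v w u∈ w∈ v∈ _ _ → v∈ }
      ; open-ended = λ { x x∈ refl → Uniform.noLeast U , Uniform.noGreatest U }
      ; shaped = λ { x x∈ () } ; gaps = λ { x y x∈ y∈ () } }

    module Next {S : X → State} (st : Stage S) (β : Bool) (n : ℕ) where
      open Stage st
      S′ : X → State
      S′ x = next β n (S x) x

      keep : ∀ x {K k} → S x ≡ (K , just k) → S′ x ≡ (K , just k)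
      keep x eq = cong (λ s → next β n s x) eq

      data View (x : X) : Set where
        kept  : ∀ K k → S x ≡ (K , just k) → S′ x ≡ (K , just k) → View x
        split : ∀ K (b : Blocks sh (_∈ F) K c n (κ n)) → S x ≡ (K , nothing) → x ∈ K →
                (∀ y → y ∈ K → S′ y ≡ (Blocks.block b y , Blocks.label b y)) → View x

      view : ∀ x → x ∈ B → View x
      view x x∈ with S x in eq
      ... | K , just k  = kept K k eq (keep x eq)
      ... | K , nothing = let b , h = region-step n x x∈ eq in split K (Step.blocks b β) eq (self x x∈ eq) (h β)

      record Cell (x : X) (K : Subset X) (m : Maybe Kd) : Set where
        field
          self′   : x ∈ K
          ⊆B′     : ∀ y → y ∈ K → y ∈ B
          same′   : ∀ y → y ∈ K → S′ y ≡ (K , m)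
          convex′ : Convex K B
          open′   : m ≡ nothing → NoLeast K × NoGreatest K
          shaped′ : ∀ k → m ≡ just k → k ∈ F × shape K c ≡ sh k

      cell : ∀ x {K m} → x ∈ B → S′ x ≡ (K , m) → Cell x K m
      cell x x∈ eq′ with view x x∈
      ... | kept K k eq eq″ with trans (sym eq′) eq″
      ...   | refl = record
              { self′ = self x x∈ eq ; ⊆B′ = ⊆B x x∈ eq
              ; same′ = λ y y∈ → keep y (same x x∈ eq y y∈)
              ; convex′ = convex x x∈ eq ; open′ = λ () ; shaped′ = λ { k refl → shaped x x∈ eq } }
      cell x x∈ eq′ | split K b eq x∈K h with trans (sym eq′) (h x x∈K)
      ...   | refl = record
              { self′ = b.self x x∈K ; ⊆B′ = λ y y∈ → ⊆B x x∈ eq y (b.inside-K x y x∈K y∈)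
              ; same′ = λ y y∈ → trans (h y (b.inside-K x y x∈K y∈))
                          (cong₂ _,_ (b.same-block x y x∈K y∈) (b.same-label x y x∈K y∈))
              ; convex′ = λ u v w u∈ w∈ v∈ l l′ → b.convex x x∈K u v w u∈ w∈
                  (convex x x∈ eq u v w (b.inside-K x u x∈K u∈) (b.inside-K x w x∈K w∈) v∈ l l′) l l′
              ; open′ = λ e → b.region-noLeast x x∈K e , b.region-noGreatest x x∈K e
              ; shaped′ = λ k e → b.piece-shape x k x∈K e }
              where module b = Blocks b

      region-above′ : ∀ x {K} → x ∈ B → S x ≡ (K , nothing) → ∃[ z ] ∃[ K′ ] (z ∈ K × x < z × S′ z ≡ (K′ , nothing) × ¬ x ∈ K′ × (∀ y → y ∈ K′ → y ∈ K))
      region-above′ x x∈ eq with view x x∈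
      ... | kept K k eq₁ _ = ⊥-elim (just≢nothing (cong proj₂ eq₁) (cong proj₂ eq))
      ... | split K b eq₁ x∈K h with trans (sym eq) eq₁
      ...   | refl = let z , z∈ , l , e , x∉ = Blocks.region-above b x x∈K
                     in z , _ , z∈ , l , trans (h z z∈) (with-label e) , x∉ , λ y y∈ → Blocks.inside-K b z y z∈ y∈

      region-below′ : ∀ x {K} → x ∈ B → S x ≡ (K , nothing) → ∃[ z ] ∃[ K′ ] (z ∈ K × z < x × S′ z ≡ (K′ , nothing) × ¬ x ∈ K′ × (∀ y → y ∈ K′ → y ∈ K))
      region-below′ x x∈ eq with view x x∈
      ... | kept K k eq₁ _ = ⊥-elim (just≢nothing (cong proj₂ eq₁) (cong proj₂ eq))
      ... | split K b eq₁ x∈K h with trans (sym eq) eq₁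
      ...   | refl = let z , z∈ , l , e , x∉ = Blocks.region-below b x x∈K
                     in z , _ , z∈ , l , trans (h z z∈) (with-label e) , x∉ , λ y y∈ → Blocks.inside-K b z y z∈ y∈

      piece-in′ : ∀ x {K} → x ∈ B → S x ≡ (K , nothing) → ∃[ z ] ∃[ K′ ] (z ∈ K × S′ z ≡ (K′ , just (κ n)) × (∀ y → y ∈ K′ → y ∈ K))
      piece-in′ x x∈ eq with view x x∈
      ... | kept K k eq₁ _ = ⊥-elim (just≢nothing (cong proj₂ eq₁) (cong proj₂ eq))
      ... | split K b eq₁ x∈K h with trans (sym eq) eq₁
      ...   | refl = let z , z∈ , e = Blocks.has-piece b
                     in z , _ , z∈ , trans (h z z∈) (with-label e) , λ y y∈ → Blocks.inside-K b z y z∈ y∈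

      not-in : ∀ x z {K K′ k} → z ∈ B → S x ≡ (K , just k) → S z ≡ (K′ , nothing) → ¬ x ∈ K′
      not-in x z z∈ eq eq′ x∈ = just≢nothing (cong proj₂ eq) (cong proj₂ (same z z∈ eq′ x x∈))

      -- A freshly cut cell has regions below and above each of its points, which separate its
      -- pieces from everything outside the cell. Two pieces of the same cell are separated by
      -- `region-between`; between two older pieces the old gap is cut in turn and keeps a region.
      gaps′ : ∀ x y {K K′ k k′} → x ∈ B → y ∈ B → S′ x ≡ (K , just k) → S′ y ≡ (K′ , just k′) → x < y → ¬ y ∈ K →
              ∃[ z ] ∃[ K″ ] (z ∈ B × x < z × z < y × S′ z ≡ (K″ , nothing))
      gaps′ x y x∈ y∈ eqx eqy l y∉ with view x x∈ | view y y∈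
      ... | kept K k eq e | kept K′ k′ eq′ e′ with trans (sym eqx) e
      ...   | refl =
              let z , K″ , z∈ , x<z , z<y , eqz = gaps x y x∈ y∈ eq eq′ l y∉
                  w , Kw , w∈ , _ , eqw , _ = region-above′ z z∈ eqz
                  cvx = convex z z∈ eqz
                  z∈K = self z z∈ eqz
              in w , Kw , ⊆B z z∈ eqz w w∈ ,
                 side-below cvx x∈ (not-in x z z∈ eq eqz) z∈K w∈ x<z ,
                 side-above cvx y∈ (not-in y z z∈ eq′ eqz) z∈K w∈ z<y , eqw
      gaps′ x y x∈ y∈ eqx eqy l y∉ | kept K k eq e | split K′ b eq′ y∈K h =
              let w , Kw , w∈ , w<y , eqw , _ = region-below′ y y∈ eq′
              in w , Kw , ⊆B y y∈ eq′ w w∈ , side-below (convex y y∈ eq′) x∈ (not-in x y y∈ eq eq′) y∈K w∈ l , w<y , eqw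
      gaps′ x y x∈ y∈ eqx eqy l y∉ | split K b eq x∈K h | _ with em {y ∈ K}
      ...   | no y∉K =
              let w , Kw , w∈ , x<w , eqw , _ = region-above′ x x∈ eq
              in w , Kw , ⊆B x x∈ eq w w∈ , x<w , side-above (convex x x∈ eq) y∈ y∉K x∈K w∈ l , eqw
      ...   | yes y∈K =
              let e = trans (sym eqx) (h x x∈K)
                  z , z∈ , x<z , z<y , ez = Blocks.region-between b x y _ _ x∈K y∈K l (sym (cong proj₂ e))
                    (cong proj₂ (trans (sym (h y y∈K)) eqy)) (λ y∈b → y∉ (subst (y ∈_) (sym (cong proj₁ e)) y∈b))
              in z , _ , ⊆B x x∈ eq z z∈ , x<z , z<y , trans (h z z∈) (with-label ez)

      stage-next : Stage S′
      stage-next = record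
        { self = λ x x∈ eq → Cell.self′ (cell x x∈ eq) ; ⊆B = λ x x∈ eq → Cell.⊆B′ (cell x x∈ eq)
        ; same = λ x x∈ eq → Cell.same′ (cell x x∈ eq) ; convex = λ x x∈ eq → Cell.convex′ (cell x x∈ eq)
        ; open-ended = λ x x∈ eq → Cell.open′ (cell x x∈ eq) refl
        ; shaped = λ x x∈ eq → Cell.shaped′ (cell x x∈ eq) _ refl
        ; gaps = λ x y → gaps′ x y }

    stages : ∀ s → Stage (stage s)
    stages []      = stage-zero
    stages (β ∷ s) = Next.stage-next (stages s) β (length s)

    length-↾ : ∀ r n → length (r ↾ n) ≡ n
    length-↾ r zero    = refl
    length-↾ r (suc n) = cong suc (length-↾ r n)

    Uncovered : List Bool → X → Set
    Uncovered s x = x ∈ B × proj₂ (stage s x) ≡ nothing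

    uncovered-anti : ∀ β s x → Uncovered (β ∷ s) x → Uncovered s x
    uncovered-anti β s x (x∈ , e) with stage s x
    ... | K , nothing = x∈ , refl

    label-at-stage : ∀ s x {K} (st : Step sh (_∈ F) K c (length s) (κ (length s))) →
      (∀ β y → y ∈ K → next β (length s) (stage s y) y ≡ (Step.Option.block st β y , Step.Option.label st β y)) →
      x ∈ K → ∀ β → Uncovered (β ∷ s) x → Step.Option.label st β x ≡ nothing
    label-at-stage s x st h x∈ β (_ , e) = trans (sym (cong proj₂ (h β x x∈))) e

    uncovered-disjoint : ∀ s x → Uncovered (true ∷ s) x → ¬ Uncovered (false ∷ s) x
    uncovered-disjoint s x t t′ =
      let x∈ , e = uncovered-anti true s x t
          eq = with-label e
          st , h = Stage.region-step (stages s) (length s) x x∈ eq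
          x∈K = Stage.self (stages s) x x∈ eq
      in Step.disjoint st x x∈K (label-at-stage s x st h x∈K true t) (label-at-stage s x st h x∈K false t′)

    module _ (r : ℕ → Bool) where

      S : ℕ → X → State
      S n = stage (r ↾ n)

      state : ∀ n → Stage (S n)
      state n = stages (r ↾ n)

      shrink : ∀ n x {K m K′ m′} → x ∈ B → S n x ≡ (K , m) → S (suc n) x ≡ (K′ , m′) → ∀ y → y ∈ K′ → y ∈ K
      shrink n x x∈ eq eq′ y y∈ with Next.view (state n) (r n) (length (r ↾ n)) x x∈
      ... | Next.kept K k e e′ = subst (λ s → y ∈ proj₁ s) (trans (sym e) eq) (subst (λ s → y ∈ proj₁ s) (trans (sym eq′) e′) y∈)
      ... | Next.split K b e x∈K h = subst (λ s → y ∈ proj₁ s) (trans (sym e) eq)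
              (Blocks.inside-K b x y x∈K (subst (λ s → y ∈ proj₁ s) (trans (sym eq′) (h x x∈K)) y∈))

      shrink* : ∀ n j x {K m K′ m′} → x ∈ B → S n x ≡ (K , m) → S (j + n) x ≡ (K′ , m′) → ∀ y → y ∈ K′ → y ∈ K
      shrink* n zero    x x∈ eq eq′ y y∈ = subst (λ s → y ∈ proj₁ s) (trans (sym eq′) eq) y∈
      shrink* n (suc j) x x∈ eq eq′ y y∈ = shrink* n j x x∈ eq refl y (shrink (j + n) x x∈ refl eq′ y y∈)

      stable : ∀ n j x {K k} → S n x ≡ (K , just k) → S (j + n) x ≡ (K , just k)
      stable n zero    x eq = eq
      stable n (suc j) x eq = cong (λ s → next _ _ s x) (stable n j x eq)

      stableʳ : ∀ n j x {K k} → S n x ≡ (K , just k) → S (n + j) x ≡ (K , just k)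
      stableʳ n j x {K} {k} eq = subst (λ i → S i x ≡ (K , just k)) (ℕ.+-comm j n) (stable n j x eq)

      unsplit : ∀ n x {K} → x ∈ B → S (suc n) x ≡ (K , nothing) → (∀ y → y ∈ K → mark n y) ⊎ (∀ y → y ∈ K → ¬ mark n y)
      unsplit n x {K′} x∈ eq with Next.view (state n) (r n) (length (r ↾ n)) x x∈
      ... | Next.kept K k e e′ = ⊥-elim (just≢nothing (cong proj₂ e′) (cong proj₂ eq))
      ... | Next.split K b e x∈K h with trans (sym eq) (h x x∈K)
      ...   | e″ = subst (λ i → (∀ y → y ∈ K′ → mark i y) ⊎ (∀ y → y ∈ K′ → ¬ mark i y)) (length-↾ r n)
                     (subst (λ K′ → (∀ y → y ∈ K′ → mark (length (r ↾ n)) y) ⊎ (∀ y → y ∈ K′ → ¬ mark (length (r ↾ n)) y)) (sym (cong proj₁ e″))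
                       (Blocks.region-unsplit b x x∈K (sym (cong proj₂ e″))))

      uncovered-thin : ∀ z → z ∈ B → (∀ n → Uncovered (r ↾ n) z) → ∀ a b → a < z → z < b →
        ∃[ n ] ∃[ u ] ∃[ v ] (a ≼ u × u < v × v ≼ b ×
          (∀ x → x ∈ B → u < x → x < v → Uncovered (r ↾ n) x × (∀ β → ¬ Uncovered (β ∷ r ↾ n) x)))
      uncovered-thin z z∈ unc a b a<z z<b =
        let m₁ , a∈ , z∉ = sep a<z
            m₂ , z∈m , b∉ = sep z<b
            -- By stage `n` both the mark separating `a` from `z` and the one separating `z` from
            -- `b` have been used. The cell of `z` is split by neither, so it lies between `a` and
            -- `b`.
            n = m₂ + suc m₁
            eq : ∀ i → S i z ≡ (proj₁ (S i z) , nothing)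
            eq i = with-label (proj₂ (unc i))
            K = proj₁ (S n z)
            st , h = Stage.region-step (state n) (length (r ↾ n)) z z∈ (eq n)
            u , v , u∈ , v∈ , u<v , cov = Step.covered st
            sub₁ : ∀ y → y ∈ K → y ∈ proj₁ (S (suc m₁) z)
            sub₁ = shrink* (suc m₁) m₂ z z∈ (eq (suc m₁)) (eq n)
            sub₂ : ∀ y → y ∈ K → y ∈ proj₁ (S (suc m₂) z)
            sub₂ = shrink* (suc m₂) m₁ z z∈ (eq (suc m₂))
                     (subst (λ i → S i z ≡ (K , nothing)) (trans (ℕ.+-suc m₂ m₁) (trans (cong suc (ℕ.+-comm m₂ m₁)) (sym (ℕ.+-suc m₁ m₂)))) (eq n))
            cvx = Stage.convex (state n) z z∈ (eq n)
        in n , u , v ,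
           [ (λ all → ⊥-elim (z∉ (all z (Stage.self (state (suc m₁)) z z∈ (eq (suc m₁))))))
           , (λ none u<a → none u (sub₁ u u∈) (down m₁ u<a a∈)) ]′ (unsplit m₁ z z∈ (eq (suc m₁))) ,
           u<v ,
           [ (λ all b<v → b∉ (down m₂ b<v (all v (sub₂ v v∈))))
           , (λ none → ⊥-elim (none z (Stage.self (state (suc m₂)) z z∈ (eq (suc m₂))) z∈m)) ]′ (unsplit m₂ z z∈ (eq (suc m₂))) ,
           λ x x∈ u<x x<v → let x∈K = cvx u x v u∈ v∈ x∈ u<x x<v in
             (x∈ , cong proj₂ (Stage.same (state n) z z∈ (eq n) x x∈K)) ,
             λ β t → cov x x∈K u<x x<v β (label-at-stage (r ↾ n) x st h x∈K β t)

      -- The kind `k` is due after `j` more steps. Until then one retreats at each step into a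
      -- region of the current region.
      piece-in : ∀ j m k → k ∈ F → κ (j + m) ≡ k → ∀ z {K} → z ∈ B → S m z ≡ (K , nothing) →
        ∃[ w ] ∃[ K′ ] ∃[ i ] (w ∈ K × S (i + m) w ≡ (K′ , just k) × (∀ y → y ∈ K′ → y ∈ K))
      piece-in zero m k k∈ κ≡ z z∈ eq =
        let w , K′ , w∈ , eqw , sub = Next.piece-in′ (state m) (r m) (length (r ↾ m)) z z∈ eq
        in w , K′ , 1 , w∈ , trans eqw (cong (λ i → K′ , just i) (trans (cong κ (length-↾ r m)) κ≡)) , sub
      piece-in (suc j) m k k∈ κ≡ z z∈ eq =
        let z′ , K₁ , z′∈ , _ , eq′ , _ , sub = Next.region-below′ (state m) (r m) (length (r ↾ m)) z z∈ eq
            w , K′ , i , w∈ , eqw , sub′ = piece-in j (suc m) k k∈ (trans (cong κ (ℕ.+-suc j m)) κ≡) z′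
                                             (Stage.⊆B (state m) z z∈ eq z′ z′∈) eq′
        in w , K′ , suc i , sub w w∈ , subst (λ q → S q w ≡ (K′ , just k)) (ℕ.+-suc i m) eqw ,
           λ y y∈ → sub y (sub′ y y∈)

      module Limit (covers : ∀ x → x ∈ B → ∃[ n ] ¬ Uncovered (r ↾ n) x) where

        final-data : Σ (X → Subset X × Kd) λ G → ∀ x → x ∈ B → ∃[ n ] S n x ≡ (proj₁ (G x) , just (proj₂ (G x)))
        final-data = choice (B , ρ) go
          where
          go : ∀ x → x ∈ B → ∃[ g ] ∃[ n ] S n x ≡ (proj₁ g , just (proj₂ g))
          go x x∈ with covers x x∈
          ... | n , ¬u with S n x in eq
          ...   | K , just k  = (K , k) , n , eq
          ...   | K , nothing = ⊥-elim (¬u (x∈ , refl))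

        G : X → Subset X × Kd
        G = proj₁ final-data

        final : ∀ x → x ∈ B → ∃[ n ] S n x ≡ (proj₁ (G x) , just (proj₂ (G x)))
        final = proj₂ final-data

        determined : ∀ n x {K k} → x ∈ B → S n x ≡ (K , just k) → G x ≡ (K , k)
        determined n x x∈ eq with final x x∈
        ... | m , eq′ with trans (sym (stableʳ m n x eq′)) (stable n m x eq)
        ...   | e = split-eq e
          where
          split-eq : ∀ {K K′ k k′} → (K , just k) ≡ (K′ , just k′) → (K , k) ≡ (K′ , k′)
          split-eq refl = refl

        block : X → Subset X
        block x = proj₁ (G x)

        self : ∀ x → x ∈ B → x ∈ block x
        self x x∈ = let n , eq = final x x∈ in Stage.self (state n) x x∈ eq

        block⊆B : ∀ x → x ∈ B → ∀ y → y ∈ block x → y ∈ B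
        block⊆B x x∈ = let n , eq = final x x∈ in Stage.⊆B (state n) x x∈ eq

        G-same : ∀ x → x ∈ B → ∀ y → y ∈ block x → G y ≡ G x
        G-same x x∈ y y∈ = let n , eq = final x x∈ in
          determined n y (block⊆B x x∈ y y∈) (Stage.same (state n) x x∈ eq y y∈)

        block-convex : ∀ x → x ∈ B → Convex (block x) B
        block-convex x x∈ = let n , eq = final x x∈ in Stage.convex (state n) x x∈ eq

        -- The representative is chosen from the block as a set, so all points of a block get the
        -- same one.
        pick-data : Σ (Subset X → X) λ g → ∀ P → ∃ (_∈ P) → g P ∈ P
        pick-data = choice (proj₁ inhabited) λ P h → h

        f : X → X
        f x = proj₁ pick-data (block x)

        f∈ : ∀ x → x ∈ B → f x ∈ block x
        f∈ x x∈ = proj₂ pick-data (block x) (x , self x x∈)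

        f-same : ∀ x → x ∈ B → ∀ y → y ∈ block x → f y ≡ f x
        f-same x x∈ y y∈ = cong (λ g → proj₁ pick-data (proj₁ g)) (G-same x x∈ y y∈)

        fB : ∀ x → x ∈ B → f x ∈ B
        fB x x∈ = block⊆B x x∈ (f x) (f∈ x x∈)

        R : Subset X
        R = ⟪ (λ x → x ∈ B × f x ≡ x) ⟫

        f∈R : ∀ x → x ∈ B → f x ∈ R
        f∈R x x∈ = ⌊⌋⁺ (fB x x∈ , f-same x x∈ (f x) (f∈ x x∈))

        symmetric : ∀ x y → x ∈ B → y ∈ B → y ∈ block x → x ∈ block y
        symmetric x y x∈ y∈ h = subst (λ g → x ∈ proj₁ g) (sym (G-same x x∈ y h)) (self x x∈)

        f-< : ∀ x y → x ∈ B → y ∈ B → x < y → ¬ y ∈ block x → f x < f y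
        f-< x y x∈ y∈ l y∉ = side-below (block-convex y y∈) (fB x x∈) fx∉ (self y y∈) (f∈ y y∈)
                               (side-above (block-convex x x∈) y∈ y∉ (self x x∈) (f∈ x x∈) l)
          where
          fx∉ : ¬ f x ∈ block y
          fx∉ h = y∉ (subst (λ g → y ∈ proj₁ g) (G-same x x∈ (f x) (f∈ x x∈)) (symmetric y (f x) y∈ (fB x x∈) h))

        mono : ∀ x y → x ∈ B → y ∈ B → x < y → f x < f y ⊎ f x ≡ f y
        mono x y x∈ y∈ l with em {y ∈ block x}
        ... | yes h = inj₂ (sym (f-same x x∈ y h))
        ... | no h  = inj₁ (f-< x y x∈ y∈ l h)

        back : ∀ x y → x ∈ B → y ∈ B → f x < f y → x < y
        back x y x∈ y∈ l with compare x y
        ... | tri< l′ _ _ = l′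
        ... | tri≈ _ refl _ = ⊥-elim (irr l)
        ... | tri> _ _ g with mono y x y∈ x∈ g
        ...   | inj₁ l′ = ⊥-elim (asym l l′)
        ...   | inj₂ e  = ⊥-elim (irr (subst (_< f y) (sym e) l))

        fibre≡ : ∀ i → i ∈ R → fibre B f i ≡ block i
        fibre≡ i i∈ = subset-ext
          (λ {x} x∈ → let x∈B , fx≡ = ⌊⌋⁻ x∈ in
            subst (λ g → x ∈ proj₁ g) (trans (sym (G-same x x∈B (f x) (f∈ x x∈B))) (cong G fx≡)) (self x x∈B))
          (λ {x} x∈ → ⌊⌋⁺ (block⊆B i i∈B x x∈ , trans (f-same i i∈B x x∈) fi≡))
          where
          i∈B = proj₁ (⌊⌋⁻ i∈)
          fi≡ = proj₂ (⌊⌋⁻ i∈)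

        kind : X → Kd
        kind x = proj₂ (G x)

        shaped : ∀ x → x ∈ B → kind x ∈ F × shape (block x) c ≡ sh (kind x)
        shaped x x∈ = let n , eq = final x x∈ in Stage.shaped (state n) x x∈ eq

        representative : ∀ n z {K} → z ∈ B → S n z ≡ (K , nothing) → ∀ k → k ∈ F →
          ∃[ i ] (i ∈ R × kind i ≡ k × i ∈ K)
        representative n z z∈ eq k k∈ =
          let j , κ≡ = hits k k∈ n
              w , K′ , i , w∈ , eqw , sub = piece-in j n k k∈ κ≡ z z∈ eq
              w∈B = Stage.⊆B (state n) z z∈ eq w w∈
              Gw = determined (i + n) w w∈B eqw
          in f w , f∈R w w∈B , cong proj₂ (trans (G-same w w∈B (f w) (f∈ w w∈B)) Gw) ,
             sub (f w) (subst (λ g → f w ∈ proj₁ g) Gw (f∈ w w∈B))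

        -- At stage `m + n` both pieces are finished. The region that `gaps` finds between them
        -- receives a piece of every kind later on, and finished pieces never change again.
        R-between : ∀ i j → i ∈ R → j ∈ R → i < j → ∀ k → k ∈ F → ∃[ z ] (z ∈ R × i < z × z < j × kind z ≡ k)
        R-between i j i∈ j∈ l k k∈ =
          let i∈B , fi = ⌊⌋⁻ i∈
              j∈B , fj = ⌊⌋⁻ j∈
              n , eqi = final i i∈B
              m , eqj = final j j∈B
              eqi′ = stable n m i eqi
              eqj′ = stableʳ m n j eqj
              j∉ = λ j∈i → irr (subst (_< j) (trans (sym fi) (trans (sym (f-same i i∈B j j∈i)) fj)) l)
              z , K , z∈ , i<z , z<j , eqz = Stage.gaps (state (m + n)) i j i∈B j∈B eqi′ eqj′ l j∉
              w , w∈R , kw , w∈K = representative (m + n) z z∈ eqz k k∈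
              cvx = Stage.convex (state (m + n)) z z∈ eqz
              z∈K = Stage.self (state (m + n)) z z∈ eqz
              out : ∀ x {K′ k} → S (m + n) x ≡ (K′ , just k) → ¬ x ∈ K
              out x e x∈ = just≢nothing (cong proj₂ e) (cong proj₂ (Stage.same (state (m + n)) z z∈ eqz x x∈))
          in w , w∈R , side-below cvx i∈B (out i eqi′) z∈K w∈K i<z , side-above cvx j∈B (out j eqj′) z∈K w∈K z<j , kw

        R-noLeast : NoLeast R
        R-noLeast i i∈ =
          let i∈B = proj₁ (⌊⌋⁻ i∈)
              z , K , z∈ , z<i , eqz , i∉ , _ = Next.region-below′ (state 0) (r 0) 0 i i∈B refl
              w , w∈R , _ , w∈K = representative 1 z z∈ eqz ρ ρ∈
          in w , w∈R , side-above (Stage.convex (state 1) z z∈ eqz) i∈B i∉ (Stage.self (state 1) z z∈ eqz) w∈K z<i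

        R-noGreatest : NoGreatest R
        R-noGreatest i i∈ =
          let i∈B = proj₁ (⌊⌋⁻ i∈)
              z , K , z∈ , i<z , eqz , i∉ , _ = Next.region-above′ (state 0) (r 0) 0 i i∈B refl
              w , w∈R , _ , w∈K = representative 1 z z∈ eqz ρ ρ∈
          in w , w∈R , side-below (Stage.convex (state 1) z z∈ eqz) i∈B i∉ (Stage.self (state 1) z z∈ eqz) w∈K i<z

        arrangement : Arrangement sh F B c
        arrangement = record
          { f = f ; R = R ; kind = kind
          ; R⊆B = λ x x∈ → proj₁ (⌊⌋⁻ x∈) ; fixed = λ x x∈ → proj₂ (⌊⌋⁻ x∈)
          ; sum = record { into = f∈R ; mono = mono ; back = back }
          ; shapes = λ i i∈ → trans (cong (λ P → shape P c) (fibre≡ i i∈)) (proj₂ (shaped i (proj₁ (⌊⌋⁻ i∈))))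
          ; uniform = record
            { dense = record
              { colour = λ i i∈ → proj₁ (shaped i (proj₁ (⌊⌋⁻ i∈)))
              ; between = λ i j i∈ j∈ l k k∈ → R-between i j i∈ j∈ l k k∈ }
            ; inhabited = f (proj₁ inhabited) , f∈R _ (proj₂ inhabited)
            ; noLeast = R-noLeast ; noGreatest = R-noGreatest } }

    arrange : Arrangement sh F B c
    arrange = let r , covers = escape small Uncovered uncovered-anti uncovered-disjoint uncovered-thin
              in Limit.arrangement r covers

-- Pairing of natural numbers and recurring enumerations.

module Pairing where

  diagonal-next : ℕ × ℕ → ℕ × ℕ
  diagonal-next (zero  , b) = suc b , zero
  diagonal-next (suc a , b) = a , suc b

  unpair : ℕ → ℕ × ℕ
  unpair zero    = zero , zero
  unpair (suc n) = diagonal-next (unpair n)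

  unpair-surjective : ∀ a b → ∃[ n ] unpair n ≡ (a , b)
  unpair-surjective a b = go (b + a) b a refl
    where
    go : ∀ s b a → b + a ≡ s → ∃[ n ] unpair n ≡ (a , b)
    go s zero zero _ = 0 , refl
    go (suc s) zero (suc a) e = let n , p = go s a zero (trans (ℕ.+-identityʳ a) (ℕ.suc-injective e))
                                in suc n , cong diagonal-next p
    go s (suc b) a e = let n , p = go s b (suc a) (trans (ℕ.+-suc b a) e) in suc n , cong diagonal-next p

  unpair-bound : ∀ n → proj₁ (unpair n) + proj₂ (unpair n) ≤ⁿ n
  unpair-bound zero = z≤n
  unpair-bound (suc n) with unpair n | unpair-bound n
  ... | zero  , b | h = s≤s (subst (_≤ⁿ n) (sym (ℕ.+-identityʳ b)) h)
  ... | suc a , b | h = subst (_≤ⁿ suc n) (sym (ℕ.+-suc a b)) (ℕ.m≤n⇒m≤1+n h)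

  nth : {A : Set} → A → List A → ℕ → A
  nth d []       n       = d
  nth d (x ∷ xs) zero    = x
  nth d (x ∷ xs) (suc n) = nth d xs n

  nth-∈ : ∀ {A : Set} {d x : A} {xs} → x ∈ˡ xs → ∃[ n ] nth d xs n ≡ x
  nth-∈ (here refl) = 0 , refl
  nth-∈ (there p)   = let n , e = nth-∈ p in suc n , e

  module _ {A : Set} (finite : Finite A) (F : Subset A) (ρ : A) (ρ∈ : ρ ∈ F) where

    -- Only the first component of `unpair n` matters; the second one runs freely and makes each
    -- value recur beyond any bound. Elements outside `F` are replaced by `ρ`.
    enumerate : ℕ → A
    enumerate n = let a = nth ρ (elements finite) (proj₁ (unpair n)) in if F a then a else ρ

    private
      if-∈ : ∀ a → (if F a then a else ρ) ∈ F
      if-∈ a with F a in eq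
      ... | true  = subst T (sym eq) _
      ... | false = ρ∈

      if-∈-≡ : ∀ a → a ∈ F → (if F a then a else ρ) ≡ a
      if-∈-≡ a a∈ with F a
      ... | true = refl

    enumerate-∈ : ∀ n → enumerate n ∈ F
    enumerate-∈ n = if-∈ (nth ρ (elements finite) (proj₁ (unpair n)))

    enumerate-hits : ∀ a → a ∈ F → ∀ m → ∃[ j ] enumerate (j + m) ≡ a
    enumerate-hits a a∈ m =
      let i , ei = nth-∈ (complete finite a)
          n , en = unpair-surjective i m
          m≤n = ℕ.≤-trans (ℕ.m≤n+m m i) (subst (λ p → proj₁ p + proj₂ p ≤ⁿ n) en (unpair-bound n))
          e = trans (cong (λ p → nth ρ (elements finite) (proj₁ p)) en) ei
      in n ∸ m , trans (cong enumerate (ℕ.m∸n+n≡m m≤n)) (trans (cong (λ x → if F x then x else ρ) e) (if-∈-≡ a a∈))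

-- Arrangements whose pieces are all single points, and the general case.

module Splitting (em : ExcludedMiddle 0ℓ) (ext : Extensionality 0ℓ 0ℓ) (O : SeparableOrder) where
  open Classical em ext
  open Types em ext
  open Orders em ext
  open Order O
  open Shapes em ext O
  open Arrangements em ext O
  open Pairing

  -- A listed point is avoided by retreating to the side of an inner point `w` that does not contain
  -- it.
  fresh : ∀ {C} {E : Subset C} {B c} → Dense E B c → ∀ l u v → u ∈ B → v ∈ B → u < v → ∀ e → e ∈ E →
          ∃[ x ] (x ∈ B × u < x × x < v × c x ≡ e × ¬ x ∈ˡ l)
  fresh D [] u v u∈ v∈ l e e∈ = let x , x∈ , l₁ , l₂ , ce = Dense.between D u v u∈ v∈ l e e∈
                                in x , x∈ , l₁ , l₂ , ce , λ ()
  fresh D (y ∷ ys) u v u∈ v∈ l e e∈ with Dense.inside D u∈ v∈ l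
  ... | w , w∈ , u<w , w<v with <⊎≽ w y
  ...   | inj₁ w<y = let x , x∈ , l₁ , l₂ , ce , x∉ = fresh D ys u w u∈ w∈ u<w e e∈
                     in x , x∈ , l₁ , <-trans l₂ w<v , ce ,
                        λ { (here refl) → asym l₂ w<y ; (there p) → x∉ p }
  ...   | inj₂ y≼w = let x , x∈ , l₁ , l₂ , ce , x∉ = fresh D ys w v w∈ v∈ w<v e e∈
                     in x , x∈ , <-trans u<w l₁ , l₂ , ce ,
                        λ { (here refl) → y≼w l₁ ; (there p) → x∉ p }

  Single : {C : Set} → C → Shape C
  Single e = just e , just e , false

  module _ {C Kd : Set} {E : Subset C} (sh : Kd → Shape C) (F : Subset Kd)
    (single : ∀ k → k ∈ F → ∃[ e ] (e ∈ E × sh k ≡ Single e))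
    (onto : ∀ e → e ∈ E → ∃[ k ] (k ∈ F × sh k ≡ Single e))
    (κ : ℕ → Kd) (κ∈ : ∀ n → κ n ∈ F) (hits : ∀ k → k ∈ F → ∀ m → ∃[ j ] κ (j + m) ≡ k)
    {B : Subset X} {c : X → C} (U : Uniform E B c) where
    open Uniform U
    private
      -- Request (a , b , d) asks for a point of kind κ d between the marks a and b; the n-th
      -- request is met by a point not used before.
      Request : ℕ × ℕ × ℕ → X → Set
      Request (a , b , d) x = x ∈ B × ¬ mark a x × mark b x × sh (κ d) ≡ Single (c x)

      decode : ℕ → ℕ × ℕ × ℕ
      decode n = let a , m = unpair n in a , unpair m

      decode-surjective : ∀ a b d → ∃[ n ] decode n ≡ (a , b , d)
      decode-surjective a b d =
        let m , em′ = unpair-surjective b d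
            n , en = unpair-surjective a m
        in n , cong₂ (λ p q → p , q) (cong proj₁ en) (trans (cong (λ p → unpair (proj₂ p)) en) em′)

      abstract
        pick : Σ (ℕ × List X → X) λ g → ∀ p → (∃[ x ] (Request (decode (proj₁ p)) x × ¬ x ∈ˡ proj₂ p)) →
               Request (decode (proj₁ p)) (g p) × ¬ g p ∈ˡ proj₂ p
        pick = choice {R = λ p x → Request (decode (proj₁ p)) x × ¬ x ∈ˡ proj₂ p} (proj₁ inhabited) (λ p h → h)

      history : ℕ → List X
      history zero    = []
      history (suc n) = proj₁ pick (n , history n) ∷ history n

      chosen : ℕ → X
      chosen n = proj₁ pick (n , history n)

      earlier : ∀ {n m} → n <ⁿ m → chosen n ∈ˡ history m
      earlier {n} n<m = go (ℕ.≤⇒≤′ n<m)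
        where
        go : ∀ {m} → suc n ≤′ m → chosen n ∈ˡ history m
        go ≤′-refl     = here refl
        go (≤′-step h) = there (go h)

      Added : ℕ → X → Set
      Added n x = x ≡ chosen n × Request (decode n) x × ¬ x ∈ˡ history n

      added-unique : ∀ {n m x} → Added n x → Added m x → n ≡ m
      added-unique {n} {m} (e , _ , x∉) (e′ , _ , x∉′) with ℕ.<-cmp n m
      ... | tri< l _ _ = ⊥-elim (x∉′ (subst (_∈ˡ history m) (sym e) (earlier l)))
      ... | tri≈ _ p _ = p
      ... | tri> _ _ g = ⊥-elim (x∉ (subst (_∈ˡ history n) (sym e′) (earlier g)))

      wanted : ℕ → Kd
      wanted n = κ (proj₂ (proj₂ (decode n)))

      Assigned : X → Kd → Set
      Assigned x k = k ∈ F × sh k ≡ Single (c x) × (∀ n → Added n x → k ≡ wanted n)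

      -- A point chosen for a request gets the kind requested; by `added-unique` no two requests
      -- compete for it. Any other point takes some kind of its own colour.
      assign : ∀ x → x ∈ B → ∃[ k ] Assigned x k
      assign x x∈ with em {∃[ n ] Added n x}
      ... | yes (n , added) = wanted n , κ∈ _ , proj₂ (proj₂ (proj₂ (proj₁ (proj₂ added)))) ,
                              λ m added′ → cong wanted (added-unique added added′)
      ... | no none = let k , k∈ , e = onto (c x) (colour x x∈)
                      in k , k∈ , e , λ n added → ⊥-elim (none (n , added))

      abstract
        kinds : Σ (X → Kd) λ kd → ∀ x → x ∈ B → Assigned x (kd x)
        kinds = choice {R = Assigned} (κ 0) assign

      -- The marks `a`, separating `i` from `u`, and `b`, separating `v` from `j`, turn the interval
      -- into a request. A fresh point between `u` and `v` shows that it could be met when its turn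
      -- came, and whatever point met it lies between `i` and `j`.
      dense-kinds : ∀ i j → i ∈ B → j ∈ B → i < j → ∀ k → k ∈ F → ∃[ z ] (z ∈ B × i < z × z < j × proj₁ kinds z ≡ k)
      dense-kinds i j i∈ j∈ i<j k k∈ =
        let e , e∈ , sh≡ = single k k∈
            u , u∈ , i<u , u<j = inside i∈ j∈ i<j
            v , v∈ , u<v , v<j = inside u∈ j∈ u<j
            a , i∈a , u∉a = sep i<u
            b , v∈b , j∉b = sep v<j
            d , κd = hits k k∈ 0
            n , dec = decode-surjective a b (d + 0)
            x , x∈ , u<x , x<v , cx , x∉ = fresh dense (history n) u v u∈ v∈ u<v e e∈
            req : Request (decode n) x
            req = subst (λ p → Request p x) (sym dec)
                    (x∈ , (λ x∈a → u∉a (down a u<x x∈a)) , down b x<v v∈b ,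
                     trans (cong sh κd) (trans sh≡ (cong Single (sym cx))))
            good , z∉ = proj₂ pick (n , history n) (x , req , x∉)
            z = chosen n
            z∈ , z∉a , z∈b , _ = subst (λ p → Request p z) dec good
        in z , z∈ , by-contradiction (λ g → z∉a (mark-≼ a g i∈a)) , by-contradiction (λ g → j∉b (mark-≼ b g z∈b)) ,
           trans (proj₂ (proj₂ (proj₂ kinds z z∈)) n (refl , good , z∉))
                 (trans (cong (λ p → κ (proj₂ (proj₂ p))) dec) κd)

      point-fibre : ∀ i → i ∈ B → shape (fibre B (λ x → x) i) c ≡ Single (c i)
      point-fibre i i∈ = single-shape (⌊⌋⁺ (i∈ , refl)) (λ x x∈ → proj₂ (⌊⌋⁻ x∈))

    abstract
      split-arrangement : Arrangement sh F B c
      split-arrangement = record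
        { f = λ x → x ; R = B ; kind = proj₁ kinds ; R⊆B = λ _ x∈ → x∈ ; fixed = λ _ _ → refl
        ; sum = record { into = λ _ x∈ → x∈ ; mono = λ _ _ _ _ l → inj₁ l ; back = λ _ _ _ _ l → l }
        ; shapes = λ i i∈ → trans (point-fibre i i∈) (sym (proj₁ (proj₂ (proj₂ kinds i i∈))))
        ; uniform = record
          { dense = record { colour = λ i i∈ → proj₁ (proj₂ kinds i i∈) ; between = dense-kinds }
          ; inhabited = inhabited ; noLeast = noLeast ; noGreatest = noGreatest } }

  module _ {C Kd : Set} (finite : Finite Kd) {E : Subset C} (sh : Kd → Shape C) (F : Subset Kd)
    (legit : ∀ k → k ∈ F → Legit E (sh k))
    {B : Subset X} {c : X → C} (U : Uniform E B c) (small : Small B) where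

    abstract
      -- The scheme needs a kind with several points to fill the stretches between slots. If there
      -- is none, each point becomes a piece of its own, and it remains to distribute the points of
      -- each colour over the kinds of that colour; `onto` says that there is one.
      arrangement : (∀ e → e ∈ E → (∀ k → k ∈ F → proj₂ (proj₂ (sh k)) ≡ false) → ∃[ k ] (k ∈ F × sh k ≡ Single e)) →
                    ∃ (_∈ F) → Arrangement sh F B c
      arrangement onto (ρ₀ , ρ₀∈) with em {∃[ ρ ] (ρ ∈ F × proj₂ (proj₂ (sh ρ)) ≡ true)}
      ... | yes (ρ , ρ∈ , several) =
            Scheme.arrange sh F legit ρ ρ∈ several (enumerate finite F ρ ρ∈) (enumerate-∈ finite F ρ ρ∈)
              (enumerate-hits finite F ρ ρ∈) U small
      ... | no none = split-arrangement sh F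
            (λ k k∈ → let e , e∈ , p , q = proj₂ (proj₂ (legit k k∈)) (not-several k k∈)
                      in e , e∈ , cong₂ _,_ p (cong₂ _,_ q (not-several k k∈)))
            (λ e e∈ → onto e e∈ not-several)
            (enumerate finite F ρ₀ ρ₀∈) (enumerate-∈ finite F ρ₀ ρ₀∈) (enumerate-hits finite F ρ₀ ρ₀∈) U
        where
        not-several : ∀ k → k ∈ F → proj₂ (proj₂ (sh k)) ≡ false
        not-several k k∈ with proj₂ (proj₂ (sh k)) in eq
        ... | false = refl
        ... | true  = ⊥-elim (none (k , k∈ , eq))

-- Matching decompositions of sets of the same shape.

module Matching (em : ExcludedMiddle 0ℓ) (ext : Extensionality 0ℓ 0ℓ) (O : SeparableOrder) where
  open Classical em ext
  open Types em ext
  open Orders em ext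
  open Order O
  open Shapes em ext O
  open Sequences em ext O

  module _ {C : Set} {c : X → C} {A Λ : Subset X} (I : Initial Λ A) where
    open Initial I

    sum-shape : ∀ {x y} → x ∈ Λ → y ∈ (A ∖ Λ) → shape A c ≡ (minColour Λ c , maxColour (A ∖ Λ) c , true)
    sum-shape {x} {y} x∈ y∈ = cong₂ _,_
      (min-initial x x∈ ⊆-whole λ a a∈ x≮a → low a a∈ x≮a)
      (cong₂ _,_
        (max-final y y∈ (λ a a∈ → proj₁ (⌊⌋⁻ a∈))
          (λ a a∈ a≮y → ⌊⌋⁺ (a∈ , λ a∈Λ → a≮y (separates a∈Λ (proj₁ (⌊⌋⁻ y∈)) (proj₂ (⌊⌋⁻ y∈))))))
        (several⁺ (⊆-whole x x∈) (proj₁ (⌊⌋⁻ y∈)) (separates x∈ (proj₁ (⌊⌋⁻ y∈)) (proj₂ (⌊⌋⁻ y∈)))))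
      where
      low : ∀ a → a ∈ A → a ≼ x → a ∈ Λ
      low a a∈ h with ≼⇒<⊎≡ h
      ... | inj₁ l    = closed a x a∈ x∈ l
      ... | inj₂ refl = x∈

  module _ {C : Set} {E : Subset C} {c : X → C} {A Λ : Subset X} (I : Initial Λ A) (D : Dense E A c) where
    open Initial I

    -- Density yields a point strictly between the two ends, and it would have to lie on one side of
    -- the cut.
    no-jump : ∀ {e e′} → maxColour Λ c ≡ just e → ¬ minColour (A ∖ Λ) c ≡ just e′
    no-jump p p′ with max-just⁻ p | min-just⁻ p′
    ... | a , (a∈ , a≥) , _ | b , (b∈ , b≤) , _
      with Dense.inside D (⊆-whole a a∈) (proj₁ (⌊⌋⁻ b∈)) (separates a∈ (proj₁ (⌊⌋⁻ b∈)) (proj₂ (⌊⌋⁻ b∈)))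
    ...   | z , z∈ , a<z , z<b with em {z ∈ Λ}
    ...     | yes z∈Λ = a≥ z z∈Λ a<z
    ...     | no z∉Λ  = b≤ z (⌊⌋⁺ (z∈ , z∉Λ)) z<b

  record Match {C : Set} (c : X → C) (A Λ : Subset X) (d : X → C) (B : Subset X) : Set where
    field
      Λ′       : Subset X
      initial′ : Initial Λ′ B
      inΛ′     : ∃ (_∈ Λ′)
      outΛ′    : ∃ (_∈ (B ∖ Λ′))
      shapeΛ   : shape Λ c ≡ shape Λ′ d
      shape∖   : shape (A ∖ Λ) c ≡ shape (B ∖ Λ′) d

  module _ {C : Set} {E : Subset C} {c : X → C} {A Λ : Subset X} (I : Initial Λ A) (DA : Dense E A c)
           (Λ≢∅ : ∃ (_∈ Λ)) (rest≢∅ : ∃ (_∈ (A ∖ Λ)))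
           {d : X → C} {B : Subset X} (DB : Dense E B d) (small : Small B) (same : shape A c ≡ shape B d) where
    private
      sumA = sum-shape {c = c} I (proj₂ Λ≢∅) (proj₂ rest≢∅)

      minB : minColour B d ≡ minColour Λ c
      minB = cong proj₁ (trans (sym same) sumA)

      maxB : maxColour B d ≡ maxColour (A ∖ Λ) c
      maxB = cong (λ s → proj₁ (proj₂ s)) (trans (sym same) sumA)

      severalB : Several B
      severalB = ⌊⌋⁻ (≡⇒T (cong (λ s → proj₂ (proj₂ s)) (trans (sym same) sumA)))

      DΛ : Dense E Λ c
      DΛ = record { colour = λ x x∈ → Dense.colour DA x (Initial.⊆-whole I x x∈)
                  ; between = λ x y x∈ y∈ l e e∈ →
                      let z , z∈ , l₁ , l₂ , ce = Dense.between DA x y (Initial.⊆-whole I x x∈) (Initial.⊆-whole I y y∈) l e e∈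
                      in z , Initial.closed I z y z∈ y∈ l₂ , l₁ , l₂ , ce }

      D∖ : Dense E (A ∖ Λ) c
      D∖ = record { colour = λ x x∈ → Dense.colour DA x (proj₁ (⌊⌋⁻ x∈))
                  ; between = λ x y x∈ y∈ l e e∈ →
                      let x∈A , x∉ = ⌊⌋⁻ x∈
                          z , z∈ , l₁ , l₂ , ce = Dense.between DA x y x∈A (proj₁ (⌊⌋⁻ y∈)) l e e∈
                      in z , ⌊⌋⁺ (z∈ , λ z∈Λ → x∉ (Initial.closed I x z x∈A z∈Λ l₁)) , l₁ , l₂ , ce }

      nothing-if : ∀ {m : Maybe C} → (∀ e → ¬ m ≡ just e) → m ≡ nothing
      nothing-if {just e}  h = ⊥-elim (h e refl)
      nothing-if {nothing} h = refl

      not-false : ∀ {b} → ¬ b ≡ false → b ≡ true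
      not-false {true}  h = refl
      not-false {false} h = ⊥-elim (h refl)

      by-division : ∀ {x₁ y₁} → x₁ ∈ B → y₁ ∈ B → x₁ < y₁ → Division B x₁ y₁ d (maxColour Λ c) (minColour (A ∖ Λ) c)
      by-division x₁∈ y₁∈ l = go (maxColour Λ c) (minColour (A ∖ Λ) c) refl refl
        where
        go : ∀ m m′ → maxColour Λ c ≡ m → minColour (A ∖ Λ) c ≡ m′ → Division B _ _ d m m′
        go m nothing p p′ = divide-after DB small x₁∈ y₁∈ l m
          (λ e e≡ → proj₁ (proj₂ (shape-legit DΛ (proj₂ Λ≢∅))) e (trans p e≡))
        go nothing (just e′) p p′ = divide-before DB small x₁∈ y₁∈ l (just e′)
          (λ e e≡ → proj₁ (shape-legit D∖ (proj₂ rest≢∅)) e (trans p′ e≡))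
        go (just e) (just e′) p p′ = ⊥-elim (no-jump I DA p p′)

      both-at : ∀ {x x₁ y₁ y} → x ∈ B → x₁ ∈ B → y₁ ∈ B → y ∈ B → x < x₁ → y₁ < y →
        Division B x₁ y₁ d (maxColour Λ c) (minColour (A ∖ Λ) c) →
        ⌊ Several Λ ⌋ ≡ true → ⌊ Several (A ∖ Λ) ⌋ ≡ true → Match c A Λ d B
      both-at {x} {x₁} {y₁} {y} x∈ x₁∈ y₁∈ y∈ x<x₁ y₁<y M b₁ b₂ = record
          { Λ′ = M.Λ ; initial′ = M.initial ; inΛ′ = x , x∈Λ″ ; outΛ′ = y , y∈∖
          ; shapeΛ = cong₂ _,_ (trans (sym minB) (cong proj₁ sumB))
                       (cong₂ _,_ (sym M.maxΛ) (trans b₁ (sym (several⁺ x∈Λ″ M.x∈Λ x<x₁))))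
          ; shape∖ = cong₂ _,_ (sym M.minΛ)
                       (cong₂ _,_ (trans (sym maxB) (cong (λ s → proj₁ (proj₂ s)) sumB)) (trans b₂ (sym (several⁺ y₁∈∖ y∈∖ y₁<y)))) }
        where
        module M = Division M
        x∈Λ″ = M.closed x x₁ x∈ M.x∈Λ x<x₁
        y∈∖ = ∖⁺ B M.Λ y∈ (λ y∈Λ″ → M.y∉Λ (M.closed y₁ y y₁∈ y∈Λ″ y₁<y))
        y₁∈∖ = ∖⁺ B M.Λ y₁∈ M.y∉Λ
        sumB = sum-shape {c = d} M.initial x∈Λ″ y∈∖

      both : ⌊ Several Λ ⌋ ≡ true → ⌊ Several (A ∖ Λ) ⌋ ≡ true → Match c A Λ d B
      both =
        let x , y , x∈ , y∈ , x<y = severalB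
            x₁ , x₁∈ , x<x₁ , x₁<y = Dense.inside DB x∈ y∈ x<y
            y₁ , y₁∈ , x₁<y₁ , y₁<y = Dense.inside DB x₁∈ y∈ x₁<y
        in both-at x∈ x₁∈ y₁∈ y∈ x<x₁ y₁<y (by-division x₁∈ y₁∈ x₁<y₁)

      first-single : ⌊ Several Λ ⌋ ≡ false → Match c A Λ d B
      first-single b₁ =
        let a , a∈ = Λ≢∅
            sΛ = single-shape {c = c} a∈ (λ u u∈ → single⁻ b₁ u a u∈ a∈)
            min≡ = nothing-if (λ e → no-jump I DA (cong (λ s → proj₁ (proj₂ s)) sΛ))
            b , (b∈ , b≤) , db = min-just⁻ (trans minB (cong proj₁ sΛ))
            x , y , x∈ , y∈ , x<y = severalB
            b<y = ≼-<-trans (b≤ x x∈) x<y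
            Λ″ = ⟪ (λ u → u ∈ B × u ≼ b) ⟫
            init : Initial Λ″ B
            init = record { ⊆-whole = λ u u∈ → proj₁ (⌊⌋⁻ u∈)
                          ; closed = λ u v u∈ v∈ u<v → ⌊⌋⁺ (u∈ , <⇒≼ (<-≼-trans u<v (proj₂ (⌊⌋⁻ v∈)))) }
            b∈Λ : b ∈ Λ″
            b∈Λ = ⌊⌋⁺ (b∈ , irr)
            above : ∀ u → u ∈ B → b < u → u ∈ (B ∖ Λ″)
            above u u∈ l = ∖⁺ B Λ″ u∈ (λ u∈Λ → proj₂ (⌊⌋⁻ u∈Λ) l)
            down∖ : NoLeast (B ∖ Λ″)
            down∖ u u∈ = let u∈B , u∉ = ⌊⌋⁻ u∈
                             b<u = by-contradiction λ g → u∉ (⌊⌋⁺ (u∈B , g))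
                             w , w∈ , l₁ , l₂ = Dense.inside DB b∈ u∈B b<u
                         in w , above w w∈ l₁ , l₂
            y∈∖ = above y y∈ b<y
            w , w∈ , w<y = down∖ y y∈∖
            sumB = sum-shape {c = d} init b∈Λ y∈∖
        in record
          { Λ′ = Λ″ ; initial′ = init ; inΛ′ = b , b∈Λ ; outΛ′ = y , y∈∖
          ; shapeΛ = trans sΛ (sym (trans
              (single-shape {c = d} b∈Λ (λ u u∈ → let u∈B , h = ⌊⌋⁻ u∈ in ≼-antisym h (b≤ u u∈B)))
              (cong (λ e → just e , just e , false) db)))
          ; shape∖ = cong₂ _,_ (trans min≡ (sym (min-nothing⁺ down∖)))
              (cong₂ _,_ (trans (sym maxB) (cong (λ s → proj₁ (proj₂ s)) sumB))
                 (trans (not-false (λ b₂ → let r , r∈ = rest≢∅ in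
                    no-jump I DA (cong (λ s → proj₁ (proj₂ s)) sΛ)
                      (cong proj₁ (single-shape {c = c} r∈ (λ u u∈ → single⁻ b₂ u r u∈ r∈)))))
                    (sym (several⁺ w∈ y∈∖ w<y)))) }

      last-single : ⌊ Several (A ∖ Λ) ⌋ ≡ false → Match c A Λ d B
      last-single b₂ =
        let a , a∈ = rest≢∅
            s∖ = single-shape {c = c} a∈ (λ u u∈ → single⁻ b₂ u a u∈ a∈)
            max≡ = nothing-if (λ e p → no-jump I DA p (cong proj₁ s∖))
            b , (b∈ , b≥) , db = max-just⁻ (trans maxB (cong (λ s → proj₁ (proj₂ s)) s∖))
            x , y , x∈ , y∈ , x<y = severalB
            x<b = <-≼-trans x<y (b≥ y y∈)
            Λ″ = ⟪ (λ u → u ∈ B × u < b) ⟫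
            init : Initial Λ″ B
            init = record { ⊆-whole = λ u u∈ → proj₁ (⌊⌋⁻ u∈)
                          ; closed = λ u v u∈ v∈ u<v → ⌊⌋⁺ (u∈ , <-trans u<v (proj₂ (⌊⌋⁻ v∈))) }
            b∈∖ : b ∈ (B ∖ Λ″)
            b∈∖ = ∖⁺ B Λ″ b∈ (λ b∈Λ → irr (proj₂ (⌊⌋⁻ b∈Λ)))
            upΛ : NoGreatest Λ″
            upΛ u u∈ = let u∈B , u<b = ⌊⌋⁻ u∈
                           w , w∈ , l₁ , l₂ = Dense.inside DB u∈B b∈ u<b
                       in w , ⌊⌋⁺ (w∈ , l₂) , l₁
            x∈Λ : x ∈ Λ″
            x∈Λ = ⌊⌋⁺ (x∈ , x<b)
            w , w∈ , x<w = upΛ x x∈Λ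
            sumB = sum-shape {c = d} init x∈Λ b∈∖
        in record
          { Λ′ = Λ″ ; initial′ = init ; inΛ′ = x , x∈Λ ; outΛ′ = b , b∈∖
          ; shape∖ = trans s∖ (sym (trans
              (single-shape {c = d} b∈∖ (λ u u∈ → let u∈B , u∉ = ⌊⌋⁻ u∈ in
                 ≼-antisym (b≥ u u∈B) (λ u<b → u∉ (⌊⌋⁺ (u∈B , u<b)))))
              (cong (λ e → just e , just e , false) db)))
          ; shapeΛ = cong₂ _,_ (trans (sym minB) (cong proj₁ sumB))
              (cong₂ _,_ (trans max≡ (sym (max-nothing⁺ upΛ)))
                 (trans (not-false (λ b₁ → let r , r∈ = Λ≢∅ in
                    no-jump I DA (cong (λ s → proj₁ (proj₂ s)) (single-shape {c = c} r∈ (λ u u∈ → single⁻ b₁ u r u∈ r∈)))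
                      (cong proj₁ s∖)))
                    (sym (several⁺ x∈Λ w∈ x<w)))) }

    abstract
      -- If both sides have several points, `B` is divided strictly inside, with the prescribed
      -- colours at the cut. A side with one point must be matched by an end point of `B`, which
      -- exists with the right colour as the shapes agree; by `no-jump` the other side then has no
      -- end at the cut and several points.
      match : Match c A Λ d B
      match with ⌊ Several Λ ⌋ in b₁ | ⌊ Several (A ∖ Λ) ⌋ in b₂
      ... | false | _     = first-single b₁
      ... | true  | false = last-single b₂
      ... | true  | true  = both b₁ b₂

  -- Every piece ends with a point of colour `e`, so the shapes of the pieces depend only on the
  -- beginning of `A`. Two sets without last points that begin alike are thus decomposed into pieces
  -- of the same shapes.
  record OmegaIndex {C : Set} (A : Subset X) (c : X → C) (e : C) : Set where
    field
      index      : X → ℕ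
      index-mono : ∀ x y → x ∈ A → y ∈ A → x < y → index x ≤ⁿ index y
      bounded    : ∀ n → ∃[ b ] (b ∈ A × (∀ x → x ∈ fibre A index n → x ≼ b))
      nonempty   : ∀ n → ∃ (_∈ fibre A index n)
      shape₀     : shape (fibre A index 0) c ≡ (minColour A c , just e , true)
      shape₊     : ∀ n → shape (fibre A index (suc n)) c ≡ (nothing , just e , true)

  module _ {C : Set} {E : Subset C} {A : Subset X} {c : X → C} (D : Dense E A c) (top : NoGreatest A)
           {a : X} (a∈ : a ∈ A) {e : C} (e∈ : e ∈ E) where
    open CofinalSequence (cofinalSequence D top a∈ e∈)
    open Dense D
    private
      First : X → ℕ → Set
      First x n = x ≼ v n × (∀ m → x ≼ v m → n ≤ⁿ m)

      abstract
        indices : Σ (X → ℕ) λ i → ∀ x → x ∈ A → First x (i x)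
        indices = choice {R = First} 0 λ x x∈ → let n , l = cofinal x x∈ in least (λ n → x ≼ v n) (n , asym l)

      ix : X → ℕ
      ix = proj₁ indices

      below-v : ∀ x → x ∈ A → x ≼ v (ix x)
      below-v x x∈ = proj₁ (proj₂ indices x x∈)

      ix-≤ : ∀ x n → x ∈ A → x ≼ v n → ix x ≤ⁿ n
      ix-≤ x n x∈ = proj₂ (proj₂ indices x x∈) n

      ix-> : ∀ x n → x ∈ A → v n < x → n <ⁿ ix x
      ix-> x n x∈ l = ℕ.≰⇒> λ h → ≼-trans (below-v x x∈) (seq-mono v v-< (ix x) n h) l

      in-fibre : ∀ x n → x ∈ A → v n < x → x ≼ v (suc n) → x ∈ fibre A ix (suc n)
      in-fibre x n x∈ l h = ⌊⌋⁺ (x∈ , ℕ.≤-antisym (ix-≤ x (suc n) x∈ h) (ix-> x n x∈ l))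

      in-fibre₀ : ∀ x → x ∈ A → x ≼ v 0 → x ∈ fibre A ix 0
      in-fibre₀ x x∈ h = ⌊⌋⁺ (x∈ , ℕ.n≤0⇒n≡0 (ix-≤ x 0 x∈ h))

      fibre-bound : ∀ n x → x ∈ fibre A ix n → x ≼ v n
      fibre-bound n x x∈ = let x∈A , e = ⌊⌋⁻ x∈ in subst (λ i → x ≼ v i) e (below-v x x∈A)

      v-fibre : ∀ n → v n ∈ fibre A ix n
      v-fibre zero    = in-fibre₀ (v 0) (v∈ 0) irr
      v-fibre (suc n) = in-fibre (v (suc n)) n (v∈ (suc n)) (v-< n) irr

      max-fibre : ∀ n → maxColour (fibre A ix n) c ≡ just e
      max-fibre n = trans (max-just⁺ (v-fibre n , fibre-bound n)) (cong just (colour≡ n))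

    abstract
      omega-index : OmegaIndex A c e
      omega-index = record
        { index = ix
        ; index-mono = λ x y x∈ y∈ l → ix-≤ x (ix y) x∈ (≼-trans (asym l) (below-v y y∈))
        ; bounded = λ n → v n , v∈ n , fibre-bound n
        ; nonempty = λ n → v n , v-fibre n
        ; shape₀ = cong₂ _,_
            (sym (min-initial a (in-fibre₀ a a∈ (asym a<v)) (λ x x∈ → proj₁ (⌊⌋⁻ x∈))
                   (λ x x∈ h → in-fibre₀ x x∈ (≼-trans h (asym a<v)))))
            (cong₂ _,_ (max-fibre 0) (several⁺ (in-fibre₀ a a∈ (asym a<v)) (v-fibre 0) a<v))
        ; shape₊ = λ n →
            let z , z∈ , l₁ , l₂ = inside (v∈ n) (v∈ (suc n)) (v-< n)
            in cong₂ _,_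
              (min-nothing⁺ λ x x∈ →
                let x∈A , ex = ⌊⌋⁻ x∈
                    vn<x = by-contradiction λ h → ℕ.<-irrefl refl (subst (_≤ⁿ n) ex (ix-≤ x n x∈A h))
                    w , w∈ , m₁ , m₂ = inside (v∈ n) x∈A vn<x
                in w , in-fibre w n w∈ m₁ (≼-trans (asym m₂) (fibre-bound (suc n) x x∈)) , m₂)
              (cong₂ _,_ (max-fibre (suc n)) (several⁺ (in-fibre z n z∈ l₁ (asym l₂)) (v-fibre (suc n)) l₂)) }

-- Shapes in the reversed order.

module Mirror (em : ExcludedMiddle 0ℓ) (ext : Extensionality 0ℓ 0ℓ) (O : SeparableOrder) where
  open Classical em ext
  open Orders em ext
  open Order O
  open Shapes em ext O
  module Sᵒ = Shapes em ext (O ᵒ)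
  module Oᵒ = Order (O ᵒ)

  abstract
    max-flip : ∀ {C} (A : Subset X) (c : X → C) → Oᵒ.maxColour A c ≡ minColour A c
    max-flip A c with minColour A c in eq
    ... | just e  = let a , least , ca = min-just⁻ eq in trans (Oᵒ.max-just⁺ {a = a} least) (cong just ca)
    ... | nothing = Oᵒ.max-nothing⁺ (min-nothing⁻ eq)

    min-flip : ∀ {C} (A : Subset X) (c : X → C) → Oᵒ.minColour A c ≡ maxColour A c
    min-flip A c = refl

    several-flip : ∀ (A : Subset X) → ⌊ Sᵒ.Several A ⌋ ≡ ⌊ Several A ⌋
    several-flip A = ⌊⌋-cong (λ (x , y , x∈ , y∈ , l) → y , x , y∈ , x∈ , l) (λ (x , y , x∈ , y∈ , l) → y , x , y∈ , x∈ , l)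

    shape-flip : ∀ {C} (A : Subset X) (c : X → C) {f l b} → Sᵒ.shape A c ≡ (f , l , b) → shape A c ≡ (l , f , b)
    shape-flip A c e = cong₂ _,_ (trans (sym (max-flip A c)) (cong (λ s → proj₁ (proj₂ s)) e))
      (cong₂ _,_ (trans (sym (min-flip A c)) (cong proj₁ e)) (trans (sym (several-flip A)) (cong (λ s → proj₂ (proj₂ s)) e)))

-- The induction on moves: condensing a coloured order to one class.

module Games (em : ExcludedMiddle 0ℓ) (ext : Extensionality 0ℓ 0ℓ) (O : SeparableOrder) where
  open Classical em ext
  open Types em ext
  open Orders em ext
  open Order O
  open Shapes em ext O
  open Arrangements em ext O
  open Splitting em ext O
  open Sequences em ext O
  open Matching em ext O
  open Chains em ext O using (dense-flip)

  IndexClaim : List FiniteSet → Set₁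
  IndexClaim ks = ∀ {K : Set} → Finite K → (F : Subset K) (R : Subset X) (k : X → K) (R′ : Subset X) (k′ : X → K) →
    Uniform F R k → Uniform F R′ k′ → Small R → Small R′ → tp _<_ ks R k ≡ tp _<_ ks R′ k′

  module Game (ks : List FiniteSet) {C D : Set} (finC : Finite C) (finD : Finite D)
    (IH : IndexClaim (idx ks ((C × D) , finite-× finC finD)))
    {E : Subset C} {B : Subset X} {c : X → C} (U : Uniform E B c) (small : Small B) (q : X → D) where
    open Uniform U using (dense)

    type : Subset X → Ty ks (C × D)
    type A = tp _<_ ks A (c & q)

    Transferable : Subset X → Set
    Transferable A = ∀ B′ (c′ : X → C) → Small B′ → Dense E B′ c′ → ∃ (_∈ B′) → shape A c ≡ shape B′ c′ →
                     ∃[ r ] tp _<_ ks B′ (c′ & r) ≡ type A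

    record Part (A : Subset X) : Set where
      field
        ⊆B       : ∀ x → x ∈ A → x ∈ B
        convex   : Convex A B
        nonempty : ∃ (_∈ A)

      dense-part : Dense E A c
      dense-part = dense-convex dense ⊆B convex

    transferable-single : ∀ {A a} → a ∈ A → (∀ x → x ∈ A → x ≡ a) → Transferable A
    transferable-single {A} {a} a∈ only B′ c′ _ _ (b , b∈) same =
      (λ _ → q a) , tp-single (λ _ → irr) (λ _ → irr) ks b a b∈ only′ a∈ only (cong (_, q a) (sym ca≡))
      where
      s : shape B′ c′ ≡ (just (c a) , just (c a) , false)
      s = trans (sym same) (single-shape a∈ only)
      only′ : ∀ y → y ∈ B′ → y ≡ b
      only′ y y∈ = single⁻ (cong (λ t → proj₂ (proj₂ t)) s) y b y∈ b∈
      ca≡ : c a ≡ c′ b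
      ca≡ = let b′ , (b′∈ , _) , e = min-just⁻ (cong proj₁ s) in trans (sym e) (cong c′ (only′ b′ b′∈))

    module _ {J : Set} {_≺_ : Rel J 0ℓ} {A B′ : Subset X} {c′ : X → C} {f g : X → J}
             (S : Sum _<_ _≺_ A f (λ _ → true)) (S′ : Sum _<_ _≺_ B′ g (λ _ → true)) where

      glue-pieces : (∀ j → ∃[ r ] tp _<_ ks (fibre B′ g j) (c′ & r) ≡ type (fibre A f j)) →
                    ∃[ r ] tp _<_ ks B′ (c′ & r) ≡ type A
      glue-pieces = glue ks (finite-× finC finD) (point finD) S S′

    ∖-⊆ : ∀ (A Λ : Subset X) x → x ∈ (A ∖ Λ) → x ∈ A
    ∖-⊆ A Λ x x∈ = proj₁ (⌊⌋⁻ x∈)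

    fibre-⊆ : ∀ {J : Set} (A : Subset X) (f : X → J) j x → x ∈ fibre A f j → x ∈ A
    fibre-⊆ A f j x x∈ = proj₁ (⌊⌋⁻ x∈)

    fibre-convex : ∀ {J} {_≺_ : Rel J 0ℓ} {A f I} → Sum _<_ _≺_ A f I → ∀ j → Convex (fibre A f j) A
    fibre-convex {_≺_ = _≺_} {f = f} S j x y z x∈ z∈ y∈ l l′ with ⌊⌋⁻ x∈ | ⌊⌋⁻ z∈
    ... | x∈A , refl | z∈A , e with Sum.mono S y z y∈ z∈A l′
    ...   | inj₁ m = ⊥-elim (asym l (Sum.back S y x y∈ x∈A (subst (f y ≺_) e m)))
    ...   | inj₂ e′ = ⌊⌋⁺ (y∈ , trans e′ e)

    side : Subset X → X → Bool
    side Λ x = not (Λ x)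

    side-sum : ∀ {A Λ} → Initial Λ A → Sum _<_ _<ᵇ_ A (side Λ) (λ _ → true)
    side-sum {A} {Λ} I = record { into = λ _ _ → _ ; mono = mono ; back = back }
      where
      mono : ∀ x y → x ∈ A → y ∈ A → x < y → side Λ x <ᵇ side Λ y ⊎ side Λ x ≡ side Λ y
      mono x y x∈ y∈ l with Λ x in ex | Λ y in ey
      ... | true  | true  = inj₂ refl
      ... | false | false = inj₂ refl
      ... | true  | false = inj₁ false<true
      ... | false | true  = ⊥-elim (subst T ex (Initial.closed I x y x∈ (subst T (sym ey) _) l))
      back : ∀ x y → x ∈ A → y ∈ A → side Λ x <ᵇ side Λ y → x < y
      back x y x∈ y∈ l with Λ x in ex | Λ y in ey | l
      ... | true | false | _ = Initial.separates I (subst T (sym ex) _) y∈ (subst T ey)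
      ... | true | true | ()
      ... | false | true | ()
      ... | false | false | ()

    side-false : ∀ {A Λ} → Initial Λ A → fibre A (side Λ) false ≡ Λ
    side-false {A} {Λ} I = subset-ext
      (λ {x} x∈ → let _ , e = ⌊⌋⁻ x∈ in in-Λ x e)
      (λ {x} x∈ → ⌊⌋⁺ (Initial.⊆-whole I x x∈ , cong not (T⇒≡ x∈)))
      where
      in-Λ : ∀ x → not (Λ x) ≡ false → x ∈ Λ
      in-Λ x e with Λ x
      ... | true = _

    side-true : ∀ {A Λ} → fibre A (side Λ) true ≡ (A ∖ Λ)
    side-true {A} {Λ} = subset-ext
      (λ {x} x∈ → let x∈A , e = ⌊⌋⁻ x∈ in ∖⁺ A Λ x∈A (out x e))
      (λ {x} x∈ → let x∈A , x∉ = ⌊⌋⁻ x∈ in ⌊⌋⁺ (x∈A , flip-out x x∉))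
      where
      out : ∀ x → not (Λ x) ≡ true → ¬ x ∈ Λ
      out x e x∈ with Λ x
      out x () x∈ | true
      flip-out : ∀ x → ¬ x ∈ Λ → not (Λ x) ≡ true
      flip-out x x∉ with Λ x
      ... | true  = ⊥-elim (x∉ _)
      ... | false = refl

    initial-convex : ∀ {A Λ} → Initial Λ A → Convex Λ A
    initial-convex I x y z x∈ z∈ y∈ l l′ = Initial.closed I y z y∈ z∈ l′

    rest-convex : ∀ {A Λ} → Initial Λ A → Convex (A ∖ Λ) A
    rest-convex {A} {Λ} I x y z x∈ z∈ y∈ l l′ = let x∈A , x∉ = ⌊⌋⁻ x∈ in
      ∖⁺ A Λ y∈ λ y∈Λ → x∉ (Initial.closed I x y x∈A y∈Λ l)

    convex-trans : ∀ {A A′} → Convex A′ A → (∀ x → x ∈ A′ → x ∈ A) → Convex A B → Convex A′ B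
    convex-trans cvx′ sub cvx x y z x∈ z∈ y∈ l l′ = cvx′ x y z x∈ z∈ (cvx x y z (sub x x∈) (sub z z∈) y∈ l l′) l l′

    initial-part : ∀ {A Λ} → Part A → Initial Λ A → ∃ (_∈ Λ) → Part Λ
    initial-part P I ne = record
      { ⊆B = λ x x∈ → ⊆B x (Initial.⊆-whole I x x∈)
      ; convex = convex-trans (initial-convex I) (Initial.⊆-whole I) convex ; nonempty = ne }
      where open Part P

    rest-part : ∀ {A Λ} → Part A → Initial Λ A → ∃ (_∈ (A ∖ Λ)) → Part (A ∖ Λ)
    rest-part P I ne = record
      { ⊆B = λ x x∈ → ⊆B x (proj₁ (⌊⌋⁻ x∈))
      ; convex = convex-trans (rest-convex I) (λ x x∈ → proj₁ (⌊⌋⁻ x∈)) convex ; nonempty = ne }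
      where open Part P

    abstract
      transferable-sum : ∀ {A Λ} → Part A → Initial Λ A → ∃ (_∈ Λ) → ∃ (_∈ (A ∖ Λ)) →
                         Transferable Λ → Transferable (A ∖ Λ) → Transferable A
      transferable-sum {A} {Λ} P I ne ne′ t t′ B′ c′ sm Db _ same = glue-pieces (side-sum I) (side-sum M.initial′) λ
          { false → proj₁ low , trans (cong (λ Q → tp _<_ ks Q (c′ & proj₁ low)) (side-false M.initial′))
                                      (trans (proj₂ low) (cong type (sym (side-false I))))
          ; true → proj₁ high , trans (cong (λ Q → tp _<_ ks Q (c′ & proj₁ high)) side-true)
                                      (trans (proj₂ high) (cong type (sym side-true))) }
        where
        M : Match c A Λ c′ B′
        M = match I (Part.dense-part P) ne ne′ Db sm same
        module M = Match M
        low : ∃[ r ] tp _<_ ks M.Λ′ (c′ & r) ≡ type Λ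
        low = t M.Λ′ c′ (small-⊆ (Initial.⊆-whole M.initial′) sm)
                (dense-convex Db (Initial.⊆-whole M.initial′) (initial-convex M.initial′)) M.inΛ′ M.shapeΛ
        high : ∃[ r ] tp _<_ ks (B′ ∖ M.Λ′) (c′ & r) ≡ type (A ∖ Λ)
        high = t′ (B′ ∖ M.Λ′) c′ (small-⊆ (∖-⊆ B′ M.Λ′) sm)
                (dense-convex Db (∖-⊆ B′ M.Λ′) (rest-convex M.initial′)) M.outΛ′ M.shape∖

    split-transferable : ∀ {A} Λ → Part A → Initial Λ A → (∃ (_∈ Λ) → Transferable Λ) →
                         (∃ (_∈ (A ∖ Λ)) → Transferable (A ∖ Λ)) → Transferable A
    split-transferable {A} Λ P I t t′ with em {∃ (_∈ Λ)} | em {∃ (_∈ (A ∖ Λ))}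
    ... | yes ne | yes ne′ = transferable-sum P I ne ne′ (t ne) (t′ ne′)
    ... | yes ne | no none = subst Transferable (subset-ext (λ {x} → Initial.⊆-whole I x)
            (λ {x} x∈ → by-contradiction λ x∉ → none (x , ∖⁺ A Λ x∈ x∉))) (t ne)
    ... | no none | _ = subst Transferable all (t′ (let a , a∈ = Part.nonempty P in a , subst (a ∈_) (sym all) a∈))
      where
      all : (A ∖ Λ) ≡ A
      all = subset-ext (λ {x} x∈ → proj₁ (⌊⌋⁻ x∈)) (λ {x} x∈ → ∖⁺ A Λ x∈ (λ x∈Λ → none (x , x∈Λ)))

    -- The closed interval with ends in either order, so that symmetry of `_≈_` needs no comparison
    -- of `x` and `y`.
    Hull : X → X → X → Set
    Hull x y z = (x ≼ z ⊎ y ≼ z) × (z ≼ x ⊎ z ≼ y)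

    infix 4 _≈_
    -- Asking for all parts inside the hull, and not only for the largest one, makes the relation
    -- inherited by points in between (`≈-hull`), hence its classes convex.
    record _≈_ (x y : X) : Set where
      constructor near
      field transfer : ∀ A → Part A → (∀ z → z ∈ A → Hull x y z) → Transferable A

    open _≈_

    hull-ordered : ∀ {x y z} → x ≼ z → z ≼ y → Hull x y z
    hull-ordered l l′ = inj₁ l , inj₂ l′

    hull-swap : ∀ {x y z} → Hull x y z → Hull y x z
    hull-swap (inj₁ l , inj₁ l′) = inj₂ l , inj₂ l′
    hull-swap (inj₁ l , inj₂ l′) = inj₂ l , inj₁ l′
    hull-swap (inj₂ l , inj₁ l′) = inj₁ l , inj₂ l′
    hull-swap (inj₂ l , inj₂ l′) = inj₁ l , inj₁ l′

    hull-shrink : ∀ {x y w z} → Hull x y w → Hull x w z → Hull x y z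
    hull-shrink (a , b) (p , r) = low a p , high b r
      where
      low : ∀ {x y w z} → x ≼ w ⊎ y ≼ w → x ≼ z ⊎ w ≼ z → x ≼ z ⊎ y ≼ z
      low _ (inj₁ l) = inj₁ l
      low (inj₁ l) (inj₂ l′) = inj₁ (≼-trans l l′)
      low (inj₂ l) (inj₂ l′) = inj₂ (≼-trans l l′)
      high : ∀ {x y w z} → w ≼ x ⊎ w ≼ y → z ≼ x ⊎ z ≼ w → z ≼ x ⊎ z ≼ y
      high _ (inj₁ l) = inj₁ l
      high (inj₁ l) (inj₂ l′) = inj₁ (≼-trans l′ l)
      high (inj₂ l) (inj₂ l′) = inj₂ (≼-trans l′ l)

    ≈-refl : ∀ {x} → x ≈ x
    ≈-refl {x} = near λ A P h → let a , a∈ = Part.nonempty P in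
      transferable-single a∈ λ y y∈ → trans (eq y (h y y∈)) (sym (eq a (h a a∈)))
      where
      eq : ∀ z → Hull x x z → z ≡ x
      eq z (p , r) = ≼-antisym ([ (λ l → l) , (λ l → l) ]′ r) ([ (λ l → l) , (λ l → l) ]′ p)

    ≈-sym : ∀ {x y} → x ≈ y → y ≈ x
    ≈-sym e = near λ A P h → transfer e A P λ z z∈ → hull-swap (h z z∈)

    ≈-hull : ∀ {x y w} → x ≈ y → Hull x y w → x ≈ w
    ≈-hull e hw = near λ A P h → transfer e A P λ z z∈ → hull-shrink hw (h z z∈)

    Up-to : Subset X → X → Subset X
    Up-to A y = ⟪ (λ z → z ∈ A × z ≼ y) ⟫

    up-to-initial : ∀ A y → Initial (Up-to A y) A
    up-to-initial A y = record
      { ⊆-whole = λ u u∈ → proj₁ (⌊⌋⁻ u∈)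
      ; closed = λ u v u∈ v∈ u<v → ⌊⌋⁺ (u∈ , asym (<-≼-trans u<v (proj₂ (⌊⌋⁻ v∈)))) }

    up-to-rest : ∀ A y z → z ∈ (A ∖ Up-to A y) → z ∈ A × y < z
    up-to-rest A y z z∈ = let z∈A , z∉ = ⌊⌋⁻ z∈ in z∈A , by-contradiction λ h → z∉ (⌊⌋⁺ (z∈A , h))

    -- A part in the hull of `x` and `z` is cut at `y`. If `y` is outside the hull, one side is
    -- empty, which `split-transferable` allows.
    ≈-trans : ∀ {x y z} → x ≈ y → y ≈ z → x ≈ z
    ≈-trans {x} {y} {z} e e′ with <⊎≽ z x
    ... | inj₂ x≼z = near λ A P h → split-transferable (Up-to A y) P (up-to-initial A y)
            (λ ne → transfer e _ (initial-part P (up-to-initial A y) ne) λ w w∈ →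
              let w∈A , w≼y = ⌊⌋⁻ w∈ in inj₁ (low w (h w w∈A)) , inj₂ w≼y)
            (λ ne → transfer e′ _ (rest-part P (up-to-initial A y) ne) λ w w∈ →
              let w∈A , y<w = up-to-rest A y w w∈ in inj₁ (asym y<w) , inj₂ (high w (h w w∈A)))
      where
      low : ∀ w → Hull x z w → x ≼ w
      low w (inj₁ l , _) = l
      low w (inj₂ l , _) = ≼-trans x≼z l
      high : ∀ w → Hull x z w → w ≼ z
      high w (_ , inj₁ l) = ≼-trans l x≼z
      high w (_ , inj₂ l) = l
    ... | inj₁ z<x = near λ A P h → split-transferable (Up-to A y) P (up-to-initial A y)
            (λ ne → transfer e′ _ (initial-part P (up-to-initial A y) ne) λ w w∈ →
              let w∈A , w≼y = ⌊⌋⁻ w∈ in inj₂ (low w (h w w∈A)) , inj₁ w≼y)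
            (λ ne → transfer e _ (rest-part P (up-to-initial A y) ne) λ w w∈ →
              let w∈A , y<w = up-to-rest A y w w∈ in inj₂ (asym y<w) , inj₁ (high w (h w w∈A)))
      where
      low : ∀ w → Hull x z w → z ≼ w
      low w (inj₁ l , _) = ≼-trans (asym z<x) l
      low w (inj₂ l , _) = l
      high : ∀ w → Hull x z w → w ≼ x
      high w (_ , inj₁ l) = l
      high w (_ , inj₂ l) = ≼-trans l (asym z<x)

    module _ {_≺_ : Rel ℕ 0ℓ} {A : Subset X} (P : Part A) {x₀ : X} (close : ∀ y → y ∈ A → x₀ ≈ y)
             {f : X → ℕ} (S : Sum _<_ _≺_ A f (λ _ → true))
             (nonempty : ∀ n → ∃ (_∈ fibre A f n))
             (bounded : ∀ n → ∃[ b ] (b ∈ A × (∀ z → z ∈ fibre A f n → Hull x₀ b z))) where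

      -- Each piece lies between `x₀` and a point `b` of the part, so `x₀ ≈ b` transfers it. The
      -- order on the indices is left open to cover sequences of pieces in both directions.
      transfer-omega : ∀ B′ (c′ : X → C) → Small B′ → Dense E B′ c′ → ∀ {g} → Sum _<_ _≺_ B′ g (λ _ → true) →
        (∀ n → ∃ (_∈ fibre B′ g n)) → (∀ n → shape (fibre A f n) c ≡ shape (fibre B′ g n) c′) →
        ∃[ r ] tp _<_ ks B′ (c′ & r) ≡ type A
      transfer-omega B′ c′ sm Db {g} S′ nonempty′ same = glue-pieces S S′ λ n →
        let b , b∈ , h = bounded n in
        transfer (close b b∈) (fibre A f n)
          (record { ⊆B = λ x x∈ → Part.⊆B P x (proj₁ (⌊⌋⁻ x∈))
                  ; convex = convex-trans (fibre-convex S n) (λ x x∈ → proj₁ (⌊⌋⁻ x∈)) (Part.convex P)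
                  ; nonempty = nonempty n }) h
          (fibre B′ g n) c′ (small-⊆ (fibre-⊆ B′ g n) sm)
          (dense-convex Db (fibre-⊆ B′ g n) (fibre-convex S′ n)) (nonempty′ n) (same n)

    module Mᵒ = Matching em ext (O ᵒ)
    open Mirror em ext O using (shape-flip)

    nothing-max : ∀ {A} → (∀ b → ¬ IsMax A b) → NoGreatest A
    nothing-max none x x∈ = by-contradiction λ h → none x (x∈ , λ y y∈ l → h (y , y∈ , l))

    nothing-min : ∀ {A} → (∀ b → ¬ IsMin A b) → NoLeast A
    nothing-min none x x∈ = by-contradiction λ h → none x (x∈ , λ y y∈ l → h (y , y∈ , l))

    module _ {C : Set} {c : X → C} {A e} (I : OmegaIndex A c e) where
      open OmegaIndex I

      omega-sum : Sum _<_ _<ⁿ_ A index (λ _ → true)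
      omega-sum = record
        { into = λ _ _ → _
        ; mono = λ x y x∈ y∈ l → ℕ.m≤n⇒m<n∨m≡n (index-mono x y x∈ y∈ l)
        ; back = back }
        where
        back : ∀ x y → x ∈ A → y ∈ A → index x <ⁿ index y → x < y
        back x y x∈ y∈ l with compare x y
        ... | tri< m _ _ = m
        ... | tri≈ _ refl _ = ⊥-elim (ℕ.<-irrefl refl l)
        ... | tri> _ _ g = ⊥-elim (ℕ.<⇒≱ l (index-mono y x y∈ x∈ g))

    module _ {C : Set} {c : X → C} {A e} (I : Mᵒ.OmegaIndex A c e) where
      open Mᵒ.OmegaIndex I

      omega-sumᵒ : Sum _<_ (λ i j → j <ⁿ i) A index (λ _ → true)
      omega-sumᵒ = record
        { into = λ _ _ → _
        ; mono = λ x y x∈ y∈ l → [ inj₁ , (λ e → inj₂ (sym e)) ]′ (ℕ.m≤n⇒m<n∨m≡n (index-mono y x y∈ x∈ l))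
        ; back = back }
        where
        back : ∀ x y → x ∈ A → y ∈ A → index y <ⁿ index x → x < y
        back x y x∈ y∈ l with compare x y
        ... | tri< m _ _ = m
        ... | tri≈ _ refl _ = ⊥-elim (ℕ.<-irrefl refl l)
        ... | tri> _ _ g = ⊥-elim (ℕ.<⇒≱ l (index-mono x y x∈ y∈ g))

    abstract
      -- Equivalence to `x₀` speaks of bounded parts only. With a greatest point `A` is such a part;
      -- without one, both sets are cut into a sequence of bounded pieces after points of the same
      -- colour `c a`.
      transferable-right : ∀ {A} → Part A → ∀ {x₀} → (∀ y → y ∈ A → x₀ ≼ y) → (∀ y → y ∈ A → x₀ ≈ y) → Transferable A
      transferable-right {A} P {x₀} bound close with em {∃[ b ] IsMax A b}
      ... | yes (b , b∈ , b≥) = transfer (close b b∈) A P λ z z∈ → hull-ordered (bound z z∈) (b≥ z z∈)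
      ... | no none = copy
        where
        topA : NoGreatest A
        topA = nothing-max λ b h → none (b , h)
        copy : Transferable A
        copy B′ c′ sm Db (b , b∈) same =
          let a , a∈ = Part.nonempty P
              e∈ = Dense.colour (Part.dense-part P) a a∈
              topB : NoGreatest B′
              topB = max-nothing⁻ (trans (sym (cong (λ s → proj₁ (proj₂ s)) same)) (max-nothing⁺ topA))
              I = omega-index (Part.dense-part P) topA a∈ e∈
              I′ = omega-index Db topB b∈ e∈
          in transfer-omega P close (omega-sum I) (OmegaIndex.nonempty I)
               (λ n → let u , u∈ , h = OmegaIndex.bounded I n in
                  u , u∈ , λ z z∈ → hull-ordered (bound z (fibre-⊆ A (OmegaIndex.index I) n z z∈)) (h z z∈))
               B′ c′ sm Db (omega-sum I′) (OmegaIndex.nonempty I′)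
               λ { zero → trans (OmegaIndex.shape₀ I) (trans (cong (λ m → m , just (c a) , true) (cong proj₁ same)) (sym (OmegaIndex.shape₀ I′)))
                 ; (suc n) → trans (OmegaIndex.shape₊ I n) (sym (OmegaIndex.shape₊ I′ n)) }

      transferable-left : ∀ {A} → Part A → ∀ {x₀} → (∀ y → y ∈ A → y ≼ x₀) → (∀ y → y ∈ A → x₀ ≈ y) → Transferable A
      transferable-left {A} P {x₀} bound close with em {∃[ b ] IsMin A b}
      ... | yes (b , b∈ , b≤) = transfer (close b b∈) A P λ z z∈ → inj₂ (b≤ z z∈) , inj₁ (bound z z∈)
      ... | no none = copy
        where
        bottomA : NoLeast A
        bottomA = nothing-min λ b h → none (b , h)
        copy : Transferable A
        copy B′ c′ sm Db (b , b∈) same =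
          let a , a∈ = Part.nonempty P
              e∈ = Dense.colour (Part.dense-part P) a a∈
              bottomB : NoLeast B′
              bottomB = min-nothing⁻ (trans (sym (cong proj₁ same)) (min-nothing⁺ bottomA))
              I = Mᵒ.omega-index (dense-flip (Part.dense-part P)) bottomA a∈ e∈
              I′ = Mᵒ.omega-index (dense-flip Db) bottomB b∈ e∈
          in transfer-omega P close (omega-sumᵒ I) (Mᵒ.OmegaIndex.nonempty I)
               (λ n → let u , u∈ , h = Mᵒ.OmegaIndex.bounded I n in
                  u , u∈ , λ z z∈ → inj₂ (h z z∈) , inj₁ (bound z (fibre-⊆ A (Mᵒ.OmegaIndex.index I) n z z∈)))
               B′ c′ sm Db (omega-sumᵒ I′) (Mᵒ.OmegaIndex.nonempty I′)
               λ { zero → trans (shape-flip _ c (Mᵒ.OmegaIndex.shape₀ I))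
                    (trans (cong (λ m → just (c a) , m , true) (cong (λ s → proj₁ (proj₂ s)) same)) (sym (shape-flip _ c′ (Mᵒ.OmegaIndex.shape₀ I′))))
                 ; (suc n) → trans (shape-flip _ c (Mᵒ.OmegaIndex.shape₊ I n)) (sym (shape-flip _ c′ (Mᵒ.OmegaIndex.shape₊ I′ n))) }

      transferable-class : ∀ {A} → Part A → (∀ x y → x ∈ A → y ∈ A → x ≈ y) → Transferable A
      transferable-class {A} P all-≈ =
        let a , a∈ = Part.nonempty P
            I = up-to-initial A a
        in split-transferable (Up-to A a) P I
             (λ ne → transferable-left (initial-part P I ne) (λ y y∈ → proj₂ (⌊⌋⁻ y∈))
                       (λ y y∈ → all-≈ a y a∈ (proj₁ (⌊⌋⁻ y∈))))
             (λ ne → transferable-right (rest-part P I ne) (λ y y∈ → asym (proj₂ (up-to-rest A a y y∈)))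
                       (λ y y∈ → all-≈ a y a∈ (proj₁ (up-to-rest A a y y∈))))

    -- Classes are convex, so the order between two of them does not depend on the representatives.
    ≈-< : ∀ {x y x′ y′} → x < y → ¬ x ≈ y → x ≈ x′ → y ≈ y′ → x′ < y′
    ≈-< {x} {y} {x′} {y′} l x≉y e e′ = by-contradiction λ y′≼x′ →
      x≉y (≈-trans e (≈-sym (≈-hull e′ (inj₂ y′≼x′ , inj₁ (asym x′<y)))))
      where
      x′<y : x′ < y
      x′<y = by-contradiction λ y≼x′ → x≉y (≈-hull e (hull-ordered (asym l) y≼x′))

    Class : X → Subset X
    Class x = ⟪ (λ y → y ∈ B × x ≈ y) ⟫

    class-part : ∀ x → x ∈ B → Part (Class x)
    class-part x x∈ = record
      { ⊆B = λ y y∈ → proj₁ (⌊⌋⁻ y∈)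
      ; convex = λ u v w u∈ w∈ v∈ l l′ →
          let _ , x≈u = ⌊⌋⁻ u∈ ; _ , x≈w = ⌊⌋⁻ w∈
          in ⌊⌋⁺ (v∈ , ≈-trans x≈u (≈-hull (≈-trans (≈-sym x≈u) x≈w) (hull-ordered (asym l) (asym l′))))
      ; nonempty = x , ⌊⌋⁺ (x∈ , ≈-refl) }

    class-transferable : ∀ x → x ∈ B → Transferable (Class x)
    class-transferable x x∈ = transferable-class (class-part x x∈)
      λ u v u∈ v∈ → ≈-trans (≈-sym (proj₂ (⌊⌋⁻ u∈))) (proj₂ (⌊⌋⁻ v∈))

    class≡ : ∀ {x y} → x ≈ y → Class x ≡ Class y
    class≡ e = subset-ext (λ z∈ → let z∈B , h = ⌊⌋⁻ z∈ in ⌊⌋⁺ (z∈B , ≈-trans (≈-sym e) h))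
                          (λ z∈ → let z∈B , h = ⌊⌋⁻ z∈ in ⌊⌋⁺ (z∈B , ≈-trans e h))

    abstract
      -- Otherwise every point of `B` between them is equivalent to `u` or to `v`. Each part in
      -- their hull then consists of at most two stretches inside single classes, which are
      -- transferable, and this would give `u ≈ v`.
      classes-dense : ∀ u v → u < v → ¬ u ≈ v → ∃[ z ] (z ∈ B × u < z × z < v × ¬ u ≈ z × ¬ z ≈ v)
      classes-dense u v u<v u≉v = by-contradiction λ none → u≉v (near λ A P h →
        let bounds : ∀ z → z ∈ A → u ≼ z × z ≼ v
            bounds z z∈ = ordered (h z z∈)
            close : ∀ z → z ∈ A → ¬ u ≈ z → z ≈ v
            close z z∈ u≉z = by-contradiction λ z≉v →
              let u≼z , z≼v = bounds z z∈ in
              none (z , Part.⊆B P z z∈ , strict u≼z (λ { refl → u≉z ≈-refl }) , strict z≼v (λ { refl → z≉v ≈-refl }) , u≉z , z≉v)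
            Λ = ⟪ (λ z → z ∈ A × u ≈ z) ⟫
            I : Initial Λ A
            I = record { ⊆-whole = λ z z∈ → proj₁ (⌊⌋⁻ z∈)
                       ; closed = λ x y x∈ y∈ x<y → ⌊⌋⁺ (x∈ , ≈-hull (proj₂ (⌊⌋⁻ y∈))
                           (hull-ordered (proj₁ (bounds x x∈)) (asym x<y))) }
            near-v : ∀ z → z ∈ (A ∖ Λ) → z ≈ v
            near-v z z∈ = let z∈A , z∉ = ⌊⌋⁻ z∈ in close z z∈A (λ e → z∉ (⌊⌋⁺ (z∈A , e)))
        in split-transferable Λ P I
             (λ ne → transferable-class (initial-part P I ne) λ x y x∈ y∈ →
                ≈-trans (≈-sym (proj₂ (⌊⌋⁻ x∈))) (proj₂ (⌊⌋⁻ y∈)))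
             (λ ne → transferable-class (rest-part P I ne) λ x y x∈ y∈ →
                ≈-trans (near-v x x∈) (≈-sym (near-v y y∈))))
        where
        strict : ∀ {x y} → x ≼ y → ¬ x ≡ y → x < y
        strict h ne with ≼⇒<⊎≡ h
        ... | inj₁ l = l
        ... | inj₂ e = ⊥-elim (ne e)
        ordered : ∀ {z} → Hull u v z → u ≼ z × z ≼ v
        ordered (p , r) = [ (λ l → l) , (λ l → ≼-trans (asym u<v) l) ]′ p , [ (λ l → ≼-trans l (asym u<v)) , (λ l → l) ]′ r

    -- What is needed to copy a class: the shape to be cut out and the type to be attained there.
    -- There are finitely many kinds, so they can be settled one by one.
    Kind : Set
    Kind = Shape C × Ty ks (C × D)

    finite-Kind : Finite Kind
    finite-Kind = finite-× (finite-× (finite-Maybe finC) (finite-× (finite-Maybe finC) finite-Bool))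
                           (finite-Ty ks (finite-× finC finD))

    abstract
      kindOf : X → Kind
      kindOf x = shape (Class x) c , type (Class x)

      kind-shape : ∀ x → proj₁ (kindOf x) ≡ shape (Class x) c
      kind-shape x = refl

      kind-type : ∀ x → proj₂ (kindOf x) ≡ type (Class x)
      kind-type x = refl

      kind≡ : ∀ {x y} → x ≈ y → kindOf x ≡ kindOf y
      kind≡ e = cong (λ Q → shape Q c , type Q) (class≡ e)

    record Bad (u v : X) : Set where
      constructor bad
      field
        u<v : u < v
        u≉v : ¬ u ≈ v

    -- Only classes different from those of `u` and `v` count. An occurrence therefore persists when
    -- the interval is enlarged.
    Occurs : Kind → X → X → Set
    Occurs k u v = ∃[ z ] (z ∈ B × u < z × z < v × ¬ u ≈ z × ¬ z ≈ v × kindOf z ≡ k)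

    occurs-wider : ∀ {k u v u′ v′} → u′ ≼ u → v ≼ v′ → Occurs k u v → Occurs k u′ v′
    occurs-wider l l′ (z , z∈ , u<z , z<v , u≉z , z≉v , e) =
      z , z∈ , ≼-<-trans l u<z , <-≼-trans z<v l′ ,
      (λ h → u≉z (≈-sym (≈-hull (≈-sym h) (inj₂ l , inj₁ (asym u<z))))) ,
      (λ h → z≉v (≈-hull h (hull-ordered (asym z<v) l′))) , e

    -- Absent from the interval, or present in all its bad subintervals. Both alternatives are kept
    -- on narrowing, so settling a further kind does not disturb the earlier ones.
    Settled : Kind → X → X → Set
    Settled k u v = Occurs k u v → ∀ u′ v′ → Bad u′ v′ → u ≼ u′ → v′ ≼ v → Occurs k u′ v′

    settled-narrower : ∀ {k u v u′ v′} → u ≼ u′ → v′ ≼ v → Settled k u v → Settled k u′ v′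
    settled-narrower l l′ s o u″ v″ b m m′ = s (occurs-wider l l′ o) u″ v″ b (≼-trans l m) (≼-trans m′ l′)

    -- Narrow the bad interval for each kind in turn until the kind is absent or occurs in
    -- all bad subintervals.
    settle : ∀ (l : List Kind) u v → Bad u v →
      ∃[ u′ ] ∃[ v′ ] (Bad u′ v′ × u ≼ u′ × v′ ≼ v × (∀ k → k ∈ˡ l → Settled k u′ v′))
    settle [] u v b = u , v , b , irr , irr , λ k ()
    settle (k ∷ l) u v b with settle l u v b
    ... | u₁ , v₁ , b₁ , l₁ , l₁′ , s with em {∃[ u′ ] ∃[ v′ ] (Bad u′ v′ × u₁ ≼ u′ × v′ ≼ v₁ × ¬ Occurs k u′ v′)}
    ...   | yes (u₂ , v₂ , b₂ , l₂ , l₂′ , none) = u₂ , v₂ , b₂ , ≼-trans l₁ l₂ , ≼-trans l₂′ l₁′ ,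
            λ { k (here refl) o → ⊥-elim (none o) ; k (there k∈) → settled-narrower l₂ l₂′ (s k k∈) }
    ...   | no all = u₁ , v₁ , b₁ , l₁ , l₁′ ,
            λ { k (here refl) _ u′ v′ b′ m m′ → by-contradiction λ none → all (u′ , v′ , b′ , m , m′ , none)
              ; k (there k∈) → s k k∈ }

    module Settling {a b : X} (ab : Bad a b) (settled : ∀ k → Settled k a b) where

      F : Subset Kind
      F = ⟪ (λ k → Occurs k a b) ⟫

      -- A part may contain only fragments of its extreme classes. These fragments, `A₁` below and
      -- the tail above, are split off, each lying in a single class. The rest, `S`, is a union of
      -- whole classes without a first or last one.
      module Middle {A : Subset X} (P : Part A) (bounds : ∀ z → z ∈ A → a ≼ z × z ≼ b) where
        open Part P using (⊆B; convex; dense-part)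

        First Last : X → Set
        First z = ∀ w → w ∈ A → w < z → w ≈ z
        Last  z = ∀ w → w ∈ A → z < w → z ≈ w

        A₁ S : Subset X
        A₁ = ⟪ (λ z → z ∈ A × First z) ⟫
        S  = ⟪ (λ z → z ∈ (A ∖ A₁) × ¬ Last z) ⟫

        Inner : X → Set
        Inner z = z ∈ A × (∃[ p ] (p ∈ A × p < z × ¬ p ≈ z)) × (∃[ r ] (r ∈ A × z < r × ¬ z ≈ r))

        not-last : ∀ z → ¬ Last z → ∃[ r ] (r ∈ A × z < r × ¬ z ≈ r)
        not-last z h = by-contradiction λ none → h λ w w∈ l → by-contradiction λ n → none (w , w∈ , l , n)

        S⁻ : ∀ z → z ∈ S → Inner z
        S⁻ z z∈ = let z∈′ , ¬last = ⌊⌋⁻ z∈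
                      z∈A , z∉ = ⌊⌋⁻ z∈′
                  in z∈A , (by-contradiction λ none → z∉ (⌊⌋⁺ (z∈A , λ w w∈ l → by-contradiction λ n → none (w , w∈ , l , n)))) ,
                     not-last z ¬last

        S⁺ : ∀ z → Inner z → z ∈ S
        S⁺ z (z∈ , (p , p∈ , p<z , p≉z) , (r , r∈ , z<r , z≉r)) =
          ⌊⌋⁺ (∖⁺ A A₁ z∈ (λ z∈₁ → p≉z (proj₂ (⌊⌋⁻ z∈₁) p p∈ p<z)) , λ last → z≉r (last r r∈ z<r))

        A₁-initial : Initial A₁ A
        A₁-initial = record
          { ⊆-whole = λ z z∈ → proj₁ (⌊⌋⁻ z∈)
          ; closed = λ x y x∈ y∈ x<y → let _ , first = ⌊⌋⁻ y∈ in
              ⌊⌋⁺ (x∈ , λ w w∈ w<x → ≈-hull (first w w∈ (<-trans w<x x<y)) (hull-ordered (asym w<x) (asym x<y))) }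

        S-initial : Initial S (A ∖ A₁)
        S-initial = record
          { ⊆-whole = λ z z∈ → proj₁ (⌊⌋⁻ z∈)
          ; closed = λ x y x∈ y∈ x<y → ⌊⌋⁺ (x∈ , λ last →
              let _ , _ , (r , r∈ , y<r , y≉r) = S⁻ y y∈
                  x≈r = last r r∈ (<-trans x<y y<r)
              in y≉r (≈-trans (≈-sym (≈-hull x≈r (hull-ordered (asym x<y) (asym y<r)))) x≈r)) }

        from-order : ∀ {x y} → (x < y → x ≈ y) → (y < x → y ≈ x) → x ≈ y
        from-order {x} {y} f g with compare x y
        ... | tri< l _ _ = f l
        ... | tri≈ _ refl _ = ≈-refl
        ... | tri> _ _ l = ≈-sym (g l)

        A₁-near : ∀ x y → x ∈ A₁ → y ∈ A₁ → x ≈ y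
        A₁-near x y x∈ y∈ = let x∈A , fx = ⌊⌋⁻ x∈ ; y∈A , fy = ⌊⌋⁻ y∈
                            in from-order (fy x x∈A) (fx y y∈A)

        tail-last : ∀ x → x ∈ ((A ∖ A₁) ∖ S) → x ∈ A × Last x
        tail-last x x∈ = let x∈′ , x∉ = ⌊⌋⁻ x∈ in
          proj₁ (⌊⌋⁻ x∈′) , by-contradiction λ n → x∉ (⌊⌋⁺ (x∈′ , n))

        tail-near : ∀ x y → x ∈ ((A ∖ A₁) ∖ S) → y ∈ ((A ∖ A₁) ∖ S) → x ≈ y
        tail-near x y x∈ y∈ = let x∈A , lx = tail-last x x∈ ; y∈A , ly = tail-last y y∈
                              in from-order (lx y y∈A) (ly x x∈A)

        module Shuffle (S≢∅ : ∃ (_∈ S)) where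

          S⊆B : ∀ z → z ∈ S → z ∈ B
          S⊆B z z∈ = ⊆B z (proj₁ (S⁻ z z∈))

          class⊆S : ∀ z → z ∈ S → ∀ w → w ∈ B → z ≈ w → w ∈ S
          class⊆S z z∈ w w∈ e =
            let z∈A , (p , p∈ , p<z , p≉z) , (r , r∈ , z<r , z≉r) = S⁻ z z∈
                p<w = ≈-< p<z p≉z ≈-refl e
                w<r = ≈-< z<r z≉r e ≈-refl
            in S⁺ w (convex p w r p∈ r∈ w∈ p<w w<r ,
                     (p , p∈ , p<w , λ h → p≉z (≈-trans h (≈-sym e))) , (r , r∈ , w<r , λ h → z≉r (≈-trans e h)))

          kind∈F : ∀ z → z ∈ S → kindOf z ∈ F
          kind∈F z z∈ =
            let z∈A , (p , p∈ , p<z , p≉z) , (r , r∈ , z<r , z≉r) = S⁻ z z∈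
            in ⌊⌋⁺ (occurs-wider (proj₁ (bounds p p∈)) (proj₂ (bounds r r∈)) (z , ⊆B z z∈A , p<z , z<r , p≉z , z≉r , refl))

          abstract
            rep-data : Σ (Subset X → X) λ g → ∀ Q → ∃ (_∈ Q) → g Q ∈ Q
            rep-data = choice a λ Q h → h

          rep : X → X
          rep x = proj₁ rep-data (Class x)

          rep∈ : ∀ x → x ∈ B → rep x ∈ B × x ≈ rep x
          rep∈ x x∈ = ⌊⌋⁻ (proj₂ rep-data (Class x) (x , ⌊⌋⁺ (x∈ , ≈-refl)))

          rep-≈ : ∀ {x y} → x ≈ y → rep x ≡ rep y
          rep-≈ e = cong (proj₁ rep-data) (class≡ e)

          R : Subset X
          R = ⟪ (λ z → z ∈ S × rep z ≡ z) ⟫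

          abstract
            rep-R : ∀ z → z ∈ S → rep z ∈ R
            rep-R z z∈ = let r∈ , e = rep∈ z (S⊆B z z∈) in ⌊⌋⁺ (class⊆S z z∈ (rep z) r∈ e , rep-≈ (≈-sym e))

          rep-< : ∀ x y → x ∈ S → y ∈ S → x < y → ¬ x ≈ y → rep x < rep y
          rep-< x y x∈ y∈ l n = ≈-< l n (proj₂ (rep∈ x (S⊆B x x∈))) (proj₂ (rep∈ y (S⊆B y y∈)))

          rep-sum : Sum _<_ _<_ S rep R
          rep-sum = record { into = rep-R ; mono = mono ; back = back }
            where
            mono : ∀ x y → x ∈ S → y ∈ S → x < y → rep x < rep y ⊎ rep x ≡ rep y
            mono x y x∈ y∈ l with em {x ≈ y}
            ... | yes e = inj₂ (rep-≈ e)
            ... | no n  = inj₁ (rep-< x y x∈ y∈ l n)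
            back : ∀ x y → x ∈ S → y ∈ S → rep x < rep y → x < y
            back x y x∈ y∈ l with compare x y
            ... | tri< l′ _ _ = l′
            ... | tri≈ _ refl _ = ⊥-elim (irr l)
            ... | tri> _ _ g with mono y x y∈ x∈ g
            ...   | inj₁ l′ = ⊥-elim (asym l l′)
            ...   | inj₂ e  = ⊥-elim (irr (subst (_< rep y) (sym e) l))

          abstract
            rep-fibre : ∀ i → i ∈ R → fibre S rep i ≡ Class i
            rep-fibre i i∈ = subset-ext
              (λ {z} z∈ → let z∈S , e = ⌊⌋⁻ z∈ in
                ⌊⌋⁺ (S⊆B z z∈S , ≈-sym (subst (z ≈_) e (proj₂ (rep∈ z (S⊆B z z∈S))))))
              (λ {z} z∈ → let z∈B , e = ⌊⌋⁻ z∈ in ⌊⌋⁺ (class⊆S i i∈S z z∈B e , trans (rep-≈ (≈-sym e)) ri))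
              where
              i∈S : i ∈ S
              i∈S = proj₁ (⌊⌋⁻ i∈)
              ri : rep i ≡ i
              ri = proj₂ (⌊⌋⁻ i∈)

          reps-apart : ∀ i j → i ∈ R → j ∈ R → i < j → ¬ i ≈ j
          reps-apart i j i∈ j∈ l e = irr (subst (_< j) (trans (sym (proj₂ (⌊⌋⁻ i∈))) (trans (rep-≈ e) (proj₂ (⌊⌋⁻ j∈)))) l)

          between-S : ∀ i j z → i ∈ S → j ∈ S → z ∈ B → i < z → z < j → ¬ i ≈ z → ¬ z ≈ j → z ∈ S
          between-S i j z i∈ j∈ z∈ l l′ n n′ =
            let i∈A = proj₁ (S⁻ i i∈) ; j∈A = proj₁ (S⁻ j j∈)
            in S⁺ z (convex i z j i∈A j∈A z∈ l l′ , (i , i∈A , l , n) , (j , j∈A , l′ , n′))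

          -- Settledness is applied here: inequivalent `i` and `j` bound a bad subinterval of the
          -- settled one, so it meets every kind in `F`.
          dense-kinds : ∀ i j → i ∈ S → j ∈ S → i < j → ¬ i ≈ j → ∀ k → k ∈ F →
                        ∃[ z ] (z ∈ S × i < z × z < j × ¬ i ≈ z × ¬ z ≈ j × kindOf z ≡ k)
          dense-kinds i j i∈ j∈ l n k k∈ =
            let i∈A = proj₁ (S⁻ i i∈) ; j∈A = proj₁ (S⁻ j j∈)
                z , z∈ , i<z , z<j , i≉z , z≉j , e =
                  settled k (⌊⌋⁻ k∈) i j (bad l n) (proj₁ (bounds i i∈A)) (proj₂ (bounds j j∈A))
            in z , between-S i j z i∈ j∈ z∈ i<z z<j i≉z z≉j , i<z , z<j , i≉z , z≉j , e

          lower-class : ∀ i → i ∈ S → ∃[ z ] (z ∈ S × z < i × ¬ z ≈ i)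
          lower-class i i∈ =
            let i∈A , (p , p∈ , p<i , p≉i) , last = S⁻ i i∈
                z , z∈ , p<z , z<i , p≉z , z≉i = classes-dense p i p<i p≉i
            in z , S⁺ z (convex p z i p∈ i∈A z∈ p<z z<i , (p , p∈ , p<z , p≉z) , (i , i∈A , z<i , z≉i)) , z<i , z≉i

          upper-class : ∀ i → i ∈ S → ∃[ z ] (z ∈ S × i < z × ¬ i ≈ z)
          upper-class i i∈ =
            let i∈A , first , (r , r∈ , i<r , i≉r) = S⁻ i i∈
                z , z∈ , i<z , z<r , i≉z , z≉r = classes-dense i r i<r i≉r
            in z , S⁺ z (convex i z r i∈A r∈ z∈ i<z z<r , (i , i∈A , i<z , i≉z) , (r , r∈ , z<r , z≉r)) , i<z , i≉z

          R⊆S : ∀ z → z ∈ R → z ∈ S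
          R⊆S z z∈ = proj₁ (⌊⌋⁻ z∈)

          rep-of : ∀ i z → i ∈ R → z ∈ S → (z < i → ¬ z ≈ i → rep z < i) × (i < z → ¬ i ≈ z → i < rep z)
          rep-of i z i∈ z∈ =
            (λ l n → ≈-< l n (proj₂ (rep∈ z (S⊆B z z∈))) ≈-refl) ,
            (λ l n → ≈-< l n ≈-refl (proj₂ (rep∈ z (S⊆B z z∈))))

          kind-rep : ∀ z → z ∈ S → kindOf (rep z) ≡ kindOf z
          kind-rep z z∈ = sym (kind≡ (proj₂ (rep∈ z (S⊆B z z∈))))

          R-uniform : Uniform F R kindOf
          R-uniform = record
            { dense = record
              { colour = λ i i∈ → kind∈F i (R⊆S i i∈)
              ; between = λ i j i∈ j∈ l k k∈ →
                  let z , z∈ , i<z , z<j , i≉z , z≉j , e =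
                        dense-kinds i j (R⊆S i i∈) (R⊆S j j∈) l (reps-apart i j i∈ j∈ l) k k∈
                  in rep z , rep-R z z∈ , proj₂ (rep-of i z i∈ z∈) i<z i≉z , proj₁ (rep-of j z j∈ z∈) z<j z≉j ,
                     trans (kind-rep z z∈) e }
            ; inhabited = let z , z∈ = S≢∅ in rep z , rep-R z z∈
            ; noLeast = λ i i∈ → let z , z∈ , l , n = lower-class i (R⊆S i i∈)
                                 in rep z , rep-R z z∈ , proj₁ (rep-of i z i∈ z∈) l n
            ; noGreatest = λ i i∈ → let z , z∈ , l , n = upper-class i (R⊆S i i∈)
                                    in rep z , rep-R z z∈ , proj₂ (rep-of i z i∈ z∈) l n }

          R-small : Small R
          R-small = small-⊆ (λ z z∈ → S⊆B z (R⊆S z z∈)) small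

          S-noLeast : NoLeast S
          S-noLeast i i∈ = let z , z∈ , l , _ = lower-class i i∈ in z , z∈ , l

          S-noGreatest : NoGreatest S
          S-noGreatest i i∈ = let z , z∈ , l , _ = upper-class i i∈ in z , z∈ , l

          F-legit : ∀ k → k ∈ F → Legit E (proj₁ k)
          F-legit k k∈ = let z , z∈ , _ , _ , _ , _ , e = ⌊⌋⁻ k∈ in
            subst (λ k → Legit E (proj₁ k)) e (subst (Legit E) (sym (kind-shape z))
              (shape-legit (Part.dense-part (class-part z z∈)) (proj₂ (Part.nonempty (class-part z z∈)))))

          -- This serves the case of one-point classes: each class then has the colour of its point,
          -- and by density every colour of `E` occurs in `S`.
          F-onto : ∀ e → e ∈ E → (∀ k → k ∈ F → proj₂ (proj₂ (proj₁ k)) ≡ false) → ∃[ k ] (k ∈ F × proj₁ k ≡ Single e)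
          F-onto e e∈ singles =
            let i , i∈ = S≢∅
                i∈A = proj₁ (S⁻ i i∈)
                j , j∈ , l , n = upper-class i i∈
                j∈A = proj₁ (S⁻ j j∈)
                z , z∈ , i<z , z<j , cz = Dense.between dense-part i j i∈A j∈A l e e∈
                z∈S = inside-S i j z i∈ j∈ z∈ i<z z<j
                z∈C : z ∈ Class z
                z∈C = ⌊⌋⁺ (⊆B z z∈ , ≈-refl)
            in kindOf z , kind∈F z z∈S ,
               trans (kind-shape z) (trans (single-shape z∈C (λ w w∈ → single⁻ (trans (cong (λ s → proj₂ (proj₂ s)) (sym (kind-shape z))) (singles (kindOf z) (kind∈F z z∈S))) w z w∈ z∈C)) (cong Single cz))
            where
            inside-S : ∀ i j z → i ∈ S → j ∈ S → z ∈ A → i < z → z < j → z ∈ S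
            inside-S i j z i∈ j∈ z∈ l l′ =
              let _ , (p , p∈ , p<i , p≉i) , _ = S⁻ i i∈
                  _ , _ , (r , r∈ , j<r , j≉r) = S⁻ j j∈
              in S⁺ z (z∈ ,
                   (p , p∈ , <-trans p<i l , λ h → p≉i (≈-hull h (hull-ordered (asym p<i) (asym l)))) ,
                   (r , r∈ , <-trans l′ j<r , λ h → j≉r (≈-trans (≈-sym (≈-hull h (hull-ordered (asym l′) (asym j<r)))) h)))

          -- The kind of each piece is that of some class between `a` and `b`; the piece has the
          -- same shape, so it can be coloured to the type of that class. The index orders `R` and
          -- `Arr.R` are both uniform in the kinds of `F`, so the induction hypothesis identifies
          -- their types and `compose` joins the pieces.
          module Copy {B′ : Subset X} {c′ : X → C} (sm : Small B′) (Db : Dense E B′ c′) (arr : Arrangement proj₁ F B′ c′) where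
            module Arr = Arrangement arr

            piece : ∀ i → i ∈ Arr.R → ∃[ r ] tp _<_ ks (fibre B′ Arr.f i) (c′ & r) ≡ proj₂ (Arr.kind i)
            piece i i∈ =
              let z , z∈ , _ , _ , _ , _ , e = ⌊⌋⁻ (Dense.colour (Uniform.dense Arr.uniform) i i∈)
                  r , eq = class-transferable z z∈ (fibre B′ Arr.f i) c′ (small-⊆ (fibre-⊆ B′ Arr.f i) sm)
                    (dense-convex Db (fibre-⊆ B′ Arr.f i) (fibre-convex Arr.sum i))
                    (i , ⌊⌋⁺ (Arr.R⊆B i i∈ , Arr.fixed i i∈)) (trans (sym (kind-shape z)) (trans (cong proj₁ e) (sym (Arr.shapes i i∈))))
              in r , trans eq (trans (sym (kind-type z)) (cong proj₂ e))

            abstract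
              pieces : Σ (X → X → D) λ g → ∀ i → i ∈ Arr.R → tp _<_ ks (fibre B′ Arr.f i) (c′ & g i) ≡ proj₂ (Arr.kind i)
              pieces = choice (λ _ → point finD) piece

            copied : X → D
            copied x = proj₁ pieces (Arr.f x) x

            typed : ∀ i → i ∈ Arr.R → tp _<_ ks (fibre B′ Arr.f i) (c′ & copied) ≡ proj₂ (Arr.kind i)
            typed i i∈ = trans (tp-cong _<_ ks λ x x∈ → cong (λ j → c′ x , proj₁ pieces j x) (proj₂ (⌊⌋⁻ x∈)))
                               (proj₂ pieces i i∈)

            typed′ : ∀ i → i ∈ R → tp _<_ ks (fibre S rep i) (c & q) ≡ proj₂ (kindOf i)
            typed′ i i∈ = trans (cong type (rep-fibre i i∈)) (sym (kind-type i))

            copy : tp _<_ ks B′ (c′ & copied) ≡ type S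
            copy = sym (compose ks (finite-× finC finD) proj₂ rep-sum Arr.sum typed′ typed
                     (IH finite-Kind F R kindOf Arr.R Arr.kind R-uniform Arr.uniform R-small (small-⊆ Arr.R⊆B sm)))

          F≢∅ : ∃ (_∈ F)
          F≢∅ = let z , z∈ = S≢∅ in kindOf z , kind∈F z z∈

          arranged : ∀ {B′ c′} → Small B′ → Uniform E B′ c′ → Arrangement proj₁ F B′ c′
          arranged {B′} {c′} sm U′ = arrangement {C = C} {Kd = Kind} finite-Kind {E = E} proj₁ F F-legit {B = B′} {c = c′} U′ sm F-onto F≢∅

          abstract
            shuffle-transferable : Transferable S
            shuffle-transferable B′ c′ sm Db ne same = Copy.copied sm Db (arranged sm U′) , Copy.copy sm Db (arranged sm U′)
              where
              U′ : Uniform E B′ c′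
              U′ = record
                { dense = Db ; inhabited = ne
                ; noLeast = min-nothing⁻ (trans (sym (cong proj₁ same)) (min-nothing⁺ S-noLeast))
                ; noGreatest = max-nothing⁻ (trans (sym (cong (λ s → proj₁ (proj₂ s)) same)) (max-nothing⁺ S-noGreatest)) }

        transferable : Transferable A
        transferable = split-transferable A₁ P A₁-initial
          (λ ne → transferable-class (initial-part P A₁-initial ne) A₁-near)
          (λ ne → let P′ = rest-part P A₁-initial ne in
            split-transferable S P′ S-initial Shuffle.shuffle-transferable
              (λ ne′ → transferable-class (rest-part P′ S-initial ne′) tail-near))

      abstract
        a≈b : a ≈ b
        a≈b = near λ A P h → Middle.transferable P λ z z∈ → bounds z (h z z∈)
          where
          open Bad ab
          bounds : ∀ z → Hull a b z → a ≼ z × z ≼ b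
          bounds z (p , r) = [ (λ l → l) , (λ l → ≼-trans (asym u<v) l) ]′ p , [ (λ l → ≼-trans l (asym u<v)) , (λ l → l) ]′ r

    abstract
      no-bad : ∀ u v → ¬ Bad u v
      no-bad u v b =
        let u′ , v′ , b′ , _ , _ , s = settle (elements finite-Kind) u v b
        in Bad.u≉v b′ (Settling.a≈b b′ λ k → s k (complete finite-Kind k))

      whole-transferable : Transferable B
      whole-transferable = transferable-class
        (record { ⊆B = λ _ x∈ → x∈ ; convex = λ _ _ _ _ _ y∈ _ _ → y∈ ; nonempty = Uniform.inhabited U })
        λ x y x∈ y∈ → joined x y x∈ y∈
        where
        joined : ∀ x y → x ∈ B → y ∈ B → x ≈ y
        joined x y x∈ y∈ with compare x y
        ... | tri< l _ _ = by-contradiction λ n → no-bad x y (bad l n)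
        ... | tri≈ _ refl _ = ≈-refl
        ... | tri> _ _ g = ≈-sym (by-contradiction λ n → no-bad y x (bad g n))

  uniform-shape : ∀ {C} {E : Subset C} {B c} → Uniform E B c → shape B c ≡ (nothing , nothing , true)
  uniform-shape U = cong₂ _,_ (min-nothing⁺ noLeast) (cong₂ _,_ (max-nothing⁺ noGreatest)
      (let x , x∈ = inhabited ; y , y∈ , l = noGreatest x x∈ in several⁺ x∈ y∈ l))
    where open Uniform U

  idx-length : ∀ ks C → length (idx ks C) ≡ length ks
  idx-length []       C = refl
  idx-length (D ∷ ks) C = cong suc (idx-length ks _)

  -- The induction is on `n` because `idx` keeps the length of the list but changes its colour sets.
  -- With no moves left, a type records only colours and ordered pairs of colours, and in a uniform
  -- set all of those from `E` occur.
  uniform-type : ∀ n ks → length ks ≡ n → ∀ {C} → Finite C → {E : Subset C} {B B′ : Subset X} {c c′ : X → C} →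
    Uniform E B c → Uniform E B′ c′ → Small B → Small B′ → tp _<_ ks B c ≡ tp _<_ ks B′ c′
  uniform-type n [] _ finC U U′ _ _ = tp-ext₀ (one U U′) (one U′ U) (two U U′) (two U′ U)
    where
    one : ∀ {C} {E : Subset C} {B B′ : Subset X} {c c′ : X → C} → Uniform E B c → Uniform E B′ c′ →
          ∀ x → x ∈ B → ∃[ y ] (y ∈ B′ × c′ y ≡ c x)
    one U U′ x x∈ =
      let y , y∈ = Uniform.inhabited U′
          z , z∈ , l = Uniform.noGreatest U′ y y∈
          w , w∈ , _ , _ , e = Uniform.between U′ y z y∈ z∈ l _ (Uniform.colour U x x∈)
      in w , w∈ , e
    two : ∀ {C} {E : Subset C} {B B′ : Subset X} {c c′ : X → C} → Uniform E B c → Uniform E B′ c′ →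
          ∀ x x′ → x ∈ B → x′ ∈ B → x < x′ →
          ∃[ y ] ∃[ y′ ] (y ∈ B′ × y′ ∈ B′ × y < y′ × c′ y ≡ c x × c′ y′ ≡ c x′)
    two U U′ x x′ x∈ x′∈ _ =
      let y , y∈ , e = one U U′ x x∈
          z , z∈ , l = Uniform.noGreatest U′ y y∈
          w , w∈ , l′ , _ , e′ = Uniform.between U′ y z y∈ z∈ l _ (Uniform.colour U x′ x′∈)
      in y , w , y∈ , w∈ , l′ , e , e′
  uniform-type (suc n) (D ∷ ks) len {C} finC {E} U U′ sm sm′ = tp-ext {D = D} {ks = ks} (forth U U′ sm sm′) (forth U′ U sm′ sm)
    where
    forth : ∀ {B B′ : Subset X} {c c′ : X → C} → Uniform E B c → Uniform E B′ c′ → Small B → Small B′ →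
            ∀ q → ∃[ r ] tp _<_ ks B′ (c′ & r) ≡ tp _<_ ks B (c & q)
    forth {B} {B′} {c} {c′} U U′ sm sm′ q =
      Game.whole-transferable ks finC (proj₂ D) IH U sm q B′ c′ sm′ (Uniform.dense U′) (Uniform.inhabited U′)
        (trans (uniform-shape U) (sym (uniform-shape U′)))
      where
      IH : IndexClaim (idx ks ((C × proj₁ D) , finite-× finC (proj₂ D)))
      IH finK F R k R′ k′ UR UR′ = uniform-type n (idx ks _) (trans (idx-length ks _) (ℕ.suc-injective len)) finK UR UR′

-- From equal types to equal monadic theories.

module Formulas (em : ExcludedMiddle 0ℓ) (ext : Extensionality 0ℓ 0ℓ) where
  open Classical em ext
  open Types em ext

  rank : ∀ {n m} → Formula n m → ℕ
  rank (_ less _)  = 0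
  rank (_ equal _) = 0
  rank (_ in′ _)   = 0
  rank (neg φ)     = rank φ
  rank (φ and ψ)   = rank φ ⊔ rank ψ
  rank (ex₁ φ)     = suc (rank φ)
  rank (ex₂ φ)     = suc (rank φ)

  moves : ℕ → List FiniteSet
  moves k = replicate k (Bool , finite-Bool)

  All : {X : Set} → Subset X
  All _ = true

  -- The individuals named by the variables are recorded as singleton sets.
  record Codes {X C : Set} {n m : ℕ} (c : X → C) (mark : C → Fin n → Bool) (set : C → Fin m → Bool)
               (xs : Vec X n) (Ps : Vec (Subset X) m) : Set where
    field
      only   : ∀ i y → T (mark (c y) i) → y ≡ lookup xs i
      marked : ∀ i → T (mark (c (lookup xs i)) i)
      member : ∀ j y → lookup Ps j y ≡ set (c y) j

  mark₁ : ∀ {C : Set} {n} → (C → Fin n → Bool) → C × Bool → Fin (suc n) → Bool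
  mark₁ mark (a , b) fzero    = b
  mark₁ mark (a , b) (fsuc i) = mark a i

  Total : Structure → Set
  Total 𝔐 = IsStrictTotalOrder _≡_ (Structure._<_ 𝔐)

  -- Both kinds of quantifier cost one move. The statement is for arbitrary total orders so that the
  -- two structures can exchange roles under a negation.
  holds-transfer : ∀ {n m} (φ : Formula n m) k → rank φ ≤ⁿ k → (𝔐 𝔑 : Structure) → Total 𝔐 → Total 𝔑 →
    ∀ {C : Set} {c d} (mark : C → Fin n → Bool) (set : C → Fin m → Bool) {xs ys Ps Qs} →
    tp (Structure._<_ 𝔐) (moves k) All c ≡ tp (Structure._<_ 𝔑) (moves k) All d →
    Codes c mark set xs Ps → Codes d mark set ys Qs → Holds 𝔐 φ xs Ps → Holds 𝔑 φ ys Qs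
  holds-transfer (i less j) k _ 𝔐 𝔑 _ _ mark set eq α β l =
    let y , y′ , _ , _ , l′ , e , e′ = tp-occurs₂ (moves k) eq _ _ tt tt l
        p = Codes.only β i y (subst (λ a → T (mark a i)) (sym e) (Codes.marked α i))
        p′ = Codes.only β j y′ (subst (λ a → T (mark a j)) (sym e′) (Codes.marked α j))
    in subst (λ z → Structure._<_ 𝔑 z _) p (subst (Structure._<_ 𝔑 y) p′ l′)
  holds-transfer (i equal j) k _ 𝔐 𝔑 _ _ {c = c} mark set {xs = xs} eq α β l =
    let y , _ , e = tp-occurs (moves k) eq (lookup xs i) tt
    in trans (sym (Codes.only β i y (subst (λ a → T (mark a i)) (sym e) (Codes.marked α i))))
             (Codes.only β j y (subst (λ a → T (mark a j)) (sym e) (subst (λ z → T (mark (c z) j)) (sym l) (Codes.marked α j))))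
  holds-transfer (i in′ j) k _ 𝔐 𝔑 _ _ mark set {xs = xs} {Qs = Qs} eq α β l =
    let y , _ , e = tp-occurs (moves k) eq (lookup xs i) tt
    in subst (λ z → z ∈ lookup Qs j) (Codes.only β i y (subst (λ a → T (mark a i)) (sym e) (Codes.marked α i)))
         (subst T (trans (Codes.member α j _) (trans (cong (λ a → set a j) (sym e)) (sym (Codes.member β j y)))) l)
  holds-transfer (neg φ) k r 𝔐 𝔑 t u mark set eq α β ¬h h =
    ¬h (holds-transfer φ k r 𝔑 𝔐 u t mark set (sym eq) β α h)
  holds-transfer (φ and ψ) k r 𝔐 𝔑 t u mark set eq α β (h , h′) =
    holds-transfer φ k (ℕ.≤-trans (ℕ.m≤m⊔n _ _) r) 𝔐 𝔑 t u mark set eq α β h ,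
    holds-transfer ψ k (ℕ.≤-trans (ℕ.m≤n⊔m (rank φ) _) r) 𝔐 𝔑 t u mark set eq α β h′
  holds-transfer (ex₁ φ) (suc k) (s≤s r) 𝔐 𝔑 t u {C} {c} {d} mark set {xs} {ys} {Ps} {Qs} eq α β (x , h) =
    y , holds-transfer φ k r 𝔐 𝔑 t u (mark₁ mark) (λ a → set (proj₁ a)) (sym eq′)
          (record { only = λ { fzero z m → ⌊⌋⁻ m ; (fsuc i) z m → α.only i z m }
                  ; marked = λ { fzero → ⌊⌋⁺ refl ; (fsuc i) → α.marked i } ; member = α.member })
          (record { only = λ { fzero z m → unique z m ; (fsuc i) z m → β.only i z m }
                  ; marked = λ { fzero → ry ; (fsuc i) → β.marked i } ; member = β.member }) h
    where
    module α = Codes α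
    module β = Codes β
    q : Structure.Carrier 𝔐 → Bool
    q z = ⌊ z ≡ x ⌋
    answer : ∃[ ρ ] tp (Structure._<_ 𝔑) (moves k) All (d & ρ) ≡ tp (Structure._<_ 𝔐) (moves k) All (c & q)
    answer = tp-forth {D = Bool , finite-Bool} {ks = moves k} eq q
    ρ = proj₁ answer
    eq′ = proj₂ answer
    hit : ∃[ y ] (y ∈ All × (d y , ρ y) ≡ (c x , q x))
    hit = tp-occurs (moves k) (sym eq′) x tt
    y = proj₁ hit
    ry : T (ρ y)
    ry = subst T (sym (cong proj₂ (proj₂ (proj₂ hit)))) (⌊⌋⁺ refl)
    -- The answer to a singleton is a singleton: two marked points on this side would correspond to
    -- an ordered pair on the other side with both members equal to `x`.
    no-two : ∀ z z′ → T (ρ z) → T (ρ z′) → ¬ Structure._<_ 𝔑 z z′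
    no-two z z′ m m′ l =
      let w , w′ , _ , _ , l′ , e , e′ = tp-occurs₂ (moves k) eq′ z z′ tt tt l
          p : w ≡ x
          p = ⌊⌋⁻ (subst T (sym (cong proj₂ e)) m)
          p′ : w′ ≡ x
          p′ = ⌊⌋⁻ (subst T (sym (cong proj₂ e′)) m′)
      in IsStrictTotalOrder.irrefl t (trans p (sym p′)) l′
    unique : ∀ z → T (ρ z) → z ≡ y
    unique z m with IsStrictTotalOrder.compare u z y
    ... | tri< l _ _ = ⊥-elim (no-two z y m ry l)
    ... | tri≈ _ e _ = e
    ... | tri> _ _ g = ⊥-elim (no-two y z ry m g)
  holds-transfer (ex₂ φ) (suc k) (s≤s r) 𝔐 𝔑 t u {C} {c} {d} mark set {xs} {ys} {Ps} {Qs} eq α β (P , h) =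
    let ρ , eq′ = tp-forth {D = Bool , finite-Bool} {ks = moves k} eq P
    in ρ , holds-transfer φ k r 𝔐 𝔑 t u (λ a → mark (proj₁ a)) (mark₁ set) (sym eq′)
          (record { only = α.only ; marked = α.marked ; member = λ { fzero z → refl ; (fsuc j) z → α.member j z } })
          (record { only = β.only ; marked = β.marked ; member = λ { fzero z → refl ; (fsuc j) z → β.member j z } }) h
    where
    module α = Codes α
    module β = Codes β

  colourless : {X : Set} → X → ⊤
  colourless _ = tt

  sentence-transfer : (𝔐 𝔑 : Structure) → Total 𝔐 → Total 𝔑 →
    (∀ ks → tp (Structure._<_ 𝔐) ks All colourless ≡ tp (Structure._<_ 𝔑) ks All colourless) →
    ∀ φ → 𝔐 ⊨ φ → 𝔑 ⊨ φ
  sentence-transfer 𝔐 𝔑 t u eq φ = holds-transfer φ (rank φ) ℕ.≤-refl 𝔐 𝔑 t u (λ _ ()) (λ _ ()) (eq _) trivial trivial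
    where
    trivial : ∀ {X : Set} → Codes {X} {⊤} colourless (λ _ ()) (λ _ ()) [] []
    trivial = record { only = λ () ; marked = λ () ; member = λ () }

  module _ {X Y : Set} {_<_ : Rel X 0ℓ} {_≺_ : Rel Y 0ℓ} (irr : ∀ x → ¬ x < x) (irr′ : ∀ y → ¬ y ≺ y)
           (ι : X → Y) (mono : ∀ x x′ → x < x′ → ι x ≺ ι x′) (back : ∀ x x′ → ι x ≺ ι x′ → x < x′)
           (inj : ∀ x x′ → ι x ≡ ι x′ → x ≡ x′) (B : Subset Y)
           (into : ∀ x → ι x ∈ B) (onto : ∀ y → y ∈ B → ∃[ x ] ι x ≡ y) where

    -- Invariance under isomorphism as a degenerate composition: `X` and `B` are both sums of
    -- one-point fibres over `B`.
    image-type : ∀ ks → tp _<_ ks All colourless ≡ tp _≺_ ks B colourless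
    image-type ks = compose ks finite-⊤ {L = Ty ks ⊤} (λ t → t) {f = ι} {I = B} {l = l} {g = λ y → y} {I′ = B} {l′ = l}
      (record { into = λ x _ → into x ; mono = λ x x′ _ _ m → inj₁ (mono x x′ m) ; back = λ x x′ _ _ → back x x′ })
      (record { into = λ y y∈ → y∈ ; mono = λ _ _ _ _ m → inj₁ m ; back = λ _ _ _ _ m → m })
      typed (λ _ _ → refl) refl
      where
      l : Y → Ty ks ⊤
      l j = tp _≺_ ks (fibre B (λ y → y) j) colourless
      typed : ∀ j → j ∈ B → tp _<_ ks (fibre All ι j) colourless ≡ l j
      typed j j∈ = let x , e = onto j j∈ in
        tp-single irr irr′ ks x j (⌊⌋⁺ (tt , e)) (λ x′ x′∈ → inj x′ x (trans (proj₂ (⌊⌋⁻ x′∈)) (sym e)))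
          (⌊⌋⁺ (j∈ , refl)) (λ y y∈ → proj₂ (⌊⌋⁻ y∈)) refl

-- König's argument for countable covers of the binary sequences.

module Koenig (em : ExcludedMiddle 0ℓ) (ext : Extensionality 0ℓ 0ℓ) where
  open Classical em ext
  open Pairing

  Sequence : Set
  Sequence = ℕ → Bool

  Big : (Sequence → Set) → Set
  Big S = Σ (Sequence → Sequence) λ g → (∀ r r′ → g r ≡ g r′ → r ≡ r′) × (∀ r → S (g r))

  big-⊆ : ∀ {S S′ : Sequence → Set} → (∀ r → S r → S′ r) → Big S → Big S′
  big-⊆ sub (g , inj , g∈) = g , inj , λ r → sub _ (g∈ r)

  -- By the pairing of indices one binary sequence codes a sequence of them. Any family of slices
  -- can be prescribed at once (`slice-interleave`), which is what diagonalising requires.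
  slice : ℕ → Sequence → Sequence
  slice m r k = r (proj₁ (unpair-surjective m k))

  interleave : (ℕ → Sequence) → Sequence
  interleave z n = z (proj₁ (unpair n)) (proj₂ (unpair n))

  slice-interleave : ∀ z m → slice m (interleave z) ≡ z m
  slice-interleave z m = ext λ k →
    cong (λ p → z (proj₁ p) (proj₂ p)) (proj₂ (unpair-surjective m k))

  -- König's argument: the sequence whose n-th slice is missed by S n lies in no S n.
  koenig : (S : ℕ → Sequence → Set) → (∀ r → ∃[ n ] S n r) → ∃[ n ] Big (S n)
  koenig S cover = by-contradiction λ none →
    let missed : ∀ n → ∃[ z ] (∀ r → S n r → ¬ slice n r ≡ z)
        missed n = by-contradiction λ all →
          let hit : ∀ z → ∃[ r ] (S n r × slice n r ≡ z)
              hit z = by-contradiction λ no-r → all (z , λ r r∈ e → no-r (r , r∈ , e))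
          in none (n , (λ z → proj₁ (hit z)) ,
                   (λ z z′ e → trans (sym (proj₂ (proj₂ (hit z)))) (trans (cong (slice n) e) (proj₂ (proj₂ (hit z′))))) ,
                   (λ z → proj₁ (proj₂ (hit z))))
        w = interleave (λ n → proj₁ (missed n))
        n , w∈ = cover w
    in proj₂ (missed n) w w∈ (slice-interleave (λ n → proj₁ (missed n)) n)

  koenig-within : ∀ {T : Sequence → Set} → Big T → (S : ℕ → Sequence → Set) →
                  (∀ r → T r → ∃[ n ] S n r) → ∃[ n ] Big (S n)
  koenig-within (g , inj , g∈) S cover =
    let n , h , inj′ , h∈ = koenig (λ n r → S n (g r)) (λ r → cover (g r) (g∈ r))
    in n , (λ r → g (h r)) , (λ r r′ e → inj′ r r′ (inj _ _ e)) , h∈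

  big-two : ∀ {S} → Big S → ∃[ r ] ∃[ r′ ] (S r × S r′ × r ≢ r′)
  big-two (g , inj , g∈) = g (λ _ → true) , g (λ _ → false) , g∈ _ , g∈ _ ,
    λ e → distinct (cong (λ f → f 0) (inj _ _ e))
    where
    distinct : ¬ true ≡ false
    distinct ()

-- The real line, condensation points and the two given orders.

module Reals (em : ExcludedMiddle 0ℓ) (ext : Extensionality 0ℓ 0ℓ) where
  open Classical em ext
  open Types em ext
  open Orders em ext using (module Order)
  open Pairing
  open Koenig em ext
  open Formulas em ext

  -- The conditions on a cut are irrelevant. Excluded middle decides the conclusion, and `recompute`
  -- turns its irrelevant proof into a usable one.
  lower-down : ∀ x {p q} → p ℚ.< q → q ∈ lower x → p ∈ lower x
  lower-down (cut l _ _ d _) p<q q∈ = recompute em (d _ _ p<q q∈)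

  lower-open : ∀ x {p} → p ∈ lower x → ∃[ q ] (p ℚ.< q × q ∈ lower x)
  lower-open (cut l _ _ _ o) p∈ = recompute em (o _ p∈)

  lower-injective : ∀ {x y} → lower x ≡ lower y → x ≡ y
  lower-injective {cut l _ _ _ _} {cut .l _ _ _ _} refl = refl

  lower-< : ∀ x {p q} → p ∈ lower x → ¬ q ∈ lower x → p ℚ.< q
  lower-< x {p} {q} p∈ q∉ with ℚ.<-cmp p q
  ... | tri< l _ _ = l
  ... | tri≈ _ refl _ = ⊥-elim (q∉ p∈)
  ... | tri> _ _ g = ⊥-elim (q∉ (lower-down x g p∈))

  <ℝ-irrefl : ∀ x → ¬ x <ℝ x
  <ℝ-irrefl x (q , q∉ , q∈) = q∉ q∈

  <ℝ-⊆ : ∀ x y {q} → x <ℝ y → q ∈ lower x → q ∈ lower y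
  <ℝ-⊆ x y (p , p∉ , p∈) q∈ = lower-down y (lower-< x q∈ p∉) p∈

  <ℝ-trans : ∀ x y z → x <ℝ y → y <ℝ z → x <ℝ z
  <ℝ-trans x y z x<y (r , r∉ , r∈) = r , (λ r∈x → r∉ (<ℝ-⊆ x y x<y r∈x)) , r∈

  <ℝ-isStrictTotalOrder : IsStrictTotalOrder _≡_ _<ℝ_
  <ℝ-isStrictTotalOrder = isStrictTotalOrderᶜ record
    { isEquivalence = isEquivalence ; trans = λ {x} {y} {z} → <ℝ-trans x y z ; compare = compare }
    where
    compare : ∀ x y → _
    compare x y with em {x <ℝ y} | em {y <ℝ x}
    ... | yes l | _     = tri< l (λ { refl → <ℝ-irrefl x l }) (λ g → <ℝ-irrefl x (<ℝ-trans x y x l g))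
    ... | no n  | yes g = tri> n (λ { refl → <ℝ-irrefl x g }) g
    ... | no n  | no n′ = tri≈ n (lower-injective (subset-ext
            (λ {q} q∈ → by-contradiction λ q∉ → n′ (q , q∉ , q∈))
            (λ {q} q∈ → by-contradiction λ q∉ → n (q , q∉ , q∈)))) n′

  enumerate-ℤ : ℕ × ℕ → ℤ
  enumerate-ℤ (zero , m)  = + m
  enumerate-ℤ (suc _ , m) = -[1+ m ]

  enumerate-ℚ : ℕ → ℚ
  enumerate-ℚ k = let a , d = unpair k in enumerate-ℤ (unpair a) ℚ./ suc d

  enumerate-ℚ-surjective : ∀ q → ∃[ k ] enumerate-ℚ k ≡ q
  enumerate-ℚ-surjective q =
    let a , ea = integer (ℚ.numerator q)
        k , ek = unpair-surjective a (ℚ.denominator-1 q)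
    in k , trans (cong (λ p → enumerate-ℤ (unpair (proj₁ p)) ℚ./ suc (proj₂ p)) ek)
             (trans (cong (λ z → z ℚ./ suc (ℚ.denominator-1 q)) ea) (ℚ.↥p/↧p≡p q))
    where
    integer : ∀ z → ∃[ a ] enumerate-ℤ (unpair a) ≡ z
    integer (+ m)    = let a , e = unpair-surjective 0 m in a , cong enumerate-ℤ e
    integer -[1+ m ] = let a , e = unpair-surjective 1 m in a , cong enumerate-ℤ e

  reals : SeparableOrder
  reals = record
    { X = ℝ ; _<_ = _<ℝ_ ; sto = <ℝ-isStrictTotalOrder
    ; mark = λ n x → ¬ enumerate-ℚ n ∈ lower x
    ; down = λ n {x} {y} x<y q∉ q∈ → q∉ (<ℝ-⊆ x y x<y q∈)
    ; sep = λ { {x} {y} (q , q∉ , q∈) → let n , e = enumerate-ℚ-surjective q in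
        n , (λ h → q∉ (subst (_∈ lower x) e h)) , λ h → h (subst (_∈ lower y) (sym e) q∈) } }

  open Order reals using (Small; NowhereDense; Uniform; _≼_; ≼-<-trans; <-≼-trans)
  open Games em ext reals using (uniform-type)

  below-ℚ : ∀ (q : ℚ) → ∃[ p ] p ℚ.< q
  below-ℚ q = q ℚ.+ ℚ.- 1ℚ , subst (q ℚ.+ ℚ.- 1ℚ ℚ.<_) (ℚ.+-identityʳ q) (ℚ.+-monoʳ-< q {ℚ.- 1ℚ} {0ℚ} (ℚ.negative⁻¹ (ℚ.- 1ℚ)))

  above-ℚ : ∀ (q : ℚ) → ∃[ p ] q ℚ.< p
  above-ℚ q = q ℚ.+ 1ℚ , subst (ℚ._< q ℚ.+ 1ℚ) (ℚ.+-identityʳ q) (ℚ.+-monoʳ-< q {0ℚ} {1ℚ} (ℚ.positive⁻¹ 1ℚ))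

  fromℚ : ℚ → ℝ
  fromℚ q = cut ⟪ (λ p → p ℚ.< q) ⟫
    (let p , l = below-ℚ q in p , ⌊⌋⁺ l)
    (q , λ h → ℚ.<-irrefl refl (⌊⌋⁻ h))
    (λ p r p<r r∈ → ⌊⌋⁺ (ℚ.<-trans p<r (⌊⌋⁻ r∈)))
    (λ p p∈ → let r , p<r , r<q = ℚ.<-dense (⌊⌋⁻ p∈) in r , p<r , ⌊⌋⁺ r<q)

  fromℚ-mono : ∀ p q → p ℚ.< q → fromℚ p <ℝ fromℚ q
  fromℚ-mono p q l = p , (λ h → ℚ.<-irrefl refl (⌊⌋⁻ h)) , ⌊⌋⁺ l

  fromℚ-back : ∀ p q → fromℚ p <ℝ fromℚ q → p ℚ.< q
  fromℚ-back p q (r , r∉ , r∈) = ℚ.≤-<-trans (ℚ.≮⇒≥ λ r<p → r∉ (⌊⌋⁺ r<p)) (⌊⌋⁻ r∈)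

  fromℚ-injective : ∀ p q → fromℚ p ≡ fromℚ q → p ≡ q
  fromℚ-injective p q e with ℚ.<-cmp p q
  ... | tri< l _ _ = ⊥-elim (<ℝ-irrefl (fromℚ q) (subst (_<ℝ fromℚ q) e (fromℚ-mono p q l)))
  ... | tri≈ _ e′ _ = e′
  ... | tri> _ _ g = ⊥-elim (<ℝ-irrefl (fromℚ q) (subst (fromℚ q <ℝ_) e (fromℚ-mono q p g)))

  <ℝ-dense : ∀ x y → x <ℝ y → ∃[ z ] (x <ℝ z × z <ℝ y)
  <ℝ-dense x y (q , q∉ , q∈) =
    let r , q<r , r∈ = lower-open y q∈
    in fromℚ r , (q , q∉ , ⌊⌋⁺ q<r) , (r , (λ h → ℚ.<-irrefl refl (⌊⌋⁻ h)) , r∈)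

  Rationals : Subset ℝ
  Rationals = ⟪ (λ x → ∃[ q ] x ≡ fromℚ q) ⟫

  -- The rationals are enumerated, so by König's argument a single one would be the value at
  -- continuum many sequences, against injectivity.
  rationals-small : Small Rationals
  rationals-small (f , f∈ , inj , _) =
    let n , big = koenig (λ n r → f r ≡ fromℚ (enumerate-ℚ n)) λ r →
          let q , e = ⌊⌋⁻ (f∈ r) ; n , e′ = enumerate-ℚ-surjective q in n , trans e (cong fromℚ (sym e′))
        r , r′ , e , e′ , r≢r′ = big-two {λ r → f r ≡ fromℚ (enumerate-ℚ n)} big
    in r≢r′ (inj r r′ (trans e (sym e′)))

  module _ (f : Sequence → ℝ) (inj : ∀ r r′ → f r ≡ f r′ → r ≡ r′) (nd : NowhereDense f) where

    Near : ℝ → ℝ → Sequence → Set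
    Near a b r = Between a b (f r)

    -- Continuum many are required near `x`, and not merely uncountably many. Sequences are counted
    -- instead of values, which is the same as `f` is injective.
    Condensation : ℝ → Set
    Condensation x = ∀ a b → Between a b x → Big (Near a b)

    Kernel : Subset ℝ
    Kernel = ⟪ Condensation ⟫

    Box : ℕ → ℝ → Set
    Box n y = enumerate-ℚ (proj₁ (unpair n)) ∈ lower y × ¬ enumerate-ℚ (proj₂ (unpair n)) ∈ lower y

    box-between : ∀ a b x → Between a b x → ∃[ n ] (Box n x × (∀ y → Box n y → Between a b y))
    box-between a b x ((q , q∉a , q∈x) , (q′ , q′∉x , q′∈b)) =
      let i , ei = enumerate-ℚ-surjective q
          j , ej = enumerate-ℚ-surjective q′
          n , en = unpair-surjective i j
          e = trans (cong (λ p → enumerate-ℚ (proj₁ p)) en) ei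
          e′ = trans (cong (λ p → enumerate-ℚ (proj₂ p)) en) ej
      in n , (subst (_∈ lower x) (sym e) q∈x , λ h → q′∉x (subst (_∈ lower x) e′ h)) ,
         λ y (h , h′) → (q , q∉a , subst (_∈ lower y) e h) , (q′ , (λ k → h′ (subst (_∈ lower y) (sym e′) k)) , q′∈b)

    -- As in the Cantor-Bendixson theorem: a value outside the kernel lies in a rational box that
    -- does not contain continuum many values. There are countably many boxes, so by König's
    -- argument either one of these boxes is big, which is absurd, or the part of `S` in the kernel
    -- is.
    kernel-big : ∀ {S} → Big S → Big (λ r → S r × f r ∈ Kernel)
    kernel-big {S} big = result (koenig-within big Parts cover)
      where
      Parts : ℕ → Sequence → Set
      Parts zero    r = S r × f r ∈ Kernel
      Parts (suc n) r = Box n (f r) × ¬ Big (λ r → Box n (f r))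
      cover : ∀ r → S r → ∃[ n ] Parts n r
      cover r r∈ with em {f r ∈ Kernel}
      ... | yes k = 0 , r∈ , k
      ... | no ¬k = by-contradiction λ none → ¬k (⌊⌋⁺ λ a b ab →
            let n , in-box , sub = box-between a b (f r) ab
            in big-⊆ (λ r → sub (f r)) (by-contradiction λ small → none (suc n , in-box , small)))
      result : ∃[ n ] Big (Parts n) → Big (λ r → S r × f r ∈ Kernel)
      result (zero , b)  = b
      result (suc n , b) = let _ , _ , (_ , small) , _ = big-two {Parts (suc n)} b in ⊥-elim (small (big-⊆ {Parts (suc n)} (λ r → proj₁) b))

    everything : Big (λ _ → ⊤)
    everything = (λ r → r) , (λ r r′ e → e) , _

    two-images : ∀ {S} → Big S → ∃[ r ] ∃[ r′ ] (S r × S r′ × f r ≢ f r′)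
    two-images {S} big = let r , r′ , r∈ , r′∈ , ne = big-two {S} big in r , r′ , r∈ , r′∈ , λ e → ne (inj r r′ e)

    kernel-perfect : Perfect Kernel
    kernel-perfect = record
      { closed = λ x cl → ⌊⌋⁺ λ a b ab → let y , ab′ , y∈ = cl a b ab in ⌊⌋⁻ y∈ a b ab′
      -- The interval from `c` to `d` misses all values of `f`, whereas a kernel point in it would
      -- bring values there.
      ; nowhereDense = λ x (a , b , (a<x , x<b) , all) →
          let c , d , a≼c , c<d , d≼b , empty = nd a b (<ℝ-trans a x b a<x x<b)
              y , c<y , y<d = <ℝ-dense c d c<d
              z , cd , z∈ = all y (≼-<-trans {a} {c} {y} a≼c c<y , <-≼-trans {y} {d} {b} y<d d≼b) c d (c<y , y<d)
              r , _ , (l , l′) , _ = big-two {Near c d} (⌊⌋⁻ z∈ c d cd)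
          in empty r l l′
      -- Near a condensation point the kernel has two distinct values of `f`, and at most one of
      -- them is `x` itself.
      ; noIsolated = λ x x∈ a b ab → isolated x a b (two-images {λ r → Near a b r × f r ∈ Kernel} (kernel-big {Near a b} (⌊⌋⁻ x∈ a b ab)))
      ; twoPoints = let r , r′ , (_ , r∈) , (_ , r′∈) , ne = two-images {λ r → ⊤ × f r ∈ Kernel} (kernel-big {λ _ → ⊤} everything)
                    in f r , f r′ , r∈ , r′∈ , ne }
      where
      isolated : ∀ x a b → ∃[ r ] ∃[ r′ ] ((Near a b r × f r ∈ Kernel) × (Near a b r′ × f r′ ∈ Kernel) × f r ≢ f r′) →
                 ∃[ y ] (Between a b y × y ∈ Kernel × y ≢ x)
      isolated x a b (r , r′ , (l , r∈) , (l′ , r′∈) , ne) with em {f r ≡ x}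
      ... | no n  = f r , l , r∈ , n
      ... | yes e = f r′ , l′ , r′∈ , λ e′ → ne (trans e (sym e′))

  small-of-perfect : ∀ (M : Subset ℝ) → (∀ P → Perfect P → Elements (P ∩ M) <ᶜ (ℕ → Bool)) → Small M
  small-of-perfect M hyp (f , f∈ , inj , nd) =
    let g , g-inj , g∈ = kernel-big f inj nd {λ _ → ⊤} (everything f inj nd)
        P = Kernel f inj nd
        h : Sequence → Elements (P ∩ M)
        h r = f (g r) , Equivalence.from T-∧ (proj₂ (g∈ r) , f∈ (g r))
    in proj₂ (hyp P (kernel-perfect f inj nd)) (mk↣ {to = h} λ {r} {r′} e → g-inj r r′ (inj _ _ (cong proj₁ e)))

  elements-≡ : ∀ {M : Subset ℝ} (x y : Elements M) → proj₁ x ≡ proj₁ y → x ≡ y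
  elements-≡ (x , p) (.x , p′) refl = cong (x ,_) (T-irrelevant p p′)

  only-colour : Subset ⊤
  only-colour _ = true

  rationals-uniform : Uniform only-colour Rationals colourless
  rationals-uniform = record
    { dense = record
      { colour = λ _ _ → tt
      ; between = λ x y x∈ y∈ x<y _ _ → between x y (⌊⌋⁻ x∈) (⌊⌋⁻ y∈) x<y }
    ; inhabited = fromℚ 0ℚ , ⌊⌋⁺ (0ℚ , refl)
    ; noLeast = λ x x∈ → lower-point x (⌊⌋⁻ x∈)
    ; noGreatest = λ x x∈ → upper-point x (⌊⌋⁻ x∈) }
    where
    between : ∀ x y → ∃[ p ] x ≡ fromℚ p → ∃[ q ] y ≡ fromℚ q → x <ℝ y → ∃[ z ] (z ∈ Rationals × x <ℝ z × z <ℝ y × tt ≡ tt)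
    between _ _ (p , refl) (q , refl) l =
      let r , p<r , r<q = ℚ.<-dense (fromℚ-back p q l)
      in fromℚ r , ⌊⌋⁺ (r , refl) , fromℚ-mono p r p<r , fromℚ-mono r q r<q , refl
    lower-point : ∀ x → ∃[ p ] x ≡ fromℚ p → ∃[ z ] (z ∈ Rationals × z <ℝ x)
    lower-point _ (p , refl) = let r , l = below-ℚ p in fromℚ r , ⌊⌋⁺ (r , refl) , fromℚ-mono r p l
    upper-point : ∀ x → ∃[ p ] x ≡ fromℚ p → ∃[ z ] (z ∈ Rationals × x <ℝ z)
    upper-point _ (p , refl) = let r , l = above-ℚ p in fromℚ r , ⌊⌋⁺ (r , refl) , fromℚ-mono p r l

  rationals-type : ∀ ks → tp ℚ._<_ ks All colourless ≡ tp _<ℝ_ ks Rationals colourless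
  rationals-type = image-type (λ q → ℚ.<-irrefl refl) <ℝ-irrefl fromℚ fromℚ-mono fromℚ-back fromℚ-injective Rationals
    (λ q → ⌊⌋⁺ (q , refl)) (λ y y∈ → let q , e = ⌊⌋⁻ y∈ in q , sym e)

  module _ (M : Subset ℝ) (m : Elements M) (dlo : IsDenseLinearOrder _≡_ (Structure._<_ (suborder M)))
           (noFirst : NoFirst (suborder M)) (noLast : NoLast (suborder M)) where

    suborder-uniform : Uniform only-colour M colourless
    suborder-uniform = record
      { dense = record
        { colour = λ _ _ → tt
        ; between = λ x y x∈ y∈ x<y _ _ →
            let (z , z∈) , l , l′ = IsDenseLinearOrder.dense dlo {x , x∈} {y , y∈} x<y in z , z∈ , l , l′ , refl }
      ; inhabited = m
      ; noLeast = λ x x∈ → let (y , y∈) , l = noFirst (x , x∈) in y , y∈ , l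
      ; noGreatest = λ x x∈ → let (y , y∈) , l = noLast (x , x∈) in y , y∈ , l }

    suborder-type : ∀ ks → tp (Structure._<_ (suborder M)) ks All colourless ≡ tp _<ℝ_ ks M colourless
    suborder-type = image-type (λ x → <ℝ-irrefl (proj₁ x)) <ℝ-irrefl proj₁ (λ _ _ l → l) (λ _ _ l → l) elements-≡ M
      proj₂ (λ y y∈ → (y , y∈) , refl)

    same-types : Small M → ∀ ks → tp (Structure._<_ (suborder M)) ks All colourless ≡ tp ℚ._<_ ks All colourless
    same-types small ks = trans (suborder-type ks) (trans
      (uniform-type _ ks refl finite-⊤ suborder-uniform rationals-uniform small rationals-small)
      (sym (rationals-type ks)))

theorem7p4 : ExcludedMiddle 0ℓ →
    Extensionality 0ℓ 0ℓ →
    (M : Subset ℝ) →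
    Elements M →
    IsDenseLinearOrder _≡_ (Structure._<_ (suborder M)) →
    NoFirst (suborder M) →
    NoLast (suborder M) →
    (∀ (P : Subset ℝ) → Perfect P → Elements (P ∩ M) <ᶜ (ℕ → Bool)) →
    MonadicTheory (suborder M) ≐ MonadicTheory rationals
theorem7p4 em ext M m dlo noFirst noLast hyp =
  (λ {φ} → sentence-transfer (suborder M) rationals M-total ℚ.<-isStrictTotalOrder types φ) ,
  (λ {φ} → sentence-transfer rationals (suborder M) ℚ.<-isStrictTotalOrder M-total (λ ks → sym (types ks)) φ)
  where
  open Reals em ext
  open Formulas em ext
  M-total = IsDenseLinearOrder.isStrictTotalOrder dlo
  types = same-types M m dlo noFirst noLast (small-of-perfect M hyp)
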